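{- Both of the following problems are fixed-parameter tractable with respect to the parameter $d=|X|$. Input: a finite simple connected undirected graph $G$, a subset $X\subseteq V(G)$ such that $G\setminus X$ is a cluster graph, and an integer $k$. Question (CF-CN coloring): does $G$ have a conflict-free closed neighborhood coloring $V(G)\to\{1,\dots,k\}$? Question (CF-ON coloring): does $G$ have a conflict-free open neighborhood coloring $V(G)\to\{1,\dots,k\}$? That is, for each of the two problems there are a computable function $f$ and an algorithm that decides the problem in time $f(d)\cdot |V(G)|^{O(1)}$.
   Context: A cluster graph is a disjoint union of complete graphs. The cluster vertex deletion number of $G$ is the minimum size of a set $X\subseteq V(G)$ such that $G\setminus X$ (the graph obtained by deleting the vertices of $X$) is a cluster graph; such a set $X$ is called a modulator to cluster graphs and is assumed to be given as part of the input, the parameter being its size $d=|X|$. Let $N(v)$ be the set of vertices adjacent to $v$ and $N[v]=N(v)\cup\{v\}$. For a coloring $C_G:V(G)\to\{1,\dots,k\}$ (not necessarily proper), a set $U\subseteq V(G)$ has a unique color if there is a color $c$ with $|\{u\in U: C_G(u)=c\}|=1$. The coloring $C_G$ is a conflict-free closed neighborhood (CF-CN) coloring if $N[v]$ has a unique color for every $v\in V(G)$, and a conflict-free open neighborhood (CF-ON) coloring if $N(v)$ has a unique color for every $v\in V(G)$. -}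

module Defs where

open import Data.Bool using (Bool; true; false)
open import Data.Fin using (Fin; _≟_)
open import Data.Fin.Subset using (Subset; _∈_; _∉_; _∩_; _∪_; ⁅_⁆; ∣_∣)
open import Data.Nat using (ℕ; zero; suc; _+_; _*_; _^_; _≤_; NonZero)
open import Data.Product using (_×_; _,_; ∃; ∃-syntax)
open import Data.Vec using (Vec; []; _∷_; tabulate)
open import Function.Bundles using (_⇔_)
open import Relation.Binary.Construct.Closure.ReflexiveTransitive using (Star)
open import Relation.Binary.PropositionalEquality using (_≡_; _≢_; refl)
open import Relation.Nullary.Decidable using (does)
open import Relation.Nullary.Reflects using (Reflects)

-- Finite simple undirected graphs on the vertex set Fin n; N v is the
-- open neighbourhood of v.
record Graph (n : ℕ) : Set where
  field
    N      : Fin n → Subset n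
    sym    : ∀ {u v} → u ∈ N v → v ∈ N u
    irrefl : ∀ {v} → v ∉ N v

  Adj : Fin n → Fin n → Set
  Adj u v = v ∈ N u

  N[_] : Fin n → Subset n
  N[ v ] = N v ∪ ⁅ v ⁆

open Graph public

-- A connected graph has at least one vertex.
Connected : ∀ {n} → Graph n → Set
Connected {n} G = NonZero n × (∀ u v → Star (Adj G) u v)

-- G ∖ X is a disjoint union of complete graphs: its vertices are split
-- into m parts (some possibly empty), each part is complete, and there
-- are no edges between parts. Values of part on X are irrelevant.
IsClusterModulator : ∀ {n} → Graph n → Subset n → Set
IsClusterModulator {n} G X =
  ∃[ m ] ∃ λ (part : Fin n → Fin m) →
    ∀ {u v} → u ∉ X → v ∉ X → u ≢ v → Adj G u v ⇔ part u ≡ part v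

-- Arbitrary, not necessarily proper; Fin k plays the role of {1, …, k}.
Colouring : ℕ → ℕ → Set
Colouring n k = Fin n → Fin k

colourClass : ∀ {n k} → Colouring n k → Fin k → Subset n
colourClass C c = tabulate λ u → does (C u ≟ c)

HasUniqueColour : ∀ {n k} → Colouring n k → Subset n → Set
HasUniqueColour C U = ∃[ c ] ∣ U ∩ colourClass C c ∣ ≡ 1

IsCFCN : ∀ {n k} → Graph n → Colouring n k → Set
IsCFCN G C = ∀ v → HasUniqueColour C (N[_] G v)

IsCFON : ∀ {n k} → Graph n → Colouring n k → Set
IsCFON G C = ∀ v → HasUniqueColour C (N G v)

-- Jones's WHILE language (Computability and Complexity from a
-- Programming Perspective, 1997), written point-free. Data are binary
-- trees. Every operation has unit cost: trees are immutable, so they can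
-- be stored with sharing as pointers to cons cells, and each step below
-- is then a constant number of pointer operations. Running times are
-- hence polynomially related to those of Turing machines and RAMs.

data Tree : Set where
  nil : Tree
  _∙_ : Tree → Tree → Tree

hd : Tree → Tree
hd nil     = nil
hd (x ∙ y) = x

tl : Tree → Tree
tl nil     = nil
tl (x ∙ y) = y

infixr 5 _⨾_

data Prog : Set where
  `id `nil `hd `tl  : Prog
  `cons             : Prog → Prog → Prog
  _⨾_               : Prog → Prog → Prog
  `if_`then_`else_  : Prog → Prog → Prog → Prog
  `while_`do_       : Prog → Prog → Prog

-- p ⟨ x ⟩⇓ y ∣ t: on input x, program p halts with output y after t steps.
-- Conditions are false exactly when they evaluate to nil. A loop
-- `while p `do q replaces its state x by q(x) as long as p(x) is not nil.
data _⟨_⟩⇓_∣_ : Prog → Tree → Tree → ℕ → Set where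
  ⇓id    : ∀ {x} → `id  ⟨ x ⟩⇓ x    ∣ 1
  ⇓nil   : ∀ {x} → `nil ⟨ x ⟩⇓ nil  ∣ 1
  ⇓hd    : ∀ {x} → `hd  ⟨ x ⟩⇓ hd x ∣ 1
  ⇓tl    : ∀ {x} → `tl  ⟨ x ⟩⇓ tl x ∣ 1
  ⇓cons  : ∀ {p q x y z s t} →
           p ⟨ x ⟩⇓ y ∣ s → q ⟨ x ⟩⇓ z ∣ t →
           `cons p q ⟨ x ⟩⇓ y ∙ z ∣ suc (s + t)
  ⇓seq   : ∀ {p q x y z s t} →
           p ⟨ x ⟩⇓ y ∣ s → q ⟨ y ⟩⇓ z ∣ t →
           (p ⨾ q) ⟨ x ⟩⇓ z ∣ suc (s + t)
  ⇓then  : ∀ {p q r x a b y s t} →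
           p ⟨ x ⟩⇓ a ∙ b ∣ s → q ⟨ x ⟩⇓ y ∣ t →
           (`if p `then q `else r) ⟨ x ⟩⇓ y ∣ suc (s + t)
  ⇓else  : ∀ {p q r x y s t} →
           p ⟨ x ⟩⇓ nil ∣ s → r ⟨ x ⟩⇓ y ∣ t →
           (`if p `then q `else r) ⟨ x ⟩⇓ y ∣ suc (s + t)
  ⇓stop  : ∀ {p q x s} →
           p ⟨ x ⟩⇓ nil ∣ s →
           (`while p `do q) ⟨ x ⟩⇓ x ∣ suc s
  ⇓loop  : ∀ {p q x a b y z r s t} →
           p ⟨ x ⟩⇓ a ∙ b ∣ r → q ⟨ x ⟩⇓ y ∣ s →
           (`while p `do q) ⟨ y ⟩⇓ z ∣ t →
           (`while p `do q) ⟨ x ⟩⇓ z ∣ suc (r + s + t)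

⇓-deterministic : ∀ {p x y z s t} → p ⟨ x ⟩⇓ y ∣ s → p ⟨ x ⟩⇓ z ∣ t →
                  y ≡ z × s ≡ t
⇓-deterministic ⇓id  ⇓id  = refl , refl
⇓-deterministic ⇓nil ⇓nil = refl , refl
⇓-deterministic ⇓hd  ⇓hd  = refl , refl
⇓-deterministic ⇓tl  ⇓tl  = refl , refl
⇓-deterministic (⇓cons a b) (⇓cons a′ b′)
  with refl , refl ← ⇓-deterministic a a′
  with refl , refl ← ⇓-deterministic b b′ = refl , refl
⇓-deterministic (⇓seq a b) (⇓seq a′ b′)
  with refl , refl ← ⇓-deterministic a a′
  with refl , refl ← ⇓-deterministic b b′ = refl , refl
⇓-deterministic (⇓then a b) (⇓then a′ b′)
  with refl , refl ← ⇓-deterministic a a′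
  with refl , refl ← ⇓-deterministic b b′ = refl , refl
⇓-deterministic (⇓then a b) (⇓else a′ b′) with () , _ ← ⇓-deterministic a a′
⇓-deterministic (⇓else a b) (⇓then a′ b′) with () , _ ← ⇓-deterministic a a′
⇓-deterministic (⇓else a b) (⇓else a′ b′)
  with refl , refl ← ⇓-deterministic a a′
  with refl , refl ← ⇓-deterministic b b′ = refl , refl
⇓-deterministic (⇓stop a) (⇓stop a′)
  with refl , refl ← ⇓-deterministic a a′ = refl , refl
⇓-deterministic (⇓stop a) (⇓loop a′ b′ c′) with () , _ ← ⇓-deterministic a a′
⇓-deterministic (⇓loop a b c) (⇓stop a′) with () , _ ← ⇓-deterministic a a′
⇓-deterministic (⇓loop a b c) (⇓loop a′ b′ c′)
  with refl , refl ← ⇓-deterministic a a′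
  with refl , refl ← ⇓-deterministic b b′
  with refl , refl ← ⇓-deterministic c c′ = refl , refl

⌜_⌝ᵇ : Bool → Tree
⌜ false ⌝ᵇ = nil
⌜ true  ⌝ᵇ = nil ∙ nil

⌜_⌝ⁿ : ℕ → Tree
⌜ zero  ⌝ⁿ = nil
⌜ suc n ⌝ⁿ = nil ∙ ⌜ n ⌝ⁿ

encodeVec : ∀ {A : Set} {n} → (A → Tree) → Vec A n → Tree
encodeVec enc []       = nil
encodeVec enc (x ∷ xs) = enc x ∙ encodeVec enc xs

encodeSubset : ∀ {n} → Subset n → Tree
encodeSubset = encodeVec ⌜_⌝ᵇ

Computable : (ℕ → ℕ) → Set
Computable f = ∃[ p ] ∀ d → ∃[ t ] p ⟨ ⌜ d ⌝ⁿ ⟩⇓ ⌜ f d ⌝ⁿ ∣ t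

record ParameterizedProblem : Set₁ where
  field
    Instance  : Set
    encode    : Instance → Tree
    parameter : Instance → ℕ
    size      : Instance → ℕ
    Question  : Instance → Set

FixedParameterTractable : ParameterizedProblem → Set
FixedParameterTractable P =
  ∃[ f ] Computable f ×
  ∃[ p ] ∃[ c ] ∀ (I : Instance) →
    ∃[ answer ] ∃[ t ]
      p ⟨ encode I ⟩⇓ ⌜ answer ⌝ᵇ ∣ t ×
      Reflects (Question I) answer ×
      t ≤ f (parameter I) * size I ^ c
  where open ParameterizedProblem P

record CFInstance : Set where
  field
    {n}       : ℕ
    G         : Graph n
    connected : Connected G
    X         : Subset n
    modulator : IsClusterModulator G X
    k         : ℕ

-- The adjacency matrix of G, the characteristic vector of X and k; the
-- proofs in the instance are promises that the program does not see.
-- Writing k in unary gives the program no extra time, since the time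
-- bound depends on ∣ X ∣ and n only.
encodeCF : CFInstance → Tree
encodeCF I = encodeVec encodeSubset (tabulate (N G)) ∙ (encodeSubset X ∙ ⌜ k ⌝ⁿ)
  where open CFInstance I

CFProblem : (∀ {n k} → Graph n → Colouring n k → Set) → ParameterizedProblem
CFProblem IsConflictFree = record
  { Instance  = CFInstance
  ; encode    = encodeCF
  ; parameter = λ I → ∣ CFInstance.X I ∣
  ; size      = λ I → CFInstance.n I
  ; Question  = λ I → let open CFInstance I in
                      ∃ λ (C : Colouring n k) → IsConflictFree G C
  }

CF-CN-Colouring : ParameterizedProblem
CF-CN-Colouring = CFProblem IsCFCN

CF-ON-Colouring : ParameterizedProblem
CF-ON-Colouring = CFProblem IsCFON

{-# OPTIONS --safe #-}
module Submission where

open import Defs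
open import Data.Bool as Bool using (Bool; true; false; if_then_else_; not; _∧_; _∨_; T)
open import Data.Bool.ListAction using (any; all)
open import Data.Bool.Properties using (T-∧; T-∨; T-≡; T?; ∧-zeroʳ; ∧-identityʳ)
open import Data.Empty using (⊥-elim)
open import Data.Fin as Fin using (Fin; zero; suc; toℕ; fromℕ<; inject≤; _↑ˡ_; _↑ʳ_; combine; splitAt)
open import Data.Fin.Properties as Fin using (_≟_; any?; combine-injective; splitAt-↑ˡ; splitAt-↑ʳ; toℕ<n; toℕ-fromℕ<; toℕ-inject≤; toℕ-injective)
open import Data.Fin.Subset using (Subset; ∣_∣; _∩_; _∪_; ⁅_⁆) renaming (_∈_ to _∈ₛ_; _∉_ to _∉ₛ_)
open import Data.Fin.Subset.Properties using (x∈p∪q⁻; x∈p∪q⁺; x∈⁅y⁆⇒x≡y; ∣p∣≤n)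
open import Data.List as List using (List; []; _∷_; length; map; foldr; _ʳ++_; filterᵇ; allFin)
open import Data.List.Membership.Propositional using (_∈_; find; lose)
open import Data.List.Membership.Propositional.Properties using (∈-allFin; ∈-filter⁺; ∈-filter⁻; ∈-map⁺; ∈-map⁻)
open import Data.List.Properties using (length-filter; length-map; length-tabulate; map-tabulate; map-∘)
open import Data.List.Relation.Unary.All as All using (All)
import Data.List.Relation.Unary.All.Properties as All
open import Data.List.Relation.Unary.AllPairs using ([]; _∷_)
open import Data.List.Relation.Unary.Any as Any using (here; there)
open import Data.List.Relation.Unary.Any.Properties using (any⁺; any⁻; lookup-index)
open import Data.List.Relation.Unary.Unique.Propositional using (Unique)
open import Data.List.Relation.Unary.Unique.Propositional.Properties using (allFin⁺)
open import Data.Nat using (ℕ; zero; suc; pred; _+_; _*_; _^_; _∸_; _⊓_; _≡ᵇ_; _≤_; _<_; z≤n; s≤s; >-nonZero⁻¹)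
open import Data.Nat.Properties hiding (_≟_)
open import Data.Nat.Tactic.RingSolver using (solve-∀)
open import Data.Product using (_×_; _,_; ∃-syntax; proj₁; proj₂)
open import Data.Sum as Sum using (_⊎_; inj₁; inj₂)
open import Data.Sum.Properties using (inj₂-injective)
open import Data.Unit using (⊤; tt)
open import Data.Vec using (Vec; []; _∷_; lookup; replicate; tabulate; toList)
open import Data.Vec.Functional using (updateAt)
open import Data.Vec.Functional.Properties using (updateAt-minimal; updateAt-updates)
open import Data.Vec.Properties using (length-toList; lookup-replicate; lookup-zipWith; lookup∘tabulate; tabulate-cong; tabulate∘lookup; []=⇒lookup; lookup⇒[]=)
open import Function using (_∘_; id; const; _⇔_; mk⇔; Equivalence)
open import Relation.Binary.PropositionalEquality renaming (sym to ≡-sym)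
open import Relation.Nullary using (¬_; Dec; yes; no; contradiction)
open import Relation.Nullary.Decidable using (does; _×-dec_)
open import Relation.Nullary.Reflects using (Reflects; ofʸ; ofⁿ)

open Equivalence using (to; from)

-- With d = ∣ X ∣, colours beyond palette d = 2d + 3 are never needed: a
-- colour of its own for every x ∈ X and for one neighbour of every x ∈ X,
-- and three colours for the rest, of which two occur at most once in each
-- clique, so that every vertex sees a unique colour. With at most palette d
-- colours, guess the colours on X and colour the cliques of G ∖ X one after
-- another, remembering only how often (capped at 3) every x ∈ X sees every
-- colour. Inside a clique the final colour counts are guessed in advance,
-- which decides for each of its vertices whether it will see a unique
-- colour. The number of states depends on d only, so the set of reachable
-- states can be maintained as a list.
--
-- For the running time, a program is packaged with a proof that it takes at
-- most W ^ c steps for a fixed weight W ≥ 2 of the instance, and W is the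
-- product of n and a function of d. Such bounds compose, because sums and
-- products of powers of W are bounded by powers of W.

-- The two problems differ only in the diagonal of the adjacency matrix, so everything is done for a
-- matrix that agrees with `G` off the diagonal. The dynamic program rests on the shape of the
-- neighbourhood of a vertex `u` outside `X`: apart from vertices of `X` it is the clique of `u`,
-- with or without `u` itself. Hence `u` depends only on the colours on `X` and on the colour counts
-- of one clique, and can be settled while that clique is coloured. A vertex of `X` collects
-- contributions from all cliques and has to be carried along in the state. The obstacle is `k`,
-- which is bounded neither by `d` nor by `n` and would enter the number of states; the palette
-- removes it. The palette colouring needs a neighbour of every vertex, and an open neighbourhood
-- may be empty. This is no loss: the palette replaces a conflict-free colouring with `k` colours,
-- and such a colouring provides a neighbour of every vertex.

infix 4 _⟨_⟩⇓_within_

_⟨_⟩⇓_within_ : Prog → Tree → Tree → ℕ → Set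
p ⟨ x ⟩⇓ y within T = ∃[ t ] p ⟨ x ⟩⇓ y ∣ t × t ≤ T

exactly : ∀ {p x y t} → p ⟨ x ⟩⇓ y ∣ t → p ⟨ x ⟩⇓ y within t
exactly r = _ , r , ≤-refl

weaken : ∀ {p x y S T} → S ≤ T → p ⟨ x ⟩⇓ y within S → p ⟨ x ⟩⇓ y within T
weaken S≤T (t , r , t≤S) = t , r , ≤-trans t≤S S≤T

seqW : ∀ {p q x y z S T} → p ⟨ x ⟩⇓ y within S → q ⟨ y ⟩⇓ z within T →
       (p ⨾ q) ⟨ x ⟩⇓ z within suc (S + T)
seqW (_ , r , s≤) (_ , r′ , t≤) = _ , ⇓seq r r′ , s≤s (+-mono-≤ s≤ t≤)

consW : ∀ {p q x y z S T} → p ⟨ x ⟩⇓ y within S → q ⟨ x ⟩⇓ z within T →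
        `cons p q ⟨ x ⟩⇓ y ∙ z within suc (S + T)
consW (_ , r , s≤) (_ , r′ , t≤) = _ , ⇓cons r r′ , s≤s (+-mono-≤ s≤ t≤)

thenW : ∀ {p q r x a b y S T} → p ⟨ x ⟩⇓ a ∙ b within S → q ⟨ x ⟩⇓ y within T →
        (`if p `then q `else r) ⟨ x ⟩⇓ y within suc (S + T)
thenW (_ , r , s≤) (_ , r′ , t≤) = _ , ⇓then r r′ , s≤s (+-mono-≤ s≤ t≤)

elseW : ∀ {p q r x y S T} → p ⟨ x ⟩⇓ nil within S → r ⟨ x ⟩⇓ y within T →
        (`if p `then q `else r) ⟨ x ⟩⇓ y within suc (S + T)
elseW (_ , r , s≤) (_ , r′ , t≤) = _ , ⇓else r r′ , s≤s (+-mono-≤ s≤ t≤)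

loopW : ∀ {p q x a b y z R S T} → p ⟨ x ⟩⇓ a ∙ b within R → q ⟨ x ⟩⇓ y within S →
        (`while p `do q) ⟨ y ⟩⇓ z within T → (`while p `do q) ⟨ x ⟩⇓ z within suc (R + S + T)
loopW (_ , r , r≤) (_ , r′ , s≤) (_ , r″ , t≤) =
  _ , ⇓loop r r′ r″ , s≤s (+-mono-≤ (+-mono-≤ r≤ s≤) t≤)

-- Folding over lists

tree : List Tree → Tree
tree []       = nil
tree (a ∷ as) = a ∙ tree as

reverseLoop : Prog
reverseLoop = `while `hd `do `cons (`hd ⨾ `tl) (`cons (`hd ⨾ `hd) `tl)

reverseLoop-run : ∀ as bs →
  reverseLoop ⟨ tree as ∙ tree bs ⟩⇓ nil ∙ tree (as ʳ++ bs) ∣ (length as * 11 + 2)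
reverseLoop-run []       bs = ⇓stop ⇓hd
reverseLoop-run (a ∷ as) bs =
  ⇓loop ⇓hd (⇓cons (⇓seq ⇓hd ⇓tl) (⇓cons (⇓seq ⇓hd ⇓hd) ⇓tl)) (reverseLoop-run as (a ∷ bs))

reverseProg : Prog
reverseProg = `cons `id `nil ⨾ reverseLoop ⨾ `tl

reverseTime : ℕ → ℕ
reverseTime l = suc (3 + suc (l * 11 + 2 + 1))

reverseProg-run : ∀ as → reverseProg ⟨ tree as ⟩⇓ tree (as ʳ++ []) ∣ (reverseTime (length as))
reverseProg-run as = ⇓seq (⇓cons ⇓id ⇓nil) (⇓seq (reverseLoop-run as []) ⇓tl)

-- The list is consumed from its last element, hence the reversal in foldProg.
data Folds (p : Prog) (γ : Tree) (T : ℕ) : List Tree → Tree → Tree → Set where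
  []  : ∀ {e} → Folds p γ T [] e e
  _∷_ : ∀ {a as e e′ e″} → p ⟨ γ ∙ (a ∙ e′) ⟩⇓ e″ within T →
        Folds p γ T as e e′ → Folds p γ T (a ∷ as) e e″

-- Programs have no variables, so the environment, the remaining list and the accumulator travel
-- together as one tree, and the environment is handed to `p` afresh in every round.
foldLoop : Prog → Prog
foldLoop p = `while (`tl ⨾ `hd) `do
  `cons `hd (`cons (`tl ⨾ `hd ⨾ `tl) (`cons `hd (`cons (`tl ⨾ `hd ⨾ `hd) (`tl ⨾ `tl)) ⨾ p))

-- In continuation-passing form: the loop meets the last element first, while `Folds` grows at the
-- front. The run that remains after `as` is therefore a hypothesis, and each `∷` prepends one
-- iteration to it. The 24 pays for the test and the regrouping in one iteration.
foldLoop-run : ∀ {p γ T as e e′ z R} bs → Folds p γ T as e e′ →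
  foldLoop p ⟨ γ ∙ (tree bs ∙ e′) ⟩⇓ z within R →
  foldLoop p ⟨ γ ∙ (tree (as ʳ++ bs) ∙ e) ⟩⇓ z within length as * (24 + T) + R
foldLoop-run bs [] r = r
foldLoop-run {T = T} {as = a ∷ as} {R = R} bs (s ∷ ss) r =
  weaken (≤-reflexive eq) (foldLoop-run (a ∷ bs) ss
    (loopW (exactly (⇓seq ⇓tl ⇓hd))
           (consW (exactly ⇓hd) (consW (exactly (⇓seq ⇓tl (⇓seq ⇓hd ⇓tl)))
             (seqW (exactly (⇓cons ⇓hd (⇓cons (⇓seq ⇓tl (⇓seq ⇓hd ⇓hd)) (⇓seq ⇓tl ⇓tl)))) s)))
           r))
  where
  eq : length as * (24 + T) + (24 + T + R) ≡ 24 + T + length as * (24 + T) + R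
  eq = trans (≡-sym (+-assoc (length as * (24 + T)) (24 + T) R))
             (cong (_+ R) (+-comm (length as * (24 + T)) (24 + T)))

foldProg : Prog → Prog → Prog → Prog
foldProg list init step =
  `cons `id (`cons (list ⨾ reverseProg) init) ⨾ foldLoop step ⨾ `tl ⨾ `tl

foldTime : ℕ → ℕ → ℕ → ℕ → ℕ
foldTime l i T n = suc (suc (1 + suc (suc (l + reverseTime n) + i)) + suc (n * (24 + T) + 4 + 3))

foldProg-run : ∀ {list init step γ as e e′ l i T n} → list ⟨ γ ⟩⇓ tree as within l →
  init ⟨ γ ⟩⇓ e within i → Folds step γ T as e e′ → length as ≤ n →
  foldProg list init step ⟨ γ ⟩⇓ e′ within foldTime l i T n
foldProg-run {as = as} {T = T} {n = n} r r′ fs len =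
  seqW (consW (exactly ⇓id) (consW (seqW r (weaken rev≤ (exactly (reverseProg-run as)))) r′))
       (seqW (weaken (+-monoˡ-≤ 4 (*-monoˡ-≤ (24 + T) len))
                (foldLoop-run [] fs (exactly (⇓stop (⇓seq ⇓tl ⇓hd)))))
             (exactly (⇓seq ⇓tl ⇓tl)))
  where
  rev≤ : reverseTime (length as) ≤ reverseTime n
  rev≤ = +-monoʳ-≤ 5 (+-monoˡ-≤ 1 (+-monoˡ-≤ 2 (*-monoˡ-≤ 11 len)))

-- Uniform families of programs

record Index : Set₁ where
  no-eta-equality
  field
    Ix  : Set
    W   : Ix → ℕ
    2≤W : ∀ i → 2 ≤ W i

open Index public

-- The degree is the same for all indices; the degree of a running time finally becomes the exponent
-- of `n`.
record Size (𝕀 : Index) : Set where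
  constructor size
  field
    value  : Ix 𝕀 → ℕ
    degree : ℕ
    value≤ : ∀ i → value i ≤ W 𝕀 i ^ degree

open Size public

W^-mono : ∀ 𝕀 i {a b} → a ≤ b → W 𝕀 i ^ a ≤ W 𝕀 i ^ b
W^-mono 𝕀 i {a} {b} a≤b with W 𝕀 i | 2≤W 𝕀 i
... | suc w | _ = ^-monoʳ-≤ (suc w) a≤b

n<2^n : ∀ n → n < 2 ^ n
n<2^n zero    = s≤s z≤n
n<2^n (suc n) = ≤-trans (s≤s (n<2^n n)) (subst (suc (2 ^ n) ≤_) eq (+-monoˡ-≤ (2 ^ n) (m^n>0 2 n)))
  where
  eq : 2 ^ n + 2 ^ n ≡ 2 ^ suc n
  eq = cong (2 ^ n +_) (≡-sym (+-identityʳ (2 ^ n)))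

infixl 6 _⊞_
infixl 7 _⊠_

-- Degree `c` is enough because `c < 2 ^ c` and the weight is at least 2.
# : ∀ {𝕀} → ℕ → Size 𝕀
# {𝕀} c = size (λ _ → c) c λ i → ≤-trans (<⇒≤ (n<2^n c)) (^-monoˡ-≤ c (2≤W 𝕀 i))

-- Both summands are raised to a common power; as the weight is at least 2, one further degree
-- absorbs the doubling.
_⊞_ : ∀ {𝕀} → Size 𝕀 → Size 𝕀 → Size 𝕀
_⊞_ {𝕀} (size f a f≤) (size g b g≤) = size (λ i → f i + g i) (suc (a + b)) bound
  where
  bound : ∀ i → f i + g i ≤ W 𝕀 i ^ suc (a + b)
  bound i = begin
    f i + g i                             ≤⟨ +-mono-≤ (≤-trans (f≤ i) (W^-mono 𝕀 i (m≤m+n a b)))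
                                                      (≤-trans (g≤ i) (W^-mono 𝕀 i (m≤n+m b a))) ⟩
    W 𝕀 i ^ (a + b) + W 𝕀 i ^ (a + b)    ≡⟨ cong (W 𝕀 i ^ (a + b) +_) (≡-sym (+-identityʳ _)) ⟩
    2 * W 𝕀 i ^ (a + b)                   ≤⟨ *-monoˡ-≤ (W 𝕀 i ^ (a + b)) (2≤W 𝕀 i) ⟩
    W 𝕀 i ^ suc (a + b)                   ∎
    where open ≤-Reasoning

_⊠_ : ∀ {𝕀} → Size 𝕀 → Size 𝕀 → Size 𝕀
_⊠_ {𝕀} (size f a f≤) (size g b g≤) = size (λ i → f i * g i) (a + b) λ i →
  ≤-trans (*-mono-≤ (f≤ i) (g≤ i)) (≤-reflexive (≡-sym (^-distribˡ-+-* (W 𝕀 i) a b)))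

encodeList : {A : Set} → (A → Tree) → List A → Tree
encodeList f = tree ∘ map f

-- Folding over a list takes time proportional to its length, so a list that is folded over carries
-- a bound. Lists without one only occur as results under construction.
record BoundedList (A : Set) (m : ℕ) : Set where
  constructor bounded
  field
    list    : List A
    length≤ : length list ≤ m

open BoundedList public

-- Repeats `foldTime` summand by summand, so that its value equals `foldTime` by computation.
foldSize : ∀ {𝕀} → Size 𝕀 → Size 𝕀 → Size 𝕀 → Size 𝕀 → Size 𝕀
foldSize l e s L =
  # 1 ⊞ ((# 1 ⊞ (# 1 ⊞ (# 1 ⊞ (# 1 ⊞ (l ⊞ (# 5 ⊞ (L ⊠ # 11 ⊞ # 2 ⊞ # 1))) ⊞ e)))) ⊞
         (# 1 ⊞ (L ⊠ (# 24 ⊞ s) ⊞ # 4 ⊞ # 3)))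

infixl 5 _⊗_

-- Codes for data types whose sizes depend on the index. The value of a
-- Const A c is determined by the index, so that programs with such an
-- input can refer to c i directly.
data Obj (𝕀 : Index) : Set₁
El : ∀ {𝕀} → Obj 𝕀 → Ix 𝕀 → Set

data Obj 𝕀 where
  BoolO NatO  : Obj 𝕀
  FinO        : Size 𝕀 → Obj 𝕀
  _⊗_         : Obj 𝕀 → Obj 𝕀 → Obj 𝕀
  ListO       : Obj 𝕀 → Obj 𝕀
  BListO VecO : Obj 𝕀 → Size 𝕀 → Obj 𝕀
  Const       : (A : Obj 𝕀) → (∀ i → El A i) → Obj 𝕀
  Raw         : (X : Ix 𝕀 → Set) → (∀ i → X i → Tree) → Obj 𝕀

El BoolO        i = Bool
El NatO         i = ℕ
El (FinO L)     i = Fin (value L i)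
El (A ⊗ B)      i = El A i × El B i
El (ListO A)    i = List (El A i)
El (BListO A L) i = BoundedList (El A i) (value L i)
El (VecO A L)   i = Vec (El A i) (value L i)
El (Const A c)  i = ⊤
El (Raw X f)    i = X i

enc : ∀ {𝕀} (A : Obj 𝕀) i → El A i → Tree
enc BoolO        i b          = ⌜ b ⌝ᵇ
enc NatO         i n          = ⌜ n ⌝ⁿ
enc (FinO L)     i j          = ⌜ toℕ j ⌝ⁿ
enc (A ⊗ B)      i (a , b)    = enc A i a ∙ enc B i b
enc (ListO A)    i xs         = encodeList (enc A i) xs
enc (BListO A L) i xs         = encodeList (enc A i) (list xs)
enc (VecO A L)   i xs         = encodeVec (enc A i) xs
enc (Const A c)  i _          = enc A i (c i)
enc (Raw X f)    i x          = f i x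

infix 3 _⟶_

-- One program serves all indices. Program and specification `fun` are composed in parallel, so the
-- meaning of a large program can be read off by computation.
record _⟶_ {𝕀} (Γ B : Obj 𝕀) : Set where
  field
    prog : Prog
    fun  : ∀ i → El Γ i → El B i
    time : Size 𝕀
    run  : ∀ i γ → prog ⟨ enc Γ i γ ⟩⇓ enc B i (fun i γ) within value time i

open _⟶_ public

encodeVec-toList : ∀ {X : Set} (f : X → Tree) {n} (xs : Vec X n) →
                   encodeVec f xs ≡ encodeList f (toList xs)
encodeVec-toList f []       = refl
encodeVec-toList f (x ∷ xs) = cong (f x ∙_) (encodeVec-toList f xs)

encodeVec-tabulate : ∀ {X : Set} (f : X → Tree) {n} (g : Fin n → X) →
                     encodeList f (map g (List.allFin n)) ≡ encodeVec f (tabulate g)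
encodeVec-tabulate f {n} g = trans (cong (encodeList f) (map-tabulate (λ i → i) g)) (go g)
  where
  go : ∀ {n} (g : Fin n → _) → encodeList f (List.tabulate g) ≡ encodeVec f (tabulate g)
  go {zero}  g = refl
  go {suc n} g = cong (f (g zero) ∙_) (go (g ∘ suc))

allFinB : ∀ n → BoundedList (Fin n) n
allFinB n = bounded (List.allFin n) (≤-reflexive (length-tabulate (λ i → i)))

filterB : ∀ {X : Set} {m} → (X → Bool) → BoundedList X m → BoundedList X m
filterB p (bounded xs len) = bounded (filterᵇ p xs) (≤-trans (length-filter (T? ∘ p) xs) len)

isZero : ∀ {n} → Fin n → Bool
isZero zero    = true
isZero (suc _) = false

equalLoop : Prog
equalLoop = `while (`if `hd `then `tl `else `nil) `do `cons (`hd ⨾ `tl) (`tl ⨾ `tl)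

equalProg : Prog
equalProg = equalLoop ⨾ (`if `hd `then `nil `else (`if `tl `then `nil `else `cons `nil `nil))

-- The loop stops as soon as either number is used up, so the first one alone bounds the cost. This
-- permits comparisons with a `NatO`, for which no bound is known.
equal-run : ∀ m n → equalProg ⟨ ⌜ m ⌝ⁿ ∙ ⌜ n ⌝ⁿ ⟩⇓ ⌜ m ≡ᵇ n ⌝ᵇ within 20 + m * 11
equal-run zero zero =
  weaken (m≤m+n 12 8) (exactly (⇓seq (⇓stop (⇓else ⇓hd ⇓nil)) (⇓else ⇓hd (⇓else ⇓tl (⇓cons ⇓nil ⇓nil)))))
equal-run zero (suc n) =
  weaken (m≤m+n 10 10) (exactly (⇓seq (⇓stop (⇓else ⇓hd ⇓nil)) (⇓else ⇓hd (⇓then ⇓tl ⇓nil))))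
equal-run (suc m) zero =
  weaken (≤-trans (m≤m+n 8 12) (m≤m+n 20 _)) (exactly (⇓seq (⇓stop (⇓then ⇓hd ⇓tl)) (⇓then ⇓hd ⇓nil)))
equal-run (suc m) (suc n) with equal-run m n
... | _ , ⇓seq {s = s} {t = t} r r′ , le =
  _ , ⇓seq (⇓loop (⇓then ⇓hd ⇓tl) (⇓cons (⇓seq ⇓hd ⇓tl) (⇓seq ⇓tl ⇓tl)) r) r′ ,
  ≤-trans (+-monoʳ-≤ 11 le) (≤-reflexive (eq (m * 11)))
  where
  eq : ∀ x → 11 + (20 + x) ≡ 20 + (11 + x)
  eq x = refl

lookupLoop : Prog
lookupLoop = `while `tl `do `cons (`hd ⨾ `tl) (`tl ⨾ `tl)

lookupLoop-run : ∀ {X : Set} (f : X → Tree) {n} (xs : Vec X n) (j : Fin n) → ∃[ rest ]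
  lookupLoop ⟨ encodeVec f xs ∙ ⌜ toℕ j ⌝ⁿ ⟩⇓ (f (lookup xs j) ∙ rest) ∙ nil ∣ (toℕ j * 9 + 2)
lookupLoop-run f (x ∷ xs) zero = _ , ⇓stop ⇓tl
lookupLoop-run f (x ∷ xs) (suc j) with lookupLoop-run f xs j
... | rest , r = rest , ⇓loop ⇓tl (⇓cons (⇓seq ⇓hd ⇓tl) (⇓seq ⇓tl ⇓tl)) r

-- Combinators for programs with specification and time bound

module _ {𝕀 : Index} where

  private variable
    Γ A B C : Obj 𝕀
    L M : Size 𝕀

  -- Programs see encodings only, so changing the type or the specification is free as long as the
  -- encoded output stays the same.
  retype : (t : Γ ⟶ A) (f : ∀ i → El Γ i → El B i) →
           (∀ i γ → enc A i (fun t i γ) ≡ enc B i (f i γ)) → Γ ⟶ B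
  retype {B = B} t f eq .prog    = prog t
  retype {B = B} t f eq .fun     = f
  retype {B = B} t f eq .time    = time t
  retype {Γ = Γ} {B = B} t f eq .run i γ =
    subst (λ y → prog t ⟨ enc Γ i γ ⟩⇓ y within value (time t) i) (eq i γ) (run t i γ)

  idC : Γ ⟶ Γ
  idC .prog    = `id
  idC .fun i γ = γ
  idC .time    = # 1
  idC .run i γ = exactly ⇓id

  infixr 9 _∘C_

  _∘C_ : B ⟶ C → Γ ⟶ B → Γ ⟶ C
  (u ∘C t) .prog    = prog t ⨾ prog u
  (u ∘C t) .fun i γ = fun u i (fun t i γ)
  (u ∘C t) .time    = # 1 ⊞ (time t ⊞ time u)
  (u ∘C t) .run i γ = seqW (run t i γ) (run u i (fun t i γ))

  infixr 4 _,C_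

  _,C_ : Γ ⟶ A → Γ ⟶ B → Γ ⟶ A ⊗ B
  (t ,C u) .prog    = `cons (prog t) (prog u)
  (t ,C u) .fun i γ = fun t i γ , fun u i γ
  (t ,C u) .time    = # 1 ⊞ (time t ⊞ time u)
  (t ,C u) .run i γ = consW (run t i γ) (run u i γ)

  fstC : A ⊗ B ⟶ A
  fstC .prog    = `hd
  fstC .fun i   = proj₁
  fstC .time    = # 1
  fstC .run i γ = exactly ⇓hd

  sndC : A ⊗ B ⟶ B
  sndC .prog    = `tl
  sndC .fun i   = proj₂
  sndC .time    = # 1
  sndC .run i γ = exactly ⇓tl

  constC : (c : ∀ i → El A i) → Const A c ⟶ A
  constC c = retype idC (λ i _ → c i) λ _ _ → refl

  -- For tables determined by the index: the computed value moves into the type, and later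
  -- specifications mention `c i` itself.
  known : (t : Γ ⟶ A) (c : ∀ i → El B i) → (∀ i γ → enc A i (fun t i γ) ≡ enc B i (c i)) →
          Γ ⟶ Const B c
  known t c eq = retype t (λ _ _ → tt) eq

  ifC : Γ ⟶ BoolO → Γ ⟶ A → Γ ⟶ A → Γ ⟶ A
  ifC b t u .prog    = `if prog b `then prog t `else prog u
  ifC b t u .fun i γ = if fun b i γ then fun t i γ else fun u i γ
  ifC b t u .time    = # 1 ⊞ (time b ⊞ (time t ⊞ time u))
  ifC b t u .run i γ with fun b i γ | run b i γ
  ... | true  | r = weaken (s≤s (+-monoʳ-≤ (value (time b) i) (m≤m+n _ _))) (thenW r (run t i γ))
  ... | false | r = weaken (s≤s (+-monoʳ-≤ (value (time b) i) (m≤n+m _ _))) (elseW r (run u i γ))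

  falseC : Γ ⟶ BoolO
  falseC .prog    = `nil
  falseC .fun i γ = false
  falseC .time    = # 1
  falseC .run i γ = exactly ⇓nil

  trueC : Γ ⟶ BoolO
  trueC .prog    = `cons `nil `nil
  trueC .fun i γ = true
  trueC .time    = # 3
  trueC .run i γ = exactly (⇓cons ⇓nil ⇓nil)

  notC : Γ ⟶ BoolO → Γ ⟶ BoolO
  notC b = retype (ifC b falseC trueC) (λ i γ → not (fun b i γ)) λ i γ → eq (fun b i γ)
    where
    eq : ∀ b → ⌜ if b then false else true ⌝ᵇ ≡ ⌜ not b ⌝ᵇ
    eq true  = refl
    eq false = refl

  andC : Γ ⟶ BoolO → Γ ⟶ BoolO → Γ ⟶ BoolO
  andC b c = retype (ifC b c falseC) (λ i γ → fun b i γ ∧ fun c i γ) λ i γ → eq (fun b i γ)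
    where
    eq : ∀ b {c} → ⌜ if b then c else false ⌝ᵇ ≡ ⌜ b ∧ c ⌝ᵇ
    eq true  = refl
    eq false = refl

  orC : Γ ⟶ BoolO → Γ ⟶ BoolO → Γ ⟶ BoolO
  orC b c = retype (ifC b trueC c) (λ i γ → fun b i γ ∨ fun c i γ) λ i γ → eq (fun b i γ)
    where
    eq : ∀ b {c} → ⌜ if b then true else c ⌝ᵇ ≡ ⌜ b ∨ c ⌝ᵇ
    eq true  = refl
    eq false = refl

  zeroC : Γ ⟶ NatO
  zeroC = retype falseC (λ _ _ → 0) λ _ _ → refl

  sucC : Γ ⟶ NatO → Γ ⟶ NatO
  sucC t .prog    = `cons `nil (prog t)
  sucC t .fun i γ = suc (fun t i γ)
  sucC t .time    = # 2 ⊞ time t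
  sucC t .run i γ = consW (exactly ⇓nil) (run t i γ)

  predC : Γ ⟶ NatO → Γ ⟶ NatO
  predC t .prog    = prog t ⨾ `tl
  predC t .fun i γ = pred (fun t i γ)
  predC t .time    = # 1 ⊞ (time t ⊞ # 1)
  predC t .run i γ = seqW (run t i γ) (exactly (step (fun t i γ)))
    where
    step : ∀ n → `tl ⟨ ⌜ n ⌝ⁿ ⟩⇓ ⌜ pred n ⌝ⁿ ∣ 1
    step zero    = ⇓tl
    step (suc n) = ⇓tl

  natC : ℕ → Γ ⟶ NatO
  natC zero    = zeroC
  natC (suc n) = sucC (natC n)

  toℕC : Γ ⟶ FinO L → Γ ⟶ NatO
  toℕC t = retype t (λ i γ → toℕ (fun t i γ)) λ _ _ → refl

  isZeroC : Γ ⟶ FinO L → Γ ⟶ BoolO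
  isZeroC t .prog    = `if prog t `then `nil `else `cons `nil `nil
  isZeroC t .fun i γ = isZero (fun t i γ)
  isZeroC t .time    = # 1 ⊞ (time t ⊞ # 3)
  isZeroC t .run i γ = go (fun t i γ) (run t i γ)
    where
    go : ∀ {p x n S} (j : Fin n) → p ⟨ x ⟩⇓ ⌜ toℕ j ⌝ⁿ within S →
         (`if p `then `nil `else `cons `nil `nil) ⟨ x ⟩⇓ ⌜ isZero j ⌝ᵇ within suc (S + 3)
    go         zero    r = elseW r (exactly (⇓cons ⇓nil ⇓nil))
    go {S = S} (suc _) r = weaken (s≤s (+-monoʳ-≤ S (s≤s z≤n))) (thenW r (exactly ⇓nil))

  equalC : Γ ⟶ FinO L → Γ ⟶ NatO → Γ ⟶ BoolO
  equalC {L = L} t u .prog    = `cons (prog t) (prog u) ⨾ equalProg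
  equalC {L = L} t u .fun i γ = toℕ (fun t i γ) ≡ᵇ fun u i γ
  equalC {L = L} t u .time    = # 1 ⊞ ((# 1 ⊞ (time t ⊞ time u)) ⊞ (# 20 ⊞ L ⊠ # 11))
  equalC {L = L} t u .run i γ = seqW (consW (run t i γ) (run u i γ))
    (weaken (+-monoʳ-≤ 20 (*-monoˡ-≤ 11 (<⇒≤ (toℕ<n (fun t i γ))))) (equal-run (toℕ (fun t i γ)) _))

  nilC : Γ ⟶ ListO A
  nilC = retype falseC (λ _ _ → []) λ _ _ → refl

  consC : Γ ⟶ A → Γ ⟶ ListO A → Γ ⟶ ListO A
  consC t u = retype (t ,C u) (λ i γ → fun t i γ ∷ fun u i γ) λ _ _ → refl

  foldrC : Γ ⊗ (A ⊗ B) ⟶ B → Γ ⟶ B → Γ ⟶ BListO A L → Γ ⟶ B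
  foldrC s e l .prog    = foldProg (prog l) (prog e) (prog s)
  foldrC s e l .fun i γ = foldr (λ a b → fun s i (γ , a , b)) (fun e i γ) (list (fun l i γ))
  foldrC {L = L} s e l .time = foldSize (time l) (time e) (time s) L
  foldrC {Γ = Γ} {A = A} {B = B} s e l .run i γ = foldProg-run (run l i γ) (run e i γ) (folds (list (fun l i γ)))
    (subst (_≤ _) (≡-sym (length-map (enc A i) (list (fun l i γ)))) (length≤ (fun l i γ)))
    where
    folds : ∀ as → Folds (prog s) (enc Γ i γ) (value (time s) i) (map (enc A i) as)
                     (enc B i (fun e i γ)) (enc B i (foldr (λ a b → fun s i (γ , a , b)) (fun e i γ) as))
    folds []       = []
    folds (a ∷ as) = run s i (γ , a , _) ∷ folds as

  fromVecC : Γ ⟶ VecO A L → Γ ⟶ BListO A L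
  fromVecC {A = A} t =
    retype t (λ i γ → bounded (toList (fun t i γ)) (≤-reflexive (length-toList (fun t i γ))))
           λ i γ → encodeVec-toList (enc A i) (fun t i γ)

  anyC : Γ ⟶ BListO A L → Γ ⊗ A ⟶ BoolO → Γ ⟶ BoolO
  anyC {A = A} l p = retype (foldrC (orC (p ∘C (fstC ,C fstC ∘C sndC)) (sndC ∘C sndC)) falseC l)
    (λ i γ → any (λ a → fun p i (γ , a)) (list (fun l i γ))) λ i γ → cong ⌜_⌝ᵇ (eq i γ (list (fun l i γ)))
    where
    eq : ∀ i γ xs → foldr (λ a b → fun p i (γ , a) ∨ b) false xs ≡ any (λ a → fun p i (γ , a)) xs
    eq i γ []       = refl
    eq i γ (x ∷ xs) = cong (fun p i (γ , x) ∨_) (eq i γ xs)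

  allC : Γ ⟶ BListO A L → Γ ⊗ A ⟶ BoolO → Γ ⟶ BoolO
  allC {A = A} l p = retype (foldrC (andC (p ∘C (fstC ,C fstC ∘C sndC)) (sndC ∘C sndC)) trueC l)
    (λ i γ → all (λ a → fun p i (γ , a)) (list (fun l i γ))) λ i γ → cong ⌜_⌝ᵇ (eq i γ (list (fun l i γ)))
    where
    eq : ∀ i γ xs → foldr (λ a b → fun p i (γ , a) ∧ b) true xs ≡ all (λ a → fun p i (γ , a)) xs
    eq i γ []       = refl
    eq i γ (x ∷ xs) = cong (fun p i (γ , x) ∧_) (eq i γ xs)

  filterC : Γ ⟶ BListO A L → Γ ⊗ A ⟶ BoolO → Γ ⟶ BListO A L
  filterC {Γ = Γ} {A = A} l p =
    retype (foldrC (ifC (p ∘C (fstC ,C fstC ∘C sndC)) (consC (fstC ∘C sndC) (sndC ∘C sndC)) (sndC ∘C sndC)) nilC l)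
    (λ i γ → filterB (λ a → fun p i (γ , a)) (fun l i γ))
    λ i γ → cong (encodeList (enc A i)) (eq i γ (list (fun l i γ)))
    where
    eq : ∀ i γ xs → foldr (λ a as → if fun p i (γ , a) then a ∷ as else as) [] xs ≡ filterᵇ (λ a → fun p i (γ , a)) xs
    eq i γ []       = refl
    eq i γ (x ∷ xs) with fun p i (γ , x)
    ... | true  = cong (x ∷_) (eq i γ xs)
    ... | false = eq i γ xs

  mapC : Γ ⟶ BListO A L → Γ ⊗ A ⟶ B → Γ ⟶ BListO B L
  mapC {A = A} {B = B} l f =
    retype (foldrC (consC (f ∘C (fstC ,C fstC ∘C sndC)) (sndC ∘C sndC)) nilC l)
    (λ i γ → bounded (map (λ a → fun f i (γ , a)) (list (fun l i γ)))
                     (≤-trans (≤-reflexive (length-map _ (list (fun l i γ)))) (length≤ (fun l i γ))))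
    λ i γ → cong (encodeList (enc B i)) (eq i γ (list (fun l i γ)))
    where
    eq : ∀ i γ xs → foldr (λ a as → fun f i (γ , a) ∷ as) [] xs ≡ map (λ a → fun f i (γ , a)) xs
    eq i γ []       = refl
    eq i γ (x ∷ xs) = cong (fun f i (γ , x) ∷_) (eq i γ xs)

  lookupC : Γ ⟶ VecO A L → Γ ⟶ FinO L → Γ ⟶ A
  lookupC {L = L} v j .prog    = `cons (prog v) (prog j) ⨾ lookupLoop ⨾ `hd ⨾ `hd
  lookupC {L = L} v j .fun i γ = lookup (fun v i γ) (fun j i γ)
  lookupC {L = L} v j .time    = # 1 ⊞ (# 1 ⊞ (time v ⊞ time j) ⊞ (# 1 ⊞ (L ⊠ # 9 ⊞ # 2 ⊞ # 3)))
  lookupC {A = A} {L = L} v j .run i γ = seqW (consW (run v i γ) (run j i γ))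
    (seqW (weaken (+-monoˡ-≤ 2 (*-monoˡ-≤ 9 (<⇒≤ (toℕ<n (fun j i γ)))))
            (exactly (proj₂ (lookupLoop-run (enc A i) (fun v i γ) (fun j i γ)))))
          (exactly (⇓seq ⇓hd ⇓hd)))

  Indices : Size 𝕀 → Obj 𝕀
  Indices L = Const (BListO (FinO L) L) (λ i → allFinB (value L i))

  tabulateC : Γ ⟶ Indices L → Γ ⊗ FinO L ⟶ A → Γ ⟶ VecO A L
  tabulateC {A = A} l t = retype (mapC (constC _ ∘C l) t) (λ i γ → tabulate (λ a → fun t i (γ , a)))
    λ i γ → encodeVec-tabulate (enc A i) (λ a → fun t i (γ , a))

-- Computable bounds

iterate : (ℕ → ℕ) → ℕ → ℕ → ℕ
iterate g zero    e = e
iterate g (suc d) e = iterate g d (g e)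

Computable-resp : ∀ {f g} → (∀ d → f d ≡ g d) → Computable f → Computable g
Computable-resp eq (p , run) = p , λ d → proj₁ (run d) , subst (λ y → p ⟨ _ ⟩⇓ ⌜ y ⌝ⁿ ∣ _) (eq d) (proj₂ (run d))

Computable-∘ : ∀ {f g} → Computable f → Computable g → Computable (f ∘ g)
Computable-∘ (p , run) (q , run′) = q ⨾ p , λ d → _ , ⇓seq (proj₂ (run′ d)) (proj₂ (run _))

Computable-+ : ∀ c → Computable (c +_)
Computable-+ zero    = `id , λ d → _ , ⇓id
Computable-+ (suc c) = Computable-∘ (`cons `nil `id , λ d → _ , ⇓cons ⇓nil ⇓id) (Computable-+ c)

Computable-const : ∀ c → ∃[ p ] ∀ x → ∃[ t ] p ⟨ x ⟩⇓ ⌜ c ⌝ⁿ ∣ t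
Computable-const zero    = `nil , λ x → _ , ⇓nil
Computable-const (suc c) with p , run ← Computable-const c =
  `cons `nil p , λ x → _ , ⇓cons ⇓nil (proj₂ (run x))

Computable-iterate : ∀ {g} c → Computable g → Computable (λ d → iterate g d c)
Computable-iterate {g} c (p , run) with q , run′ ← Computable-const c =
  `cons `id q ⨾ loop ⨾ `tl ,
  λ d → _ , ⇓seq (⇓cons ⇓id (proj₂ (run′ _))) (⇓seq (proj₂ (loop-run d c)) ⇓tl)
  where
  loop : Prog
  loop = `while `hd `do `cons (`hd ⨾ `tl) (`tl ⨾ p)

  loop-run : ∀ d e → ∃[ t ] loop ⟨ ⌜ d ⌝ⁿ ∙ ⌜ e ⌝ⁿ ⟩⇓ nil ∙ ⌜ iterate g d e ⌝ⁿ ∣ t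
  loop-run zero    e = _ , ⇓stop ⇓hd
  loop-run (suc d) e =
    _ , ⇓loop ⇓hd (⇓cons (⇓seq ⇓hd ⇓tl) (⇓seq ⇓tl (proj₂ (run e)))) (proj₂ (loop-run d (g e)))

iterate-+ : ∀ c d e → iterate (c +_) d e ≡ d * c + e
iterate-+ c zero    e = refl
iterate-+ c (suc d) e = begin
  iterate (c +_) d (c + e) ≡⟨ iterate-+ c d (c + e) ⟩
  d * c + (c + e)          ≡⟨ ≡-sym (+-assoc (d * c) c e) ⟩
  d * c + c + e            ≡⟨ cong (_+ e) (+-comm (d * c) c) ⟩
  c + d * c + e            ∎
  where open ≡-Reasoning

Computable-* : ∀ c e → Computable (λ d → d * c + e)
Computable-* c e = Computable-resp (λ d → iterate-+ c d e) (Computable-iterate e (Computable-+ c))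

-- Doubling is written with `+ 0` to match the function of `Computable-* 2 0`.
iterate-double : ∀ d e → iterate (λ x → x * 2 + 0) d e ≡ 2 ^ d * e
iterate-double zero    e = ≡-sym (+-identityʳ e)
iterate-double (suc d) e = begin
  iterate (λ x → x * 2 + 0) d (e * 2 + 0) ≡⟨ iterate-double d (e * 2 + 0) ⟩
  2 ^ d * (e * 2 + 0)                     ≡⟨ cong (2 ^ d *_) (trans (+-identityʳ _) (*-comm e 2)) ⟩
  2 ^ d * (2 * e)                         ≡⟨ ≡-sym (*-assoc (2 ^ d) 2 e) ⟩
  2 ^ d * 2 * e                           ≡⟨ cong (_* e) (*-comm (2 ^ d) 2) ⟩
  2 ^ suc d * e                           ∎
  where open ≡-Reasoning

Computable-2^ : Computable (2 ^_)
Computable-2^ = Computable-resp (λ d → trans (iterate-double d 1) (*-identityʳ _))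
                                (Computable-iterate 1 (Computable-* 2 0))

-- Enumerating vectors over an alphabet

-- The nested `foldr` is the form in which the program computes, so `extendC` meets this
-- specification by computation.
extend : ∀ {A : Set} {m} → List A → A → Bool → List (Vec A m) → List (Vec A (suc m))
extend as z b ys =
  if b then foldr (λ a out → foldr (λ y out → (a ∷ y) ∷ out) out ys) [] as else map (z ∷_) ys

-- Only the positions in the subset vary; all others hold the filler `z`. This makes the number of
-- vectors depend on the size of the subset and not on their length, so that the number of states
-- depends on `d` and not on `n`.
enumerate : ∀ {A : Set} {m} → List A → A → Subset m → List (Vec A m)
enumerate as z []      = [] ∷ []
enumerate as z (b ∷ p) = extend as z b (enumerate as z p)

module _ {A B : Set} (f : A → B) where

  ∈-foldr-cons⁺ˡ : ∀ {y out} ys → y ∈ ys → f y ∈ foldr (λ y out → f y ∷ out) out ys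
  ∈-foldr-cons⁺ˡ (_ ∷ ys) (here refl) = here refl
  ∈-foldr-cons⁺ˡ (_ ∷ ys) (there y∈)  = there (∈-foldr-cons⁺ˡ ys y∈)

  ∈-foldr-cons⁺ʳ : ∀ {x out} ys → x ∈ out → x ∈ foldr (λ y out → f y ∷ out) out ys
  ∈-foldr-cons⁺ʳ []       x∈ = x∈
  ∈-foldr-cons⁺ʳ (_ ∷ ys) x∈ = there (∈-foldr-cons⁺ʳ ys x∈)

  length-foldr-cons : ∀ {out} ys → length (foldr (λ y out → f y ∷ out) out ys) ≡ length ys + length out
  length-foldr-cons []       = refl
  length-foldr-cons (_ ∷ ys) = cong suc (length-foldr-cons ys)

∈-foldr-cons⁻ : ∀ {A B : Set} {P : B → Set} (f : A → B) {out} ys →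
                (∀ {y} → y ∈ ys → P (f y)) → (∀ {x} → x ∈ out → P x) →
                ∀ {x} → x ∈ foldr (λ y out → f y ∷ out) out ys → P x
∈-foldr-cons⁻ f []       p q x∈          = q x∈
∈-foldr-cons⁻ f (y ∷ ys) p q (here refl) = p (here refl)
∈-foldr-cons⁻ f (y ∷ ys) p q (there x∈)  = ∈-foldr-cons⁻ f ys (p ∘ there) q x∈

module _ {A : Set} (z : A) where

  enumerate-complete : ∀ {m as} (p : Subset m) (v : Vec A m) →
    (∀ j → lookup p j ≡ true → lookup v j ∈ as) → (∀ j → lookup p j ≡ false → lookup v j ≡ z) →
    v ∈ enumerate as z p
  enumerate-complete []          []      h h′ = here refl
  enumerate-complete (false ∷ p) (x ∷ v) h h′ with refl ← h′ zero refl =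
    ∈-map⁺ (z ∷_) (enumerate-complete p v (h ∘ suc) (h′ ∘ suc))
  enumerate-complete {as = as} (true ∷ p) (x ∷ v) h h′ =
    go as (h zero refl)
    where
    ih : v ∈ enumerate as z p
    ih = enumerate-complete p v (h ∘ suc) (h′ ∘ suc)
    go : ∀ bs → x ∈ bs → x ∷ v ∈ extend bs z true (enumerate as z p)
    go (b ∷ bs) (here refl) = ∈-foldr-cons⁺ˡ (b ∷_) _ ih
    go (b ∷ bs) (there x∈)  = ∈-foldr-cons⁺ʳ (b ∷_) (enumerate as z p) (go bs x∈)

  enumerate-outside : ∀ {m as} (p : Subset m) {v} → v ∈ enumerate as z p →
                      ∀ j → lookup p j ≡ false → lookup v j ≡ z
  enumerate-outside {as = as} (false ∷ p) v∈ j eq with w , w∈ , refl ← ∈-map⁻ (z ∷_) v∈ | j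
  ... | zero  = refl
  ... | suc j = enumerate-outside p w∈ j eq
  enumerate-outside {as = as} (true ∷ p) v∈ (suc j) eq = go as v∈
    where
    go : ∀ bs {v} → v ∈ extend bs z true (enumerate as z p) → lookup v (suc j) ≡ z
    go (b ∷ bs) = ∈-foldr-cons⁻ {P = λ v → lookup v (suc j) ≡ z} (b ∷_) (enumerate as z p)
                    (λ w∈ → enumerate-outside p w∈ j eq) (go bs)

  enumerate-inside : ∀ {m as} (p : Subset m) {v} → v ∈ enumerate as z p →
                     ∀ j → lookup p j ≡ true → lookup v j ∈ as
  enumerate-inside {as = as} (false ∷ p) v∈ (suc j) eq with w , w∈ , refl ← ∈-map⁻ (z ∷_) v∈ =
    enumerate-inside p w∈ j eq
  enumerate-inside {as = as} (true ∷ p) v∈ zero eq = go as v∈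
    where
    go : ∀ bs {v} → v ∈ extend bs z true (enumerate as z p) → lookup v zero ∈ bs
    go (b ∷ bs) = ∈-foldr-cons⁻ {P = λ v → lookup v zero ∈ b ∷ bs} (b ∷_) (enumerate as z p)
                    (λ _ → here refl) (there ∘ go bs)
  enumerate-inside {as = as} (true ∷ p) v∈ (suc j) eq = go as v∈
    where
    go : ∀ bs {v} → v ∈ extend bs z true (enumerate as z p) → lookup v (suc j) ∈ as
    go (b ∷ bs) = ∈-foldr-cons⁻ {P = λ v → lookup v (suc j) ∈ as} (b ∷_) (enumerate as z p)
                    (λ w∈ → enumerate-inside p w∈ j eq) (go bs)

  -- With base `suc q` instead of `q` the bound is monotone in `∣ p ∣` even for an empty alphabet;
  -- `shrink` below relies on this.
  length-enumerate : ∀ {m as q} (p : Subset m) → length as ≤ q →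
                     length (enumerate as z p) ≤ suc q ^ ∣ p ∣
  length-enumerate []          len = ≤-refl
  length-enumerate {as = as} (false ∷ p) len =
    ≤-trans (≤-reflexive (length-map (z ∷_) (enumerate as z p))) (length-enumerate p len)
  length-enumerate {as = as} {q} (true ∷ p) len =
    ≤-trans (go as) (*-mono-≤ (≤-trans len (n≤1+n q)) (length-enumerate p len))
    where
    go : ∀ bs → length (extend bs z true (enumerate as z p)) ≤ length bs * length (enumerate as z p)
    go []       = z≤n
    go (b ∷ bs) = ≤-trans (≤-reflexive (length-foldr-cons (b ∷_) (enumerate as z p)))
                          (+-monoʳ-≤ (length (enumerate as z p)) (go bs))

-- The index of a step of the enumeration also records the length of the
-- vectors that have already been built.
module _ {𝕀 : Index} (A : Obj 𝕀) (q L : Size 𝕀) where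
  private
    𝕁 : Index
    𝕁 = record { Ix = Ix 𝕀 × ℕ ; W = W 𝕀 ∘ proj₁ ; 2≤W = 2≤W 𝕀 ∘ proj₁ }

    lift : Size 𝕀 → Size 𝕁
    lift M = size (value M ∘ proj₁) (degree M) (value≤ M ∘ proj₁)

    A′ V V⁺ : Obj 𝕁
    A′ = Raw (El A ∘ proj₁) λ (i , _) → enc A i
    V  = Raw (λ (i , m) → Vec (El A i) m) λ (i , _) → encodeVec (enc A i)
    V⁺ = Raw (λ (i , m) → Vec (El A i) (suc m)) λ (i , _) → encodeVec (enc A i)

    attachC : ∀ {Γ : Obj 𝕁} → Γ ⟶ A′ → Γ ⟶ V → Γ ⟶ V⁺
    attachC a v = retype (a ,C v) (λ i γ → fun a i γ ∷ fun v i γ) λ _ _ → refl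

    asC : BListO A′ (lift q) ⊗ A′ ⊗ (BoolO ⊗ BListO V (lift L)) ⟶ BListO A′ (lift q)
    asC = fstC ∘C fstC

    ysC : BListO A′ (lift q) ⊗ A′ ⊗ (BoolO ⊗ BListO V (lift L)) ⟶ BListO V (lift L)
    ysC = sndC ∘C sndC

    unbound : ∀ {Γ B : Obj 𝕁} {M : Size 𝕁} → Γ ⟶ BListO B M → Γ ⟶ ListO B
    unbound t = retype t (λ i γ → list (fun t i γ)) λ _ _ → refl

    extendC : BListO A′ (lift q) ⊗ A′ ⊗ (BoolO ⊗ BListO V (lift L)) ⟶ ListO V⁺
    extendC = ifC (fstC ∘C sndC)
      (foldrC (foldrC (consC (attachC (fstC ∘C sndC ∘C fstC) (fstC ∘C sndC)) (sndC ∘C sndC))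
                      (sndC ∘C sndC) (ysC ∘C fstC))
              nilC asC)
      (unbound (mapC ysC (attachC (sndC ∘C fstC ∘C fstC) sndC)))

  module _ {Γ : Obj 𝕀} {M : Size 𝕀} (as : Γ ⟶ BListO A q) (z : Γ ⟶ A) (p : Γ ⟶ VecO BoolO M)
           (fits : ∀ i γ → suc (value q i) ^ ∣ fun p i γ ∣ ≤ value L i) where
    private
      stepProg : Prog
      stepProg = `cons (`hd ⨾ prog (as ,C z)) `tl ⨾ prog extendC

      stepSize : Size 𝕀
      stepSize = # 1 ⊞ ((# 1 ⊞ ((# 1 ⊞ (# 1 ⊞ time (as ,C z))) ⊞ # 1)) ⊞
                        -- The time of `extendC` may depend on the length reached so far. Its bound
                        -- by a power of the weight does not, and takes its place.
                        size (λ i → W 𝕀 i ^ degree (time extendC)) (degree (time extendC)) (λ _ → ≤-refl))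

      folds : ∀ i γ {m} (s : Subset m) → suc (value q i) ^ ∣ s ∣ ≤ value L i →
              Folds stepProg (enc Γ i γ) (value stepSize i) (map ⌜_⌝ᵇ (toList s)) (nil ∙ nil)
                    (encodeList (encodeVec (enc A i)) (enumerate (list (fun as i γ)) (fun z i γ) s))
      folds i γ [] fit = []
      folds i γ {suc m} (b ∷ s) fit =
        seqW (consW (seqW (exactly ⇓hd) (run (as ,C z) i γ)) (exactly ⇓tl))
             (weaken (value≤ (time extendC) (i , m))
                     (run extendC (i , m) ((fun as i γ , fun z i γ) , (b , bounded ys (≤-trans len fits-s)))))
        ∷ folds i γ s fits-s
        where
        ys : List (Vec (El A i) m)
        ys = enumerate (list (fun as i γ)) (fun z i γ) s
        len : length ys ≤ suc (value q i) ^ ∣ s ∣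
        len = length-enumerate (fun z i γ) s (length≤ (fun as i γ))
        fits-s : suc (value q i) ^ ∣ s ∣ ≤ value L i
        fits-s = ≤-trans (shrink b) fit
          where
          shrink : ∀ b → suc (value q i) ^ ∣ s ∣ ≤ suc (value q i) ^ ∣ b ∷ s ∣
          shrink true  = m≤n*m _ (suc (value q i))
          shrink false = ≤-refl

    enumerateC : Γ ⟶ BListO (VecO A M) L
    enumerateC .prog    = foldProg (prog p) (`cons `nil `nil) stepProg
    enumerateC .fun i γ = bounded (enumerate (list (fun as i γ)) (fun z i γ) (fun p i γ))
      (≤-trans (length-enumerate (fun z i γ) (fun p i γ) (length≤ (fun as i γ))) (fits i γ))
    enumerateC .time    = foldSize (time p) (# 3) stepSize M
    enumerateC .run i γ = foldProg-run
      (subst (λ y → prog p ⟨ enc Γ i γ ⟩⇓ y within value (time p) i) (encodeVec-toList ⌜_⌝ᵇ (fun p i γ)) (run p i γ))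
      (exactly (⇓cons ⇓nil ⇓nil)) (folds i γ (fun p i γ) (fits i γ))
      (≤-reflexive (trans (length-map ⌜_⌝ᵇ (toList (fun p i γ))) (length-toList (fun p i γ))))

range : ℕ → ℕ → List ℕ
range m zero    = []
range m (suc j) = m ∷ range (suc m) j

tabulate≡range : ∀ {A : Set} (g : A → ℕ) {n} m (f : Fin n → A) → (∀ j → g (f j) ≡ m + toℕ j) →
                 map g (List.tabulate f) ≡ range m n
tabulate≡range g {zero}  m f eq = refl
tabulate≡range g {suc n} m f eq = cong₂ _∷_ (trans (eq zero) (+-identityʳ m))
  (tabulate≡range g (suc m) (f ∘ suc) λ j → trans (eq (suc j)) (+-suc m (toℕ j)))

-- A right fold reaches the last element first, so indices are produced by counting down from the
-- length; `m` is the number of elements in front of `ys`.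
countdown : ∀ {A : Set} (ys : List A) m →
  foldr (λ _ (i , is) → pred i , pred i ∷ is) (m + length ys , []) ys ≡ (m , range m (length ys))
countdown []       m = cong (_, []) (+-identityʳ m)
countdown (y ∷ ys) m rewrite +-suc m (length ys) | countdown ys (suc m) = refl

module _ {𝕀 : Index} where

  private variable
    Γ A : Obj 𝕀
    L : Size 𝕀

  lengthC : Γ ⟶ BListO A L → Γ ⟶ NatO
  lengthC l = retype (foldrC (sucC (sndC ∘C sndC)) zeroC l) (λ i γ → length (list (fun l i γ)))
                     λ i γ → cong ⌜_⌝ⁿ (eq (list (fun l i γ)))
    where
    eq : ∀ {X : Set} (xs : List X) → foldr (λ _ n → suc n) 0 xs ≡ length xs
    eq []       = refl
    eq (x ∷ xs) = cong suc (eq xs)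

  -- The input contains no numeral for `n`; the list of indices is read off from any vector of the
  -- right length.
  indicesC : Γ ⟶ VecO A L → Γ ⟶ Indices L
  indicesC {A = A} {L = L} v = known (sndC ∘C count) _ correct
    where
    l : _ ⟶ BListO A L
    l = fromVecC v
    count : _ ⟶ NatO ⊗ ListO NatO
    count = foldrC (predC (fstC ∘C sndC ∘C sndC) ,C consC (predC (fstC ∘C sndC ∘C sndC)) (sndC ∘C sndC ∘C sndC))
                   (lengthC l ,C nilC) l
    correct : ∀ i γ → encodeList ⌜_⌝ⁿ (proj₂ (fun count i γ)) ≡
                      encodeList (⌜_⌝ⁿ ∘ toℕ) (List.allFin (value L i))
    correct i γ = begin
      encodeList ⌜_⌝ⁿ (proj₂ (fun count i γ))
        ≡⟨ cong (encodeList ⌜_⌝ⁿ ∘ proj₂) (countdown xs 0) ⟩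
      encodeList ⌜_⌝ⁿ (range 0 (length xs))
        ≡⟨ cong (encodeList ⌜_⌝ⁿ ∘ range 0) (length-toList (fun v i γ)) ⟩
      encodeList ⌜_⌝ⁿ (range 0 (value L i))
        ≡⟨ cong (encodeList ⌜_⌝ⁿ) (≡-sym (tabulate≡range toℕ 0 id λ _ → refl)) ⟩
      encodeList ⌜_⌝ⁿ (map toℕ (List.allFin (value L i)))
        ≡⟨ cong tree (≡-sym (map-∘ (List.allFin (value L i)))) ⟩
      encodeList (⌜_⌝ⁿ ∘ toℕ) (List.allFin (value L i)) ∎
      where
      open ≡-Reasoning
      xs : List (El A i)
      xs = toList (fun v i γ)

-- The dynamic program

-- In the end, counts are compared only with 1, or with 2 when a vertex has to be discounted from
-- its own clique; 3 stands for everything larger.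
capSuc : ℕ → ℕ
capSuc 0 = 1
capSuc 1 = 2
capSuc (suc (suc _)) = 3

count : ∀ {A : Set} → (A → Bool) → ℕ → List A → ℕ
count P r = foldr (λ a s → if P a then capSuc s else s) r

_==_ : ∀ {m n} → Fin m → Fin n → Bool
i == j = toℕ i ≡ᵇ toℕ j

-- Colour counts are capped at 3. Entry suc x of a state counts the
-- colours of the coloured vertices in the neighbourhood of x ∈ X, and
-- entry zero those of the coloured vertices in the current clique.
Row : ℕ → Set
Row k = Vec (Fin 4) k

State : ℕ → ℕ → Set
State n k = Vec (Row k) (suc n)

module Algorithm {n : ℕ} (A : Vec (Vec Bool n) n) (X : Vec Bool n) (k : ℕ) where

  vs : List (Fin n)
  vs = List.allFin n

  zs : List (Fin (suc n))
  zs = List.allFin (suc n)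

  cs : List (Fin k)
  cs = List.allFin k

  -- Position `zero` acts as an additional modulator vertex adjacent to everything, so the counter
  -- of the current clique is updated by the same rule as the counters of `X`.
  Â : Vec (Vec Bool n) (suc n)
  Â = tabulate (λ _ → true) ∷ A

  X̂ : Vec Bool (suc n)
  X̂ = true ∷ X

  rows : List (Row k)
  rows = enumerate (List.allFin 4) zero (tabulate λ _ → true)

  states : List (State n k)
  states = enumerate rows (tabulate λ _ → zero) X̂

  -- Partial colourings of X by the numbers of the colours.
  codes : List (Vec ℕ n)
  codes = enumerate (map toℕ cs) 0 X

  adj : Fin n → Fin n → Bool
  adj u v = lookup (lookup A u) v

  inX : Fin n → Bool
  inX u = lookup X u

  near : Fin (suc n) → Fin n → Bool
  near z u = lookup X̂ z ∧ lookup (lookup Â z) u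

  cell : State n k → Fin (suc n) → Fin k → ℕ
  cell s z c = toℕ (lookup (lookup s z) c)

  mate : Fin n → Fin n → Bool
  mate w u = not (inX w) ∧ not (inX u) ∧ ((w == u) ∨ adj w u)

  -- A canonical representative, the first vertex of the clique of `u`. The cliques are visited by
  -- letting `v` run through all vertices; a `v` that leads no clique gives an empty round. For `u`
  -- in `X` the default `u` remains, and `inClique` excludes it.
  leader : Fin n → Fin n
  leader u = foldr (λ w r → if mate w u then w else r) u vs

  inClique : Fin n → Fin n → Bool
  inClique v u = not (inX u) ∧ (leader u == v)

  -- Of colour c′ the neighbourhood of u contains, besides those in X, the
  -- τ c′ vertices of the clique of u, except that u itself, of colour c, must
  -- not be counted when neighbourhoods are open; then the target count is 2.
  unique : Vec ℕ n → Row k → Fin n → Fin k → Fin k → Bool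
  unique X-colour τ u c c′ =
    toℕ (if not (adj u u) ∧ (c′ == c) then suc {n = 2} (suc zero) else suc zero) ≡ᵇ
    count (λ w → inX w ∧ adj u w ∧ (toℕ c′ ≡ᵇ lookup X-colour w)) (toℕ (lookup τ c′)) vs

  satisfied : Vec ℕ n → Row k → Fin n → Fin k → Bool
  satisfied X-colour τ u c = any (unique X-colour τ u c) cs

  -- Successor states are tested, not constructed: filtering the fixed list of all states removes
  -- duplicates and keeps every list of states within its length.
  agrees : State n k → (Fin (suc n) → Fin k → ℕ) → Bool
  agrees s g = all (λ z → all (λ c → cell s z c ≡ᵇ g z c) cs) zs

  bumped : Fin n → Fin k → State n k → Fin (suc n) → Fin k → ℕ
  bumped u c s z c′ = if near z u ∧ (c′ == c) then capSuc (cell s z c′) else cell s z c′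

  colourStep : Vec ℕ n → Row k → Fin n → State n k → State n k → Bool
  colourStep X-colour τ u s s′ = any (λ c → satisfied X-colour τ u c ∧ agrees s′ (bumped u c s)) cs

  closed : State n k → Fin (suc n) → Fin k → ℕ
  closed t z c = if isZero z then 0 else cell t z c

  closes : Row k → State n k → State n k → Bool
  closes τ t s = all (λ c → lookup τ c == lookup (lookup t zero) c) cs ∧ agrees s (closed t)

  start : Vec ℕ n → Fin (suc n) → Fin k → ℕ
  start X-colour z c =
    if isZero z then 0 else count (λ u → inX u ∧ near z u ∧ (toℕ c ≡ᵇ lookup X-colour u)) 0 vs

  initial : Vec ℕ n → State n k → Bool
  initial X-colour s = agrees s (start X-colour)

  -- Only `X` is left to check here; the other vertices were tested by `satisfied` when they were
  -- coloured.
  accepting : State n k → Bool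
  accepting s = all (λ z → isZero z ∨ not (lookup X̂ z) ∨ any (λ c → cell s z c ≡ᵇ 1) cs) zs

  module _ {q} (Σ : BoundedList (State n k) q) (X-colour : Vec ℕ n) where

    -- Here τ is a guess of the final colour counts of the clique, to be
    -- verified by closes.
    colourClique : Fin n → Row k → BoundedList (State n k) q → BoundedList (State n k) q
    colourClique v τ S = foldr
      (λ u T → if inClique v u then filterB (λ s → any (λ t → colourStep X-colour τ u t s) (list T)) Σ else T) S vs

    nextClique : Fin n → BoundedList (State n k) q → BoundedList (State n k) q
    nextClique v S =
      filterB (λ s → any (λ τ → any (λ t → closes τ t s) (list (colourClique v τ S))) rows) Σ

    reachable : BoundedList (State n k) q
    reachable = foldr nextClique (filterB (initial X-colour) Σ) vs

  -- The outer quantifier only ensures that there is a colour.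
  answer : ∀ {q} → BoundedList (State n k) q → Bool
  answer Σ = any (λ _ → any (λ X-colour → any accepting (list (reachable Σ X-colour))) codes) cs

-- The dynamic program as a WHILE program

module _ {𝕀 : Index} where

  private variable
    Γ A : Obj 𝕀
    L : Size 𝕀

  capSucC : Γ ⟶ NatO → Γ ⟶ NatO
  -- The second tail is non-empty from 3 on; at 2 the ordinary successor already is the cap.
  capSucC t .prog    = `if (prog t ⨾ `tl ⨾ `tl) `then prog (natC {𝕀} {Γ = NatO} 3) `else `cons `nil (prog t)
  capSucC t .fun i γ = capSuc (fun t i γ)
  capSucC t .time    = # 1 ⊞ ((# 1 ⊞ (time t ⊞ # 3)) ⊞ (# 7 ⊞ (# 2 ⊞ time t)))
  capSucC {Γ = Γ} t .run i γ = go (fun t i γ) (run t i γ)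
    where
    S = value (time t) i
    go : ∀ m → prog t ⟨ enc Γ i γ ⟩⇓ ⌜ m ⌝ⁿ within S →
         prog (capSucC t) ⟨ enc Γ i γ ⟩⇓ ⌜ capSuc m ⌝ⁿ within value (time (capSucC t)) i
    low : ∀ {m} → `tl ⨾ `tl ⟨ ⌜ m ⌝ⁿ ⟩⇓ nil within 3 → prog t ⟨ enc Γ i γ ⟩⇓ ⌜ m ⌝ⁿ within S →
          prog (capSucC t) ⟨ enc Γ i γ ⟩⇓ ⌜ suc m ⌝ⁿ within value (time (capSucC t)) i
    low r′ r = weaken (s≤s (+-monoʳ-≤ (1 + (S + 3)) (m≤n+m (2 + S) 7))) (elseW (seqW r r′) (consW (exactly ⇓nil) r))
    go 0 r = low (exactly (⇓seq ⇓tl ⇓tl)) r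
    go 1 r = low (exactly (⇓seq ⇓tl ⇓tl)) r
    go 2 r = low (exactly (⇓seq ⇓tl ⇓tl)) r
    go (suc (suc (suc m))) r = weaken (s≤s (+-monoʳ-≤ (1 + (S + 3)) (m≤m+n 7 (2 + S))))
      (thenW (seqW r (exactly (⇓seq ⇓tl ⇓tl))) (exactly (⇓cons ⇓nil (⇓cons ⇓nil (⇓cons ⇓nil ⇓nil)))))

  infixr 8 ↑_
  ↑_ : ∀ {Γ A B : Obj 𝕀} → Γ ⟶ B → Γ ⊗ A ⟶ B
  ↑ t = t ∘C fstC

  v0 : Γ ⊗ A ⟶ A
  v0 = sndC

  countC : Γ ⟶ BListO A L → Γ ⟶ NatO → Γ ⊗ A ⟶ BoolO → Γ ⟶ NatO
  countC l r p = foldrC (ifC (p ∘C (fstC ,C fstC ∘C sndC)) (capSucC (sndC ∘C sndC)) (sndC ∘C sndC)) r l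

record Tables {𝕀 : Index} (N K Q R P : Size 𝕀) : Set where
  field
    adjacency : ∀ i → Vec (Vec Bool (value N i)) (value N i)
    modulator : ∀ i → Vec Bool (value N i)

  module Alg i = Algorithm (adjacency i) (modulator i) (value K i)

  field
    states≤ : ∀ i → length (Alg.states i) ≤ value Q i
    rows≤   : ∀ i → length (Alg.rows i) ≤ value R i
    codes≤  : ∀ i → length (Alg.codes i) ≤ value P i

module Program {𝕀 : Index} {N K Q R P : Size 𝕀} (tables : Tables N K Q R P) where
  open Tables tables

  N⁺ : Size 𝕀
  N⁺ = # 1 ⊞ N

  RowO StateO CodeO : Obj 𝕀
  RowO   = VecO (FinO (# 4)) K
  StateO = VecO RowO N⁺
  CodeO  = VecO NatO N

  Vertices Positions Colours Adjacency Modulator Adjacency⁺ Modulator⁺ Rows States Codes Data : Obj 𝕀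
  Vertices   = Indices N
  Positions  = Indices N⁺
  Colours    = Indices K
  Adjacency  = Const (VecO (VecO BoolO N) N) adjacency
  Modulator  = Const (VecO BoolO N) modulator
  Adjacency⁺ = Const (VecO (VecO BoolO N) N⁺) (λ i → Alg.Â i)
  Modulator⁺ = Const (VecO BoolO N⁺) (λ i → Alg.X̂ i)
  Rows       = Const (BListO RowO R) (λ i → bounded (Alg.rows i) (rows≤ i))
  States     = Const (BListO StateO Q) (λ i → bounded (Alg.states i) (states≤ i))
  Codes      = Const (BListO CodeO P) (λ i → bounded (Alg.codes i) (codes≤ i))
  Data = Vertices ⊗ Positions ⊗ Colours ⊗ Adjacency ⊗ Modulator ⊗ Adjacency⁺ ⊗ Modulator⁺ ⊗ Rows ⊗ States ⊗ Codes

  private variable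
    Γ : Obj 𝕀

  module _ (d : Γ ⟶ Data) where

    vsC : Γ ⟶ BListO (FinO N) N
    vsC = constC _ ∘C fstC ∘C fstC ∘C fstC ∘C fstC ∘C fstC ∘C fstC ∘C fstC ∘C fstC ∘C fstC ∘C d

    zsC : Γ ⟶ BListO (FinO N⁺) N⁺
    zsC = constC _ ∘C sndC ∘C fstC ∘C fstC ∘C fstC ∘C fstC ∘C fstC ∘C fstC ∘C fstC ∘C fstC ∘C d

    csC : Γ ⟶ BListO (FinO K) K
    csC = constC _ ∘C sndC ∘C fstC ∘C fstC ∘C fstC ∘C fstC ∘C fstC ∘C fstC ∘C fstC ∘C d

    adjC : Γ ⟶ FinO N → Γ ⟶ FinO N → Γ ⟶ BoolO
    adjC u v = lookupC (lookupC (constC _ ∘C sndC ∘C fstC ∘C fstC ∘C fstC ∘C fstC ∘C fstC ∘C fstC ∘C d) u) v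

    inXC : Γ ⟶ FinO N → Γ ⟶ BoolO
    inXC u = lookupC (constC _ ∘C sndC ∘C fstC ∘C fstC ∘C fstC ∘C fstC ∘C fstC ∘C d) u

    inX⁺C : Γ ⟶ FinO N⁺ → Γ ⟶ BoolO
    inX⁺C z = lookupC (constC _ ∘C sndC ∘C fstC ∘C fstC ∘C fstC ∘C d) z

    nearC : Γ ⟶ FinO N⁺ → Γ ⟶ FinO N → Γ ⟶ BoolO
    nearC z u = andC (inX⁺C z)
      (lookupC (lookupC (constC _ ∘C sndC ∘C fstC ∘C fstC ∘C fstC ∘C fstC ∘C d) z) u)

    rowsC : Γ ⟶ BListO RowO R
    rowsC = constC _ ∘C sndC ∘C fstC ∘C fstC ∘C d

    statesC : Γ ⟶ BListO StateO Q
    statesC = constC _ ∘C sndC ∘C fstC ∘C d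

    codesC : Γ ⟶ BListO CodeO P
    codesC = constC _ ∘C sndC ∘C d

  sameC : ∀ {L M} → Γ ⟶ FinO L → Γ ⟶ FinO M → Γ ⟶ BoolO
  sameC i j = equalC i (toℕC j)

  entryC : Γ ⟶ StateO → Γ ⟶ FinO N⁺ → Γ ⟶ FinO K → Γ ⟶ FinO (# 4)
  entryC s z c = lookupC (lookupC s z) c

  mateC : Γ ⟶ Data → Γ ⟶ FinO N → Γ ⟶ FinO N → Γ ⟶ BoolO
  mateC d w u = andC (notC (inXC d w)) (andC (notC (inXC d u)) (orC (sameC w u) (adjC d w u)))

  leaderC : Γ ⟶ Data → Γ ⟶ FinO N → Γ ⟶ FinO N
  leaderC d u = foldrC (ifC (mateC (↑ d) (fstC ∘C v0) (↑ u)) (fstC ∘C v0) (sndC ∘C v0)) u (vsC d)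

  inCliqueC : Γ ⟶ Data → Γ ⟶ FinO N → Γ ⟶ FinO N → Γ ⟶ BoolO
  inCliqueC d v u = andC (notC (inXC d u)) (sameC (leaderC d u) v)

  smallC : ∀ m → Fin m → Γ ⟶ FinO (# m)
  smallC m j = retype (natC (toℕ j)) (λ _ _ → j) λ i γ → cong ⌜_⌝ⁿ (eq (toℕ j) i γ)
    where
    eq : ∀ n i (γ : El Γ i) → fun (natC {Γ = Γ} n) i γ ≡ n
    eq zero    i γ = refl
    eq (suc n) i γ = cong suc (eq n i γ)

  satisfiedC : Γ ⟶ Data → Γ ⟶ CodeO → Γ ⟶ RowO → Γ ⟶ FinO N → Γ ⟶ FinO K → Γ ⟶ BoolO
  satisfiedC d X-colour τ u c = anyC (csC d)
    (equalC (ifC (andC (notC (adjC (↑ d) (↑ u) (↑ u))) (sameC v0 (↑ c)))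
                 (smallC 3 (suc (suc zero))) (smallC 3 (suc zero)))
            (countC (vsC (↑ d)) (toℕC (lookupC (↑ τ) v0))
              (andC (inXC (↑ ↑ d) v0) (andC (adjC (↑ ↑ d) (↑ ↑ u) v0)
                (equalC (↑ v0) (lookupC (↑ ↑ X-colour) v0))))))

  agreesC : Γ ⟶ Data → Γ ⟶ StateO → Γ ⊗ FinO N⁺ ⊗ FinO K ⟶ NatO → Γ ⟶ BoolO
  agreesC d s g = allC (zsC d) (allC (csC (↑ d)) (equalC (entryC (↑ ↑ s) (↑ v0) v0) g))

  colourStepC : Γ ⟶ Data → Γ ⟶ CodeO → Γ ⟶ RowO → Γ ⟶ FinO N → Γ ⟶ StateO → Γ ⟶ StateO → Γ ⟶ BoolO
  colourStepC d X-colour τ u s s′ = anyC (csC d)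
    (andC (satisfiedC (↑ d) (↑ X-colour) (↑ τ) (↑ u) v0)
      (agreesC (↑ d) (↑ s′)
        (ifC (andC (nearC (↑ ↑ ↑ d) (↑ v0) (↑ ↑ ↑ u)) (sameC v0 (↑ ↑ v0)))
             (capSucC (toℕC (entryC (↑ ↑ ↑ s) (↑ v0) v0)))
             (toℕC (entryC (↑ ↑ ↑ s) (↑ v0) v0)))))

  originC : Γ ⟶ FinO N⁺
  originC = retype falseC (λ _ _ → zero) λ _ _ → refl

  closesC : Γ ⟶ Data → Γ ⟶ RowO → Γ ⟶ StateO → Γ ⟶ StateO → Γ ⟶ BoolO
  closesC d τ t s = andC
    (allC (csC d) (sameC (lookupC (↑ τ) v0) (lookupC (lookupC (↑ t) originC) v0)))
    (agreesC d s (ifC (isZeroC (↑ v0)) zeroC (toℕC (entryC (↑ ↑ t) (↑ v0) v0))))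

  initialC : Γ ⟶ Data → Γ ⟶ CodeO → Γ ⟶ StateO → Γ ⟶ BoolO
  initialC d X-colour s = agreesC d s
    (ifC (isZeroC (↑ v0)) zeroC (countC (vsC (↑ ↑ d)) zeroC
      (andC (inXC (↑ ↑ ↑ d) v0) (andC (nearC (↑ ↑ ↑ d) (↑ ↑ v0) v0)
        (equalC (↑ v0) (lookupC (↑ ↑ ↑ X-colour) v0))))))

  acceptingC : Γ ⟶ Data → Γ ⟶ StateO → Γ ⟶ BoolO
  acceptingC d s = allC (zsC d) (orC (isZeroC v0) (orC (notC (inX⁺C (↑ d) v0))
    (anyC (csC (↑ d)) (equalC (entryC (↑ ↑ s) (↑ v0) v0) (natC 1)))))

  colourCliqueC : Γ ⟶ Data → Γ ⟶ CodeO → Γ ⟶ FinO N → Γ ⟶ RowO → Γ ⟶ BListO StateO Q → Γ ⟶ BListO StateO Q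
  colourCliqueC d X-colour v τ S = foldrC
    (ifC (inCliqueC (↑ d) (↑ v) (fstC ∘C v0))
         (filterC (statesC (↑ d)) (anyC (↑ (sndC ∘C v0))
           (colourStepC (↑ ↑ ↑ d) (↑ ↑ ↑ X-colour) (↑ ↑ ↑ τ) (↑ ↑ (fstC ∘C v0)) v0 (↑ v0))))
         (sndC ∘C v0))
    S (vsC d)

  nextCliqueC : Γ ⟶ Data → Γ ⟶ CodeO → Γ ⟶ FinO N → Γ ⟶ BListO StateO Q → Γ ⟶ BListO StateO Q
  nextCliqueC d X-colour v S = filterC (statesC d)
    (anyC (rowsC (↑ d)) (anyC (colourCliqueC (↑ ↑ d) (↑ ↑ X-colour) (↑ ↑ v) v0 (↑ ↑ S))
      (closesC (↑ ↑ ↑ d) (↑ v0) v0 (↑ ↑ v0))))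

  reachableC : Γ ⟶ Data → Γ ⟶ CodeO → Γ ⟶ BListO StateO Q
  reachableC d X-colour = foldrC (nextCliqueC (↑ d) (↑ X-colour) (fstC ∘C v0) (sndC ∘C v0))
    (filterC (statesC d) (initialC (↑ d) (↑ X-colour) v0)) (vsC d)

  answerC : Γ ⟶ Data → Γ ⟶ BoolO
  answerC d = anyC (csC d) (anyC (codesC (↑ d)) (anyC (reachableC (↑ ↑ d) v0) (acceptingC (↑ ↑ ↑ d) v0)))

  -- `refl` suffices because the combinators follow the algorithm clause by clause and all
  -- components of `Data` are determined by the index.
  answerC-fun : ∀ (d : Γ ⟶ Data) i γ → fun (answerC d) i γ ≡ Alg.answer i (bounded (Alg.states i) (states≤ i))
  answerC-fun d i γ = refl

-- The number of colours that suffices for a modulator of size d.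
palette : ℕ → ℕ
palette d = 3 + d * 2

-- There are roughly `2 ^ (4 * palette d * palette d)` states. The square is rounded up to a power
-- of two with exponent `2 * palette d`, so that the final bound is composed of affine functions and
-- `2 ^_`, which are easily computed.
exponent : ℕ → ℕ
exponent d = 2 ^ (d * 4 + 6)

palette² : ∀ d → palette d * palette d ≤ exponent d
palette² d = begin
  palette d * palette d         ≤⟨ *-mono-≤ (<⇒≤ (n<2^n (palette d))) (<⇒≤ (n<2^n (palette d))) ⟩
  2 ^ palette d * 2 ^ palette d ≡⟨ ≡-sym (^-distribˡ-+-* 2 (palette d) (palette d)) ⟩
  2 ^ (palette d + palette d)   ≡⟨ cong (2 ^_) (eq d) ⟩
  exponent d                    ∎
  where
  open ≤-Reasoning
  eq : ∀ d → (3 + d * 2) + (3 + d * 2) ≡ d * 4 + 6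
  eq = solve-∀

palette≤ : ∀ d → palette d ≤ exponent d
palette≤ d = ≤-trans (m≤m*n (palette d) (palette d)) (palette² d)

suc≤palette : ∀ d → suc d ≤ palette d
suc≤palette d = s≤s (≤-trans (≤-trans (m≤m*n d 2) (n≤1+n _)) (n≤1+n _))

2^-mono : ∀ {a b} → a ≤ b → 2 ^ a ≤ 2 ^ b
2^-mono = ^-monoʳ-≤ 2

colours≤ : ∀ d {k} → k ≤ palette d → k ≤ 2 ^ (exponent d * 1)
colours≤ d k≤ = ≤-trans k≤ (≤-trans (palette≤ d) (≤-trans (<⇒≤ (n<2^n (exponent d)))
  (2^-mono (≤-reflexive (≡-sym (*-identityʳ (exponent d)))))))

5^≤ : ∀ {k m} → k ≤ m → 5 ^ k ≤ 2 ^ (3 * m)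
5^≤ {k} {m} k≤m = begin
  5 ^ k       ≤⟨ ^-monoˡ-≤ k (m≤m+n 5 3) ⟩
  8 ^ k       ≤⟨ ^-monoʳ-≤ 8 k≤m ⟩
  (2 ^ 3) ^ m ≡⟨ ^-*-assoc 2 3 m ⟩
  2 ^ (3 * m) ∎
  where open ≤-Reasoning

rowCount≤ : ∀ d {k} → k ≤ palette d → 5 ^ k ≤ 2 ^ (exponent d * 3)
rowCount≤ d {k} k≤ = ≤-trans (5^≤ k≤) (2^-mono (≤-trans (*-monoʳ-≤ 3 (palette≤ d)) (≤-reflexive (*-comm 3 (exponent d)))))

-- `suc d` rows vary: one for each vertex of `X` and one for the current clique. Both 5 and
-- `suc (5 ^ k)` are the `suc q` of `length-enumerate`, for 4 capped counts and for at most `5 ^ k`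
-- rows.
stateCount≤ : ∀ d {k} → k ≤ palette d → suc (5 ^ k) ^ suc d ≤ 2 ^ (exponent d * 4)
stateCount≤ d {k} k≤ = begin
  suc (5 ^ k) ^ suc d                  ≤⟨ ^-monoˡ-≤ (suc d) base ⟩
  (2 ^ (4 * palette d)) ^ suc d        ≡⟨ ^-*-assoc 2 (4 * palette d) (suc d) ⟩
  2 ^ (4 * palette d * suc d)          ≤⟨ 2^-mono (*-monoʳ-≤ (4 * palette d) (suc≤palette d)) ⟩
  2 ^ (4 * palette d * palette d)      ≡⟨ cong (2 ^_) (*-assoc 4 (palette d) (palette d)) ⟩
  2 ^ (4 * (palette d * palette d))    ≤⟨ 2^-mono (*-monoʳ-≤ 4 (palette² d)) ⟩
  2 ^ (4 * exponent d)                 ≡⟨ cong (2 ^_) (*-comm 4 (exponent d)) ⟩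
  2 ^ (exponent d * 4)                 ∎
  where
  open ≤-Reasoning
  base : suc (5 ^ k) ≤ 2 ^ (4 * palette d)
  base = begin
    suc (5 ^ k)                               ≤⟨ +-mono-≤ (m^n>0 2 (3 * palette d)) (5^≤ k≤) ⟩
    2 ^ (3 * palette d) + 2 ^ (3 * palette d) ≡⟨ cong (2 ^ (3 * palette d) +_) (≡-sym (+-identityʳ _)) ⟩
    2 ^ suc (3 * palette d)                   ≤⟨ 2^-mono (s≤s (≤-trans (m≤n+m (3 * palette d) (2 + d * 2)) ≤-refl)) ⟩
    2 ^ (4 * palette d)                       ∎

codeCount≤ : ∀ d {k} → k ≤ palette d → suc k ^ d ≤ 2 ^ (exponent d * 1)
codeCount≤ d {k} k≤ = begin
  suc k ^ d                     ≤⟨ ^-monoˡ-≤ d (≤-trans (s≤s k≤) (n<2^n (palette d))) ⟩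
  (2 ^ palette d) ^ d           ≡⟨ ^-*-assoc 2 (palette d) d ⟩
  2 ^ (palette d * d)           ≤⟨ 2^-mono (*-monoʳ-≤ (palette d) (<⇒≤ (suc≤palette d))) ⟩
  2 ^ (palette d * palette d)   ≤⟨ 2^-mono (≤-trans (palette² d) (≤-reflexive (≡-sym (*-identityʳ _)))) ⟩
  2 ^ (exponent d * 1)          ∎
  where open ≤-Reasoning

-- The weight of an instance and the sizes it bounds

module I = CFInstance

weight : CFInstance → ℕ
weight I = 2 ^ exponent ∣ I.X I ∣ * I.n I

1≤n : ∀ I → 1 ≤ I.n I
1≤n I = >-nonZero⁻¹ (I.n I) {{proj₁ (I.connected I)}}

instances : Index
instances = record
  { Ix  = CFInstance
  ; W   = weight
  ; 2≤W = λ I → *-mono-≤ (2^-mono (m^n>0 2 (∣ I.X I ∣ * 4 + 6))) (1≤n I)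
  }

parameterSize : (f : CFInstance → ℕ) (c : ℕ) → (∀ I → f I ≤ 2 ^ (exponent ∣ I.X I ∣ * c)) → Size instances
parameterSize f c f≤ = size f c λ I → begin
  f I                                ≤⟨ f≤ I ⟩
  2 ^ (exponent ∣ I.X I ∣ * c)       ≡⟨ ≡-sym (^-*-assoc 2 (exponent ∣ I.X I ∣) c) ⟩
  (2 ^ exponent ∣ I.X I ∣) ^ c       ≤⟨ ^-monoˡ-≤ c (≤-trans (≤-reflexive (≡-sym (*-identityʳ _))) (*-monoʳ-≤ (2 ^ exponent ∣ I.X I ∣) (1≤n I))) ⟩
  weight I ^ c                       ∎
  where open ≤-Reasoning

-- The weight does not involve `k`, so only after this truncation do the lists of colours, rows and
-- states have polynomial size in it.
colours : CFInstance → ℕ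
colours I = I.k I ⊓ palette ∣ I.X I ∣

colours≤palette : ∀ I → colours I ≤ palette ∣ I.X I ∣
colours≤palette I = m⊓n≤n (I.k I) _

N̂ K̂ R̂ Q̂ P̂ : Size instances
N̂ = size I.n 1 λ I → begin
  I.n I              ≤⟨ m≤n*m (I.n I) (2 ^ exponent ∣ I.X I ∣) {{m^n≢0 2 (exponent ∣ I.X I ∣)}} ⟩
  weight I           ≡⟨ ≡-sym (*-identityʳ (weight I)) ⟩
  weight I ^ 1       ∎
  where open ≤-Reasoning
K̂ = parameterSize colours 1 λ I → colours≤ ∣ I.X I ∣ (colours≤palette I)
R̂ = parameterSize (λ I → 5 ^ colours I) 3 λ I → rowCount≤ ∣ I.X I ∣ (colours≤palette I)
Q̂ = parameterSize (λ I → suc (5 ^ colours I) ^ suc ∣ I.X I ∣) 4 λ I → stateCount≤ ∣ I.X I ∣ (colours≤palette I)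
P̂ = parameterSize (λ I → suc (colours I) ^ ∣ I.X I ∣) 1 λ I → codeCount≤ ∣ I.X I ∣ (colours≤palette I)

-- The program obtains k ⊓ palette d by moving palette d units, as long as
-- there are any, from a counter that starts with k to another one.
move : ℕ × ℕ → ℕ × ℕ
move (zero , m)  = zero , m
move (suc r , m) = r , suc m

move-suc : ∀ r m → move (r , suc m) ≡ (proj₁ (move (r , m)) , suc (proj₂ (move (r , m))))
move-suc zero    m = refl
move-suc (suc r) m = refl

move-⊓ : ∀ k j → move (k ∸ j , k ⊓ j) ≡ (k ∸ suc j , k ⊓ suc j)
move-⊓ zero    zero    = refl
move-⊓ zero    (suc j) = refl
move-⊓ (suc k) zero    = cong (λ m → k , suc m) (≡-sym (⊓-zeroʳ k))
move-⊓ (suc k) (suc j) = trans (move-suc (k ∸ j) (k ⊓ j))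
  (cong (λ p → proj₁ p , suc (proj₂ p)) (move-⊓ k j))

moveMany : ℕ → List Bool → ℕ × ℕ
moveMany k = foldr (λ b p → if b then move (move p) else p) (move (move (move (k , 0))))

moveMany-⊓ : ∀ k {n} (p : Subset n) → moveMany k (toList p) ≡ (k ∸ palette ∣ p ∣ , k ⊓ palette ∣ p ∣)
moveMany-⊓ k [] = begin
  move (move (move (k , 0)))           ≡⟨ cong (λ m → move (move (move (k , m)))) (≡-sym (⊓-zeroʳ k)) ⟩
  move (move (move (k ∸ 0 , k ⊓ 0)))   ≡⟨ cong (move ∘ move) (move-⊓ k 0) ⟩
  move (move (k ∸ 1 , k ⊓ 1))          ≡⟨ cong move (move-⊓ k 1) ⟩
  move (k ∸ 2 , k ⊓ 2)                 ≡⟨ move-⊓ k 2 ⟩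
  (k ∸ 3 , k ⊓ 3)                      ∎
  where open ≡-Reasoning
moveMany-⊓ k (false ∷ p) = moveMany-⊓ k p
moveMany-⊓ k (true ∷ p)  = begin
  move (move (moveMany k (toList p)))                            ≡⟨ cong (move ∘ move) (moveMany-⊓ k p) ⟩
  move (move (k ∸ palette ∣ p ∣ , k ⊓ palette ∣ p ∣))            ≡⟨ cong move (move-⊓ k (palette ∣ p ∣)) ⟩
  move (k ∸ suc (palette ∣ p ∣) , k ⊓ suc (palette ∣ p ∣))       ≡⟨ move-⊓ k (suc (palette ∣ p ∣)) ⟩
  (k ∸ palette (suc ∣ p ∣) , k ⊓ palette (suc ∣ p ∣))            ∎
  where open ≡-Reasoning

module _ {𝕀 : Index} {Γ : Obj 𝕀} where

  moveC : Γ ⟶ NatO ⊗ NatO → Γ ⟶ NatO ⊗ NatO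
  moveC t .prog    = prog t ⨾ (`if `hd `then `cons (`hd ⨾ `tl) (`cons `nil `tl) `else `id)
  moveC t .fun i γ = move (fun t i γ)
  moveC t .time    = # 1 ⊞ (time t ⊞ # 9)
  moveC t .run i γ = seqW (run t i γ) (go (fun t i γ))
    where
    go : ∀ p → (`if `hd `then `cons (`hd ⨾ `tl) (`cons `nil `tl) `else `id)
               ⟨ enc {𝕀} (NatO ⊗ NatO) i p ⟩⇓ enc {𝕀} (NatO ⊗ NatO) i (move p) within 9
    go (zero , m)  = weaken (m≤m+n 3 6) (exactly (⇓else ⇓hd ⇓id))
    go (suc r , m) = exactly (⇓then ⇓hd (⇓cons (⇓seq ⇓hd ⇓tl) (⇓cons ⇓nil ⇓tl)))

  -- A unary numeral and a vector of `false` have the same encoding, so `indicesC` applies to a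
  -- computed number.
  unaryC : ∀ (L : Size 𝕀) (t : Γ ⟶ NatO) → (∀ i γ → fun t i γ ≡ value L i) → Γ ⟶ VecO BoolO L
  unaryC L t eq = retype t (λ i γ → replicate (value L i) false)
    λ i γ → trans (cong ⌜_⌝ⁿ (eq i γ)) (encode-replicate (value L i))
    where
    encode-replicate : ∀ m → ⌜ m ⌝ⁿ ≡ encodeVec ⌜_⌝ᵇ (replicate m false)
    encode-replicate zero    = refl
    encode-replicate (suc m) = cong (nil ∙_) (encode-replicate m)

-- The decision program on encoded instances

Input : Obj instances
Input = Const (VecO (VecO BoolO N̂) N̂) (λ I → tabulate (N (I.G I))) ⊗
        (Const (VecO BoolO N̂) I.X ⊗ Const NatO I.k)

module _ (adjacency : ∀ I → Vec (Vec Bool (I.n I)) (I.n I))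
         (adjacencyC : Input ⟶ Const (VecO (VecO BoolO N̂) N̂) adjacency) where

  tables : Tables N̂ K̂ Q̂ R̂ P̂
  tables = record
    { adjacency = adjacency
    ; modulator = I.X
    ; states≤   = λ I → length-enumerate (tabulate λ _ → zero) {as = Algorithm.rows (adjacency I) (I.X I) (colours I)} (true ∷ I.X I) (rows≤ I)
    ; rows≤     = rows≤
    ; codes≤    = λ I → length-enumerate 0 {as = map toℕ (List.allFin (colours I))} (I.X I)
        (≤-reflexive (trans (length-map toℕ (List.allFin (colours I))) (length-tabulate id)))
    }
    where
    rows≤ : ∀ I → length (Algorithm.rows (adjacency I) (I.X I) (colours I)) ≤ 5 ^ colours I
    rows≤ I = ≤-trans (length-enumerate zero {m = colours I} {as = List.allFin 4} (tabulate λ _ → true) ≤-refl)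
                      (^-monoʳ-≤ 5 (∣p∣≤n (tabulate {n = colours I} λ _ → true)))

  open Program tables

  modulatorC : Input ⟶ VecO BoolO N̂
  modulatorC = constC _ ∘C fstC ∘C sndC

  verticesC : Input ⟶ Vertices
  verticesC = indicesC modulatorC

  modulator⁺C : Input ⟶ Modulator⁺
  modulator⁺C = known (trueC ,C modulatorC) _ λ _ _ → refl

  positionsC : Input ⟶ Positions
  positionsC = indicesC (constC _ ∘C modulator⁺C)

  paletteC : Input ⟶ NatO
  paletteC = sndC ∘C foldrC
    (ifC (fstC ∘C sndC) (moveC (moveC (sndC ∘C sndC))) (sndC ∘C sndC))
    (moveC (moveC (moveC (constC I.k ∘C sndC ∘C sndC ,C zeroC)))) (fromVecC modulatorC)

  coloursC : Input ⟶ Colours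
  coloursC = indicesC (unaryC K̂ paletteC λ I γ → cong proj₂ (moveMany-⊓ (I.k I) (I.X I)))

  adjacency⁺C : Input ⟶ Adjacency⁺
  adjacency⁺C = known (tabulateC verticesC trueC ,C constC _ ∘C adjacencyC) _ λ _ _ → refl

  allRowsC : Input ⟶ Rows
  allRowsC = known (enumerateC (FinO (# 4)) (# 4) R̂
    (constC _ ∘C indicesC (unaryC (# 4) (natC 4) λ _ _ → refl)) (smallC 4 zero) (tabulateC coloursC trueC)
    λ I γ → ^-monoʳ-≤ 5 (∣p∣≤n (tabulate {n = colours I} λ _ → true))) _ λ _ _ → refl

  allStatesC : Input ⟶ States
  allStatesC = known (enumerateC RowO R̂ Q̂ (constC _ ∘C allRowsC) (tabulateC coloursC (smallC 4 zero))
    (constC _ ∘C modulator⁺C) λ I γ → ≤-refl) _ λ _ _ → refl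

  allCodesC : Input ⟶ Codes
  allCodesC = known (enumerateC NatO K̂ P̂ (mapC (constC _ ∘C coloursC) (toℕC sndC)) zeroC modulatorC
    λ I γ → ≤-refl) _ λ _ _ → refl

  dataC : Input ⟶ Data
  dataC = (((((((((verticesC ,C positionsC) ,C coloursC) ,C adjacencyC) ,C known modulatorC _ λ _ _ → refl)
            ,C adjacency⁺C) ,C modulator⁺C) ,C allRowsC) ,C allStatesC) ,C allCodesC)

  decideC : Input ⟶ BoolO
  decideC = answerC dataC

  decideC-fun : ∀ I γ → fun decideC I γ ≡ Algorithm.answer (adjacency I) (I.X I) (colours I)
    (bounded (Algorithm.states (adjacency I) (I.X I) (colours I)) (Tables.states≤ tables I))
  decideC-fun I γ = answerC-fun dataC I γ

-- The matrices of open and closed neighbourhoods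

openMatrix closedMatrix : ∀ I → Vec (Vec Bool (I.n I)) (I.n I)
openMatrix   I = tabulate (N (I.G I))
closedMatrix I = tabulate (N[_] (I.G I))

openMatrixC : Input ⟶ Const (VecO (VecO BoolO N̂) N̂) openMatrix
openMatrixC = fstC

closedMatrixC : Input ⟶ Const (VecO (VecO BoolO N̂) N̂) closedMatrix
closedMatrixC = known (tabulateC vs (tabulateC (vs ∘C fstC)
  (orC (lookupC (lookupC (constC openMatrix ∘C fstC ∘C fstC ∘C fstC) (sndC ∘C fstC)) sndC)
       (equalC (sndC ∘C fstC) (toℕC sndC))))) closedMatrix λ I γ → cong (encodeVec (encodeVec ⌜_⌝ᵇ)) (eq I)
  where
  vs : Input ⟶ Indices N̂
  vs = indicesC (constC I.X ∘C fstC ∘C sndC)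

  lookup-⁅⁆ : ∀ {n} (u v : Fin n) → (u == v) ≡ lookup ⁅ u ⁆ v
  lookup-⁅⁆ zero    zero    = refl
  lookup-⁅⁆ zero    (suc v) = ≡-sym (lookup-replicate v false)
  lookup-⁅⁆ (suc u) zero    = refl
  lookup-⁅⁆ (suc u) (suc v) = lookup-⁅⁆ u v

  eq : ∀ I → tabulate (λ u → tabulate (λ v → lookup (lookup (openMatrix I) u) v ∨ (u == v))) ≡ closedMatrix I
  eq I = tabulate-cong λ u → trans (tabulate-cong λ v → begin
      lookup (lookup (openMatrix I) u) v ∨ (u == v) ≡⟨ cong₂ _∨_ (cong (λ r → lookup r v) (lookup∘tabulate (N (I.G I)) u)) (lookup-⁅⁆ u v) ⟩
      lookup (N (I.G I) u) v ∨ lookup ⁅ u ⁆ v       ≡⟨ ≡-sym (lookup-zipWith _∨_ v (N (I.G I) u) ⁅ u ⁆) ⟩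
      lookup (N[_] (I.G I) u) v                     ∎)
    (tabulate∘lookup (N[_] (I.G I) u))
    where open ≡-Reasoning

-- Boolean quantifiers, counting and capped arithmetic

module _ {A : Set} (p : A → Bool) where

  any-elim : ∀ xs → T (any p xs) → ∃[ a ] a ∈ xs × T (p a)
  any-elim xs t = find (any⁻ p xs t)

  any-intro : ∀ {a xs} → a ∈ xs → T (p a) → T (any p xs)
  any-intro a∈ pa = any⁺ p (lose a∈ pa)

  filter-elim : ∀ {a xs} → a ∈ filterᵇ p xs → a ∈ xs × T (p a)
  filter-elim = ∈-filter⁻ (T? ∘ p)

  filter-intro : ∀ {a xs} → a ∈ xs → T (p a) → a ∈ filterᵇ p xs
  filter-intro = ∈-filter⁺ (T? ∘ p)

all-elim : ∀ {n} (p : Fin n → Bool) → T (all p (allFin n)) → ∀ i → T (p i)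
all-elim {n} p t i = All.lookup (All.all⁺ p (allFin n) t) (∈-allFin i)

all-intro : ∀ {n} (p : Fin n → Bool) → (∀ i → T (p i)) → T (all p (allFin n))
all-intro {n} p h = All.all⁻ p (All.tabulate {xs = allFin n} λ {i} _ → h i)

==-sound : ∀ {n} {i j : Fin n} → T (i == j) → i ≡ j
==-sound t = toℕ-injective (≡ᵇ⇒≡ _ _ t)

==-refl : ∀ {n} (i : Fin n) → T (i == i)
==-refl i = ≡⇒≡ᵇ (toℕ i) (toℕ i) refl

≢⇒== : ∀ {n} {i j : Fin n} → i ≢ j → (i == j) ≡ false
≢⇒== {i = i} {j} i≢j with i == j in eq
... | true  = ⊥-elim (i≢j (==-sound (from T-≡ eq)))
... | false = refl

⟦_⟧ : Bool → ℕ
⟦ b ⟧ = if b then 1 else 0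

number : ∀ {A : Set} → (A → Bool) → List A → ℕ
number P []       = 0
number P (a ∷ as) = ⟦ P a ⟧ + number P as

number-+ : ∀ {A : Set} {P Q R : A → Bool} → (∀ a → ⟦ P a ⟧ ≡ ⟦ Q a ⟧ + ⟦ R a ⟧) → ∀ as →
           number P as ≡ number Q as + number R as
number-+ eq [] = refl
number-+ {P = P} {Q} {R} eq (a ∷ as) = trans (cong₂ _+_ (eq a) (number-+ eq as))
  (interchange ⟦ Q a ⟧ ⟦ R a ⟧ (number Q as) (number R as))
  where
  interchange : ∀ a b c d → (a + b) + (c + d) ≡ (a + c) + (b + d)
  interchange = solve-∀

number-exchange : ∀ {A : Set} {P Q R S : A → Bool} → (∀ a → ⟦ P a ⟧ + ⟦ Q a ⟧ ≡ ⟦ R a ⟧ + ⟦ S a ⟧) → ∀ as →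
                  number P as + number Q as ≡ number R as + number S as
number-exchange eq [] = refl
number-exchange {P = P} {Q} {R} {S} eq (a ∷ as) = begin
  (⟦ P a ⟧ + number P as) + (⟦ Q a ⟧ + number Q as) ≡⟨ interchange ⟦ P a ⟧ _ ⟦ Q a ⟧ _ ⟩
  (⟦ P a ⟧ + ⟦ Q a ⟧) + (number P as + number Q as) ≡⟨ cong₂ _+_ (eq a) (number-exchange eq as) ⟩
  (⟦ R a ⟧ + ⟦ S a ⟧) + (number R as + number S as) ≡⟨ interchange ⟦ R a ⟧ ⟦ S a ⟧ _ _ ⟩
  (⟦ R a ⟧ + number R as) + (⟦ S a ⟧ + number S as) ∎
  where
  open ≡-Reasoning
  interchange : ∀ a b c d → (a + b) + (c + d) ≡ (a + c) + (b + d)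
  interchange = solve-∀

number-cong : ∀ {A : Set} {P Q : A → Bool} as → (∀ {a} → a ∈ as → P a ≡ Q a) → number P as ≡ number Q as
number-cong []       eq = refl
number-cong (a ∷ as) eq = cong₂ _+_ (cong ⟦_⟧ (eq (here refl))) (number-cong as (eq ∘ there))

number-none : ∀ {A : Set} {P : A → Bool} as → (∀ {a} → a ∈ as → P a ≡ false) → number P as ≡ 0
number-none []       eq = refl
number-none (a ∷ as) eq = cong₂ _+_ (cong ⟦_⟧ (eq (here refl))) (number-none as (eq ∘ there))

number-one : ∀ {n} {P : Fin n → Bool} {us u} → Unique us → u ∈ us → (∀ w → w ≢ u → P w ≡ false) →
             number P us ≡ ⟦ P u ⟧
number-one {P = P} (u∉ ∷ uniq) (here refl) only =
  trans (cong (⟦ P _ ⟧ +_) (number-none _ λ w∈ → only _ (All.lookup u∉ w∈ ∘ ≡-sym))) (+-identityʳ _)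
number-one {us = w ∷ us} (w∉ ∷ uniq) (there u∈) only =
  cong₂ _+_ (cong ⟦_⟧ (only w (All.lookup w∉ u∈))) (number-one uniq u∈ only)

cap : ℕ → ℕ
cap m = 3 ⊓ m

capSuc-cap : ∀ m → capSuc (cap m) ≡ cap (suc m)
capSuc-cap 0 = refl
capSuc-cap 1 = refl
capSuc-cap 2 = refl
capSuc-cap (suc (suc (suc m))) = refl

bump-cap : ∀ b m → (if b then capSuc (cap m) else cap m) ≡ cap (⟦ b ⟧ + m)
bump-cap true  m = capSuc-cap m
bump-cap false m = refl

-- Capping the counts after every clique does not affect the capped counts at the end.
cap-+ : ∀ m n → cap (m + cap n) ≡ cap (m + n)
cap-+ zero                n = trans (≡-sym (⊓-assoc 3 3 n)) refl
cap-+ 1 0 = refl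
cap-+ 1 1 = refl
cap-+ 1 (suc (suc n)) = refl
cap-+ 2 0 = refl
cap-+ 2 (suc n) = refl
cap-+ (suc (suc (suc m))) n = refl

cap-small : ∀ {m} → m < 4 → cap m ≡ m
cap-small (s≤s m≤3) = m≥n⇒m⊓n≡n m≤3

cap<4 : ∀ m → cap m < 4
cap<4 m = s≤s (m⊓n≤m 3 m)

cap-reflects : ∀ {m c} → c < 3 → c ≡ cap m → c ≡ m
cap-reflects {0} c<3 eq = eq
cap-reflects {1} c<3 eq = eq
cap-reflects {2} c<3 eq = eq
cap-reflects {suc (suc (suc m))} (s≤s (s≤s (s≤s ()))) refl

count-cap : ∀ {A : Set} (P : A → Bool) m as → count P (cap m) as ≡ cap (number P as + m)
count-cap P m []       = refl
count-cap P m (a ∷ as) = begin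
  (if P a then capSuc (count P (cap m) as) else count P (cap m) as)
    ≡⟨ cong (λ r → if P a then capSuc r else r) (count-cap P m as) ⟩
  (if P a then capSuc (cap (number P as + m)) else cap (number P as + m))
    ≡⟨ bump-cap (P a) (number P as + m) ⟩
  cap (⟦ P a ⟧ + (number P as + m))
    ≡⟨ cong cap (≡-sym (+-assoc ⟦ P a ⟧ _ m)) ⟩
  cap (number P (a ∷ as) + m) ∎
  where open ≡-Reasoning

-- Correctness of the dynamic program

module Correctness {n : ℕ} (A : Vec (Vec Bool n) n) (X : Vec Bool n) (k : ℕ) where
  open Algorithm A X k

  Colours : Set
  Colours = Fin n → Fin k

  neighbours : Colours → Fin n → Fin k → ℕ
  neighbours C v c = number (λ u → adj v u ∧ (c == C u)) vs

  ConflictFree : Colours → Set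
  ConflictFree C = ∀ v → ∃[ c ] neighbours C v c ≡ 1

  state : (Fin (suc n) → Fin k → ℕ) → State n k
  state g = tabulate λ z → tabulate λ c → fromℕ< (cap<4 (g z c))

  cell-state : ∀ g z c → cell (state g) z c ≡ cap (g z c)
  cell-state g z c = begin
    cell (state g) z c
      ≡⟨ cong (λ r → toℕ (lookup r c)) (lookup∘tabulate (λ z → tabulate λ c → fromℕ< (cap<4 (g z c))) z) ⟩
    toℕ (lookup (tabulate λ c → fromℕ< (cap<4 (g z c))) c)
      ≡⟨ cong toℕ (lookup∘tabulate (λ c → fromℕ< (cap<4 (g z c))) c) ⟩
    toℕ (fromℕ< (cap<4 (g z c)))
      ≡⟨ toℕ-fromℕ< (cap<4 (g z c)) ⟩
    cap (g z c) ∎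
    where open ≡-Reasoning

  cap-cell : ∀ s z c → cap (cell s z c) ≡ cell s z c
  cap-cell s z c = cap-small (toℕ<n (lookup (lookup s z) c))

  vec-ext : ∀ {B : Set} {m} {v w : Vec B m} → (∀ i → lookup v i ≡ lookup w i) → v ≡ w
  vec-ext {v = v} {w} eq = trans (≡-sym (tabulate∘lookup v)) (trans (tabulate-cong eq) (tabulate∘lookup w))

  state-ext : ∀ {s t} → (∀ z c → cell s z c ≡ cell t z c) → s ≡ t
  state-ext eq = vec-ext λ z → vec-ext λ c → toℕ-injective (eq z c)

  agrees-elim : ∀ {s} g → T (agrees s g) → ∀ z c → cell s z c ≡ g z c
  agrees-elim {s} g t z c = ≡ᵇ⇒≡ (cell s z c) (g z c)
    (all-elim (λ c → cell s z c ≡ᵇ g z c) (all-elim (λ z → all (λ c → cell s z c ≡ᵇ g z c) cs) t z) c)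

  agrees-intro : ∀ {s} g → (∀ z c → cell s z c ≡ g z c) → T (agrees s g)
  agrees-intro {s} g h = all-intro (λ z → all (λ c → cell s z c ≡ᵇ g z c) cs) λ z →
    all-intro (λ c → cell s z c ≡ᵇ g z c) λ c → ≡⇒≡ᵇ (cell s z c) (g z c) (h z c)

  row∈ : ∀ τ → τ ∈ rows
  row∈ τ = enumerate-complete zero (tabulate λ _ → true) τ (λ j _ → ∈-allFin (lookup τ j))
    λ j eq → ⊥-elim (true≢false (trans (≡-sym (lookup∘tabulate (λ _ → true) j)) eq))
    where
    true≢false : true ≢ false
    true≢false ()

  state∈ : ∀ s → (∀ z c → lookup X̂ z ≡ false → cell s z c ≡ 0) → s ∈ states
  state∈ s outside = enumerate-complete (tabulate λ _ → zero) X̂ s (λ z _ → row∈ (lookup s z))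
    λ z eq → vec-ext λ c → toℕ-injective (trans (outside z c eq) (≡-sym (cong toℕ (lookup∘tabulate (λ _ → zero) c))))

  state-outside : ∀ {s} → s ∈ states → ∀ z c → lookup X̂ z ≡ false → cell s z c ≡ 0
  state-outside s∈ z c eq =
    trans (cong (λ r → toℕ (lookup r c)) (enumerate-outside (tabulate λ _ → zero) {as = rows} X̂ s∈ z eq))
          (cong toℕ (lookup∘tabulate (λ _ → zero) c))

  near-outside : ∀ {z} u → lookup X̂ z ≡ false → near z u ≡ false
  near-outside u eq = cong (_∧ _) eq

  module _ {q} (Σ : BoundedList (State n k) q) (Σ-states : list Σ ≡ states) (X-colour : Vec ℕ n) where

    gain : (Fin n → Bool) → Colours → List (Fin n) → Fin (suc n) → Fin k → ℕ
    gain B C us z c = number (λ u → B u ∧ near z u ∧ (c == C u)) us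

    gain-outside : ∀ B C us {z} c → lookup X̂ z ≡ false → gain B C us z c ≡ 0
    gain-outside B C us {z} c eq = number-none us λ {u} _ →
      trans (cong (λ b → B u ∧ b ∧ (c == C u)) (near-outside {z} u eq)) (∧-zeroʳ (B u))

    module _ (v : Fin n) (τ : Row k) (S : BoundedList (State n k) q) where

      B : Fin n → Bool
      B = inClique v

      select : Fin n → BoundedList (State n k) q → BoundedList (State n k) q
      select u T = filterB (λ s → any (λ t → colourStep X-colour τ u t s) (list T)) Σ

      coloured : List (Fin n) → BoundedList (State n k) q
      coloured = foldr (λ u T → if B u then select u T else T) S

      -- The invariant inside one clique. The guess `τ` is taken at face value here; it is justified
      -- only when the clique is closed.
      Extends : List (Fin n) → State n k → State n k → Colours → Set
      Extends us s₀ s C = (∀ {u} → u ∈ us → T (B u) → T (satisfied X-colour τ u (C u))) ×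
                          (∀ z c → cell s z c ≡ cap (gain B C us z c + cell s₀ z c))

      gain-skip : ∀ C u us → B u ≡ false → ∀ z c → gain B C (u ∷ us) z c ≡ gain B C us z c
      gain-skip C u us eq z c = cong (λ b → ⟦ b ∧ near z u ∧ (c == C u) ⟧ + gain B C us z c) eq

      gain-take : ∀ C u us → B u ≡ true → ∀ z c →
                  gain B C (u ∷ us) z c ≡ ⟦ near z u ∧ (c == C u) ⟧ + gain B C us z c
      gain-take C u us eq z c = cong (λ b → ⟦ b ∧ near z u ∧ (c == C u) ⟧ + gain B C us z c) eq

      bump-state : ∀ b g r → (if b then capSuc (cap (g + r)) else cap (g + r)) ≡ cap ((⟦ b ⟧ + g) + r)
      bump-state b g r = trans (bump-cap b (g + r)) (cong cap (≡-sym (+-assoc ⟦ b ⟧ g r)))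

      -- A colouring is read off from the run: the colour found for `u` overrides that of the
      -- colouring of the tail, whose vertices are unaffected because they differ from `u`. The
      -- given colouring fills in where no choice is made.
      colourClique-sound : ∀ us → Unique us → Colours → ∀ {s} → s ∈ list (coloured us) →
        ∃[ s₀ ] s₀ ∈ list S × ∃[ C ] Extends us s₀ s C
      colourClique-sound [] _ C {s} s∈ = s , s∈ , C , (λ ()) , λ z c → ≡-sym (cap-cell s z c)
      colourClique-sound (u ∷ us) (u∉ ∷ uniq) C₀ {s} s∈ = go (B u) refl s∈
        where
        go : ∀ b → B u ≡ b → s ∈ list (if b then select u (coloured us) else coloured us) →
             ∃[ s₀ ] s₀ ∈ list S × ∃[ C ] Extends (u ∷ us) s₀ s C
        go false eq s∈ = s₀ , proj₁ (proj₂ ih) , C , ok′ ,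
          λ z c → trans (proj₂ (proj₂ (proj₂ (proj₂ ih))) z c) (cong (λ g → cap (g + cell s₀ z c)) (≡-sym (gain-skip C u us eq z c)))
          where
          ih : ∃[ s₀ ] s₀ ∈ list S × ∃[ C ] Extends us s₀ s C
          ih = colourClique-sound us uniq C₀ s∈
          s₀ : State n k
          s₀ = proj₁ ih
          C : Colours
          C = proj₁ (proj₂ (proj₂ ih))
          ok : ∀ {w} → w ∈ us → T (B w) → T (satisfied X-colour τ w (C w))
          ok = proj₁ (proj₂ (proj₂ (proj₂ ih)))
          ok′ : ∀ {w} → w ∈ u ∷ us → T (B w) → T (satisfied X-colour τ w (C w))
          ok′ (here refl) Bu = ⊥-elim (subst T eq Bu)
          ok′ (there w∈)  Bw = ok w∈ Bw
        go true eq s∈ = s₀ , proj₁ (proj₂ ih) , C′ , ok′ , cells′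
          where
          viaColour : State n k → Fin k → Bool
          viaColour t c = satisfied X-colour τ u c ∧ agrees s (bumped u c t)
          previous : ∃[ t ] t ∈ list (coloured us) × T (colourStep X-colour τ u t s)
          previous = any-elim (λ t → colourStep X-colour τ u t s) (list (coloured us))
            (proj₂ (filter-elim (λ s → any (λ t → colourStep X-colour τ u t s) (list (coloured us))) {xs = list Σ} s∈))
          t : State n k
          t = proj₁ previous
          choice : ∃[ c ] c ∈ cs × T (viaColour t c)
          choice = any-elim (viaColour t) cs (proj₂ (proj₂ previous))
          c : Fin k
          c = proj₁ choice
          sat : T (satisfied X-colour τ u c)
          sat = proj₁ (to T-∧ (proj₂ (proj₂ choice)))
          cells : T (agrees s (bumped u c t))
          cells = proj₂ (to (T-∧ {satisfied X-colour τ u c}) (proj₂ (proj₂ choice)))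
          ih : ∃[ s₀ ] s₀ ∈ list S × ∃[ C ] Extends us s₀ t C
          ih = colourClique-sound us uniq C₀ (proj₁ (proj₂ previous))
          s₀ : State n k
          s₀ = proj₁ ih
          C : Colours
          C = proj₁ (proj₂ (proj₂ ih))
          ok : ∀ {w} → w ∈ us → T (B w) → T (satisfied X-colour τ w (C w))
          ok = proj₁ (proj₂ (proj₂ (proj₂ ih)))
          cells₀ : ∀ z c → cell t z c ≡ cap (gain B C us z c + cell s₀ z c)
          cells₀ = proj₂ (proj₂ (proj₂ (proj₂ ih)))
          C′ : Colours
          C′ = updateAt C u (const c)
          C′-u : C′ u ≡ c
          C′-u = updateAt-updates u C
          C′-us : ∀ {w} → w ∈ us → C′ w ≡ C w
          C′-us w∈ = updateAt-minimal _ u C (All.lookup u∉ w∈ ∘ ≡-sym)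
          ok′ : ∀ {w} → w ∈ u ∷ us → T (B w) → T (satisfied X-colour τ w (C′ w))
          ok′ (here refl) _  = subst (T ∘ satisfied X-colour τ u) (≡-sym C′-u) sat
          ok′ (there w∈)  Bw = subst (T ∘ satisfied X-colour τ _) (≡-sym (C′-us w∈)) (ok w∈ Bw)
          gain′ : ∀ z c′ → gain B C′ (u ∷ us) z c′ ≡ ⟦ near z u ∧ (c′ == c) ⟧ + gain B C us z c′
          gain′ z c′ = trans (gain-take C′ u us eq z c′) (cong₂ _+_
            (cong (λ d → ⟦ near z u ∧ (c′ == d) ⟧) C′-u)
            (number-cong us λ {w} w∈ → cong (λ d → B w ∧ near z w ∧ (c′ == d)) (C′-us w∈)))
          cells′ : ∀ z c′ → cell s z c′ ≡ cap (gain B C′ (u ∷ us) z c′ + cell s₀ z c′)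
          cells′ z c′ = begin
            cell s z c′
              ≡⟨ agrees-elim {s} (bumped u c t) cells z c′ ⟩
            (if b then capSuc (cell t z c′) else cell t z c′)
              ≡⟨ cong (λ r → if b then capSuc r else r) (cells₀ z c′) ⟩
            (if b then capSuc (cap (gain B C us z c′ + cell s₀ z c′)) else cap (gain B C us z c′ + cell s₀ z c′))
              ≡⟨ bump-state b (gain B C us z c′) (cell s₀ z c′) ⟩
            cap ((⟦ b ⟧ + gain B C us z c′) + cell s₀ z c′)
              ≡⟨ cong (λ g → cap (g + cell s₀ z c′)) (≡-sym (gain′ z c′)) ⟩
            cap (gain B C′ (u ∷ us) z c′ + cell s₀ z c′) ∎
            where
            open ≡-Reasoning
            b : Bool
            b = near z u ∧ (c′ == c)

      -- The colouring dictates the intermediate states: each is `s₀` plus the gain so far, capped.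
      -- It is among the enumerated states because its rows outside `X̂` vanish.
      colourClique-complete : ∀ us {s₀ s} C → s₀ ∈ states → s₀ ∈ list S → s ∈ states →
        Extends us s₀ s C → s ∈ list (coloured us)
      colourClique-complete [] {s₀} {s} C _ s₀∈ _ (_ , cells) =
        subst (_∈ list S) (state-ext λ z c → trans (≡-sym (cap-cell s₀ z c)) (≡-sym (cells z c))) s₀∈
      colourClique-complete (u ∷ us) {s₀} {s} C s₀∈Σ s₀∈ s∈Σ (ok , cells) = go (B u) refl
        where
        go : ∀ b → B u ≡ b → s ∈ list (if b then select u (coloured us) else coloured us)
        go false eq = colourClique-complete us C s₀∈Σ s₀∈ s∈Σ
          (ok ∘ there , λ z c → trans (cells z c) (cong (λ g → cap (g + cell s₀ z c)) (gain-skip C u us eq z c)))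
        go true eq = filter-intro (λ s → any (λ t → colourStep X-colour τ u t s) (list (coloured us)))
          (subst (s ∈_) (≡-sym Σ-states) s∈Σ)
          (any-intro (λ t → colourStep X-colour τ u t s) t∈
            (any-intro (λ c → satisfied X-colour τ u c ∧ agrees s (bumped u c t)) (∈-allFin (C u))
              (from T-∧ (ok (here refl) (from T-≡ eq) , agrees-intro {s} (bumped u (C u) t) cells′))))
          where
          g : Fin (suc n) → Fin k → ℕ
          g z c = gain B C us z c + cell s₀ z c
          t : State n k
          t = state g
          t∈ : t ∈ list (coloured us)
          t∈ = colourClique-complete us C s₀∈Σ s₀∈
            (state∈ t λ z c eq → trans (cell-state g z c) (cong cap (cong₂ _+_ (gain-outside B C us {z} c eq) (state-outside s₀∈Σ z c eq))))
            (ok ∘ there , cell-state g)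
          cells′ : ∀ z c → cell s z c ≡ (if near z u ∧ (c == C u) then capSuc (cell t z c) else cell t z c)
          cells′ z c = begin
            cell s z c ≡⟨ cells z c ⟩
            cap (gain B C (u ∷ us) z c + cell s₀ z c)
              ≡⟨ cong (λ g → cap (g + cell s₀ z c)) (gain-take C u us eq z c) ⟩
            cap ((⟦ b ⟧ + gain B C us z c) + cell s₀ z c)
              ≡⟨ ≡-sym (bump-state b (gain B C us z c) (cell s₀ z c)) ⟩
            (if b then capSuc (cap (g z c)) else cap (g z c))
              ≡⟨ cong (λ r → if b then capSuc r else r) (≡-sym (cell-state g z c)) ⟩
            (if b then capSuc (cell t z c) else cell t z c) ∎
            where
            open ≡-Reasoning
            b : Bool
            b = near z u ∧ (c == C u)

    target : Fin n → Fin k → Fin k → Fin 3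
    target u c c′ = if not (adj u u) ∧ (c′ == c) then suc (suc zero) else suc zero

    X-number : Fin n → Fin k → ℕ
    X-number u c = number (λ w → inX w ∧ adj u w ∧ (toℕ c ≡ᵇ lookup X-colour w)) vs

    clique-number : Colours → Fin n → Fin k → ℕ
    clique-number C v c = number (λ w → inClique v w ∧ (c == C w)) vs

    -- The exact counterpart of `satisfied`: uncapped, and with the actual counts of the clique in
    -- place of the guess.
    Okay : Colours → Fin n → Set
    Okay C u = ∃[ c′ ] toℕ (target u (C u) c′) ≡ X-number u c′ + clique-number C (leader u) c′

    module _ {τ : Row k} {g : Fin k → ℕ} (τ-g : ∀ c → toℕ (lookup τ c) ≡ cap (g c)) where

      count-target : ∀ u c → count (λ w → inX w ∧ adj u w ∧ (toℕ c ≡ᵇ lookup X-colour w)) (toℕ (lookup τ c)) vs ≡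
                             cap (X-number u c + g c)
      count-target u c = trans
        (cong (λ r → count (λ w → inX w ∧ adj u w ∧ (toℕ c ≡ᵇ lookup X-colour w)) r vs) (τ-g c))
        (count-cap (λ w → inX w ∧ adj u w ∧ (toℕ c ≡ᵇ lookup X-colour w)) (g c) vs)

      -- Targets lie below 3, so agreement with a capped count is agreement with the count.
      satisfied-elim : ∀ u c → T (satisfied X-colour τ u c) → ∃[ c′ ] toℕ (target u c c′) ≡ X-number u c′ + g c′
      satisfied-elim u c t = c′ , cap-reflects (toℕ<n (target u c c′)) (trans (≡ᵇ⇒≡ _ _ (proj₂ (proj₂ found))) (count-target u c′))
        where
        found : ∃[ c′ ] c′ ∈ cs × T (unique X-colour τ u c c′)
        found = any-elim (unique X-colour τ u c) cs t
        c′ : Fin k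
        c′ = proj₁ found

      satisfied-intro : ∀ u c → ∃[ c′ ] toℕ (target u c c′) ≡ X-number u c′ + g c′ → T (satisfied X-colour τ u c)
      satisfied-intro u c (c′ , eq) = any-intro (unique X-colour τ u c) (∈-allFin c′) (≡⇒≡ᵇ _ _
        (trans (trans (≡-sym (cap-small (≤-trans (toℕ<n (target u c c′)) (n≤1+n 3)))) (cong cap eq))
               (≡-sym (count-target u c′))))

    processed : List (Fin n) → Fin n → Bool
    processed ls u = not (inX u) ∧ any (λ v → leader u == v) ls

    X-gain : Fin (suc n) → Fin k → ℕ
    X-gain z c = number (λ u → inX u ∧ near z u ∧ (toℕ c ≡ᵇ lookup X-colour u)) vs

    -- What a state records between two cliques; position `zero` is then empty because `closes`
    -- resets it.
    total : List (Fin n) → Colours → Fin (suc n) → Fin k → ℕ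
    total ls C z c = if isZero z then 0 else X-gain z c + gain (processed ls) C vs z c

    total-outside : ∀ ls C {z} c → lookup X̂ z ≡ false → total ls C z c ≡ 0
    total-outside ls C {suc x} c eq = cong₂ _+_
      (number-none vs λ {u} _ → trans (cong (λ b → inX u ∧ b ∧ (toℕ c ≡ᵇ lookup X-colour u)) (near-outside {suc x} u eq)) (∧-zeroʳ (inX u)))
      (gain-outside (processed ls) C vs {suc x} c eq)

    start-total : ∀ C z c → start X-colour z c ≡ cap (total [] C z c)
    start-total C zero    c = refl
    start-total C (suc x) c = trans (count-cap (λ u → inX u ∧ near (suc x) u ∧ (toℕ c ≡ᵇ lookup X-colour u)) 0 vs)
      (cong (λ m → cap (X-gain (suc x) c + m)) (≡-sym (number-none vs λ {u} _ →
        cong (_∧ (near (suc x) u ∧ (c == C u))) (∧-zeroʳ (not (inX u))))))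

    gain-zero : ∀ v C c → gain (inClique v) C vs zero c ≡ clique-number C v c
    gain-zero v C c = number-cong vs λ {u} _ →
      cong (λ b → inClique v u ∧ b ∧ (c == C u)) (lookup∘tabulate (λ _ → true) u)

    data Split (v : Fin n) (ls : List (Fin n)) (u : Fin n) : Set where
      new : inClique v u ≡ true → processed ls u ≡ false → processed (v ∷ ls) u ≡ true → Split v ls u
      old : inClique v u ≡ false → processed (v ∷ ls) u ≡ processed ls u → Split v ls u

    clique-leader : ∀ {v u} → inClique v u ≡ true → leader u ≡ v
    clique-leader {v} {u} eq = ==-sound (proj₂ (to (T-∧ {not (inX u)}) (from T-≡ eq)))

    clique-outside : ∀ {v u} → inClique v u ≡ true → inX u ≡ false
    clique-outside {v} {u} eq = go (inX u) (proj₁ (to (T-∧ {not (inX u)}) (from T-≡ eq)))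
      where
      go : ∀ b → T (not b) → b ≡ false
      go false _ = refl

    processed-leader : ∀ {ls u} → T (processed ls u) → leader u ∈ ls
    processed-leader {ls} {u} t = subst (_∈ ls) (≡-sym (==-sound (proj₂ (proj₂ found)))) (proj₁ (proj₂ found))
      where
      found : ∃[ v ] v ∈ ls × T (leader u == v)
      found = any-elim (λ v → leader u == v) ls (proj₂ (to (T-∧ {not (inX u)}) t))

    split : ∀ {v ls} → All (v ≢_) ls → ∀ u → Split v ls u
    split {v} {ls} v∉ u = go (inX u) (leader u == v) (any (λ w → leader u == w) ls) refl refl refl
      where
      go : ∀ x e r → inX u ≡ x → (leader u == v) ≡ e → any (λ w → leader u == w) ls ≡ r → Split v ls u
      go true e r x≡ e≡ r≡ = old (cong (λ x → not x ∧ (leader u == v)) x≡)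
        (trans (cong (λ x → not x ∧ ((leader u == v) ∨ any (λ w → leader u == w) ls)) x≡)
               (≡-sym (cong (λ x → not x ∧ any (λ w → leader u == w) ls) x≡)))
      go false false r x≡ e≡ r≡ = old (cong₂ (λ x e → not x ∧ e) x≡ e≡)
        (cong (λ e → not (inX u) ∧ (e ∨ any (λ w → leader u == w) ls)) e≡)
      go false true false x≡ e≡ r≡ = new (cong₂ (λ x e → not x ∧ e) x≡ e≡) (cong₂ (λ x e → not x ∧ e) x≡ r≡)
        (cong₂ (λ x e → not x ∧ (e ∨ any (λ w → leader u == w) ls)) x≡ e≡)
      go false true true x≡ e≡ r≡ = ⊥-elim (All.lookup v∉
        (processed-leader {ls} {u} (from T-∧ (subst (T ∘ not) (≡-sym x≡) _ , from T-≡ r≡)))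
        (≡-sym (==-sound (from T-≡ e≡))))

    module _ {v ls} (v∉ : All (v ≢_) ls) {C C₁ C₂ : Colours}
             (C≡C₁ : ∀ {u} → inClique v u ≡ true → C u ≡ C₁ u)
             (C≡C₂ : ∀ {u} → inClique v u ≡ false → C u ≡ C₂ u) where

      -- With three colourings this serves both directions: for soundness `C` is glued from a
      -- colouring `C₁` of the new clique and a colouring `C₂` of the earlier ones; for completeness
      -- all three coincide.
      gain-split : ∀ z c → gain (processed (v ∷ ls)) C vs z c ≡
                           gain (inClique v) C₁ vs z c + gain (processed ls) C₂ vs z c
      gain-split z c = number-+ (λ u → go u (split v∉ u)) vs
        where
        go : ∀ u → Split v ls u → ⟦ processed (v ∷ ls) u ∧ near z u ∧ (c == C u) ⟧ ≡
             ⟦ inClique v u ∧ near z u ∧ (c == C₁ u) ⟧ + ⟦ processed ls u ∧ near z u ∧ (c == C₂ u) ⟧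
        go u (new B≡ ls≡ vls≡) = begin
          ⟦ processed (v ∷ ls) u ∧ near z u ∧ (c == C u) ⟧
            ≡⟨ cong₂ (λ b d → ⟦ b ∧ near z u ∧ (c == d) ⟧) vls≡ (C≡C₁ B≡) ⟩
          ⟦ near z u ∧ (c == C₁ u) ⟧
            ≡⟨ ≡-sym (+-identityʳ _) ⟩
          ⟦ near z u ∧ (c == C₁ u) ⟧ + 0
            ≡⟨ ≡-sym (cong₂ (λ b d → ⟦ b ∧ near z u ∧ (c == C₁ u) ⟧ + ⟦ d ∧ near z u ∧ (c == C₂ u) ⟧) B≡ ls≡) ⟩
          ⟦ inClique v u ∧ near z u ∧ (c == C₁ u) ⟧ + ⟦ processed ls u ∧ near z u ∧ (c == C₂ u) ⟧ ∎
          where open ≡-Reasoning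
        go u (old B≡ vls≡) = begin
          ⟦ processed (v ∷ ls) u ∧ near z u ∧ (c == C u) ⟧
            ≡⟨ cong₂ (λ b d → ⟦ b ∧ near z u ∧ (c == d) ⟧) vls≡ (C≡C₂ B≡) ⟩
          ⟦ processed ls u ∧ near z u ∧ (c == C₂ u) ⟧
            ≡⟨ ≡-sym (cong (λ b → ⟦ b ∧ near z u ∧ (c == C₁ u) ⟧ + ⟦ processed ls u ∧ near z u ∧ (c == C₂ u) ⟧) B≡) ⟩
          ⟦ inClique v u ∧ near z u ∧ (c == C₁ u) ⟧ + ⟦ processed ls u ∧ near z u ∧ (c == C₂ u) ⟧ ∎
          where open ≡-Reasoning

      total-split : ∀ x c → cap (gain (inClique v) C₁ vs (suc x) c + cap (total ls C₂ (suc x) c)) ≡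
                            cap (total (v ∷ ls) C (suc x) c)
      total-split x c = trans (cap-+ (gain (inClique v) C₁ vs (suc x) c) (total ls C₂ (suc x) c)) (cong cap
        (trans (rotate (gain (inClique v) C₁ vs (suc x) c) (X-gain (suc x) c) (gain (processed ls) C₂ vs (suc x) c))
               (cong (X-gain (suc x) c +_) (≡-sym (gain-split (suc x) c)))))
        where
        rotate : ∀ a b d → a + (b + d) ≡ b + (a + d)
        rotate = solve-∀

    reached : List (Fin n) → BoundedList (State n k) q
    reached = foldr (nextClique Σ X-colour) (filterB (initial X-colour) Σ)

    Explains : List (Fin n) → State n k → Colours → Set
    Explains ls s C = (∀ u → T (processed ls u) → Okay C u) × (∀ z c → cell s z c ≡ cap (total ls C z c))

    -- Each clique gets its colours from its own run, and gluing is harmless: `Okay` at `u` looks at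
    -- the colouring only within the clique of `u`, which is disjoint from the clique of `v` as `v`
    -- is not among the earlier leaders.
    reached-sound : ∀ ls → Unique ls → (C₀ : Colours) → ∀ {s} → s ∈ list (reached ls) →
      ∃[ C ] (∀ u → inX u ≡ true → C u ≡ C₀ u) × Explains ls s C
    reached-sound [] _ C₀ {s} s∈ = C₀ , (λ _ _ → refl) ,
      (λ u t → ⊥-elim (subst T (∧-zeroʳ (not (inX u))) t)) ,
      λ z c → trans (agrees-elim {s} (start X-colour) (proj₂ (filter-elim (initial X-colour) {xs = list Σ} s∈)) z c) (start-total C₀ z c)
    reached-sound (v ∷ ls) (v∉ ∷ uniq) C₀ {s} s∈ = C , fixed , okay , cells
      where
      S : BoundedList (State n k) q
      S = reached ls
      before : Row k → List (State n k)
      before τ = list (colourClique Σ X-colour v τ S)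
      guess : ∃[ τ ] τ ∈ rows × T (any (λ t → closes τ t s) (before τ))
      guess = any-elim (λ τ → any (λ t → closes τ t s) (before τ)) rows
        (proj₂ (filter-elim (λ s → any (λ τ → any (λ t → closes τ t s) (before τ)) rows) {xs = list Σ} s∈))
      τ : Row k
      τ = proj₁ guess
      end : ∃[ t ] t ∈ before τ × T (closes τ t s)
      end = any-elim (λ t → closes τ t s) (before τ) (proj₂ (proj₂ guess))
      t : State n k
      t = proj₁ end
      τ≡ : ∀ c → toℕ (lookup τ c) ≡ cell t zero c
      τ≡ c = ≡ᵇ⇒≡ _ _ (all-elim (λ c → lookup τ c == lookup (lookup t zero) c) (proj₁ (to T-∧ (proj₂ (proj₂ end)))) c)
      s≡ : ∀ z c → cell s z c ≡ closed t z c
      s≡ = agrees-elim {s} (closed t)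
        (proj₂ (to (T-∧ {all (λ c → lookup τ c == lookup (lookup t zero) c) cs}) (proj₂ (proj₂ end))))
      inner : ∃[ s₀ ] s₀ ∈ list S × ∃[ C ] Extends v τ S vs s₀ t C
      inner = colourClique-sound v τ S vs (allFin⁺ n) C₀ (proj₁ (proj₂ end))
      s₀ : State n k
      s₀ = proj₁ inner
      C₁ : Colours
      C₁ = proj₁ (proj₂ (proj₂ inner))
      sat : ∀ {u} → u ∈ vs → T (inClique v u) → T (satisfied X-colour τ u (C₁ u))
      sat = proj₁ (proj₂ (proj₂ (proj₂ inner)))
      t≡ : ∀ z c → cell t z c ≡ cap (gain (inClique v) C₁ vs z c + cell s₀ z c)
      t≡ = proj₂ (proj₂ (proj₂ (proj₂ inner)))
      outer : ∃[ C ] (∀ u → inX u ≡ true → C u ≡ C₀ u) × Explains ls s₀ C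
      outer = reached-sound ls uniq C₀ (proj₁ (proj₂ inner))
      C₂ : Colours
      C₂ = proj₁ outer
      s₀≡ : ∀ z c → cell s₀ z c ≡ cap (total ls C₂ z c)
      s₀≡ = proj₂ (proj₂ (proj₂ outer))
      C : Colours
      C u = if inClique v u then C₁ u else C₂ u
      C≡C₁ : ∀ {u} → inClique v u ≡ true → C u ≡ C₁ u
      C≡C₁ {u} eq = cong (λ b → if b then C₁ u else C₂ u) eq
      C≡C₂ : ∀ {u} → inClique v u ≡ false → C u ≡ C₂ u
      C≡C₂ {u} eq = cong (λ b → if b then C₁ u else C₂ u) eq
      fixed : ∀ u → inX u ≡ true → C u ≡ C₀ u
      fixed u eq = trans (C≡C₂ (cong (λ b → not b ∧ (leader u == v)) eq)) (proj₁ (proj₂ outer) u eq)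
      -- The clique counter of `s₀` is empty, so at closing time it holds the counts of this clique
      -- alone. Here the guess is verified.
      τ-number : ∀ c → toℕ (lookup τ c) ≡ cap (clique-number C v c)
      τ-number c = begin
        toℕ (lookup τ c)                                     ≡⟨ τ≡ c ⟩
        cell t zero c                                        ≡⟨ t≡ zero c ⟩
        cap (gain (inClique v) C₁ vs zero c + cell s₀ zero c) ≡⟨ cong (λ m → cap (gain (inClique v) C₁ vs zero c + m)) (s₀≡ zero c) ⟩
        cap (gain (inClique v) C₁ vs zero c + 0)             ≡⟨ cong cap (+-identityʳ _) ⟩
        cap (gain (inClique v) C₁ vs zero c)                 ≡⟨ cong cap (gain-zero v C₁ c) ⟩
        cap (clique-number C₁ v c)                           ≡⟨ cong cap (number-cong vs λ {w} _ → same w (inClique v w) refl) ⟩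
        cap (clique-number C v c)                            ∎
        where
        open ≡-Reasoning
        same : ∀ w b → inClique v w ≡ b → inClique v w ∧ (c == C₁ w) ≡ inClique v w ∧ (c == C w)
        same w true  eq = cong (λ d → inClique v w ∧ (c == d)) (≡-sym (C≡C₁ eq))
        same w false eq = trans (cong (_∧ (c == C₁ w)) eq) (≡-sym (cong (_∧ (c == C w)) eq))
      okay : ∀ u → T (processed (v ∷ ls) u) → Okay C u
      okay u pr = go (split v∉ u)
        where
        go : Split v ls u → Okay C u
        go (new B≡ _ _) = subst (λ l → ∃[ c′ ] toℕ (target u (C u) c′) ≡ X-number u c′ + clique-number C l c′)
          (≡-sym (clique-leader {v} {u} B≡))
          (satisfied-elim {τ} τ-number u (C u)
            (subst (T ∘ satisfied X-colour τ u) (≡-sym (C≡C₁ B≡)) (sat (∈-allFin u) (from T-≡ B≡))))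
        go (old B≡ vls≡) = proj₁ ok₂ ,
          trans (cong (λ c → toℕ (target u c (proj₁ ok₂))) (C≡C₂ B≡))
            (trans (proj₂ ok₂) (cong (X-number u (proj₁ ok₂) +_) (number-cong vs λ {w} _ → same w (inClique (leader u) w) refl)))
          where
          in-ls : T (processed ls u)
          in-ls = subst T vls≡ pr
          ok₂ : Okay C₂ u
          ok₂ = proj₁ (proj₂ (proj₂ outer)) u in-ls
          same : ∀ w b → inClique (leader u) w ≡ b →
                 inClique (leader u) w ∧ (proj₁ ok₂ == C₂ w) ≡ inClique (leader u) w ∧ (proj₁ ok₂ == C w)
          same w true eq = cong (λ d → inClique (leader u) w ∧ (proj₁ ok₂ == d)) (≡-sym (C≡C₂ other))
            where
            other : inClique v w ≡ false
            other = trans (cong (not (inX w) ∧_) (≢⇒== λ lw≡v → All.lookup v∉ (processed-leader {ls} {u} in-ls)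
              (trans (≡-sym lw≡v) (clique-leader {leader u} {w} eq)))) (∧-zeroʳ (not (inX w)))
          same w false eq = trans (cong (_∧ (proj₁ ok₂ == C₂ w)) eq) (≡-sym (cong (_∧ (proj₁ ok₂ == C w)) eq))
      cells : ∀ z c → cell s z c ≡ cap (total (v ∷ ls) C z c)
      cells zero    c = s≡ zero c
      cells (suc x) c = begin
        cell s (suc x) c ≡⟨ s≡ (suc x) c ⟩
        cell t (suc x) c ≡⟨ t≡ (suc x) c ⟩
        cap (gain (inClique v) C₁ vs (suc x) c + cell s₀ (suc x) c)
          ≡⟨ cong (λ m → cap (gain (inClique v) C₁ vs (suc x) c + m)) (s₀≡ (suc x) c) ⟩
        cap (gain (inClique v) C₁ vs (suc x) c + cap (total ls C₂ (suc x) c))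
          ≡⟨ total-split v∉ {C} {C₁} {C₂} C≡C₁ C≡C₂ x c ⟩
        cap (total (v ∷ ls) C (suc x) c) ∎
        where open ≡-Reasoning

    module _ (C : Colours) (okay : ∀ u → inX u ≡ false → Okay C u) where

      summary : List (Fin n) → State n k
      summary ls = state (total ls C)

      summary∈ : ∀ ls → summary ls ∈ states
      summary∈ ls = state∈ (summary ls) λ z c eq →
        trans (cell-state (total ls C) z c) (cong cap (total-outside ls C {z} c eq))

      -- Follows the run prescribed by `C`, in which the guess for each clique is its true capped
      -- colour count.
      reached-complete : ∀ ls → Unique ls → summary ls ∈ list (reached ls)
      reached-complete [] _ = filter-intro (initial X-colour) (subst (summary [] ∈_) (≡-sym Σ-states) (summary∈ []))
        (agrees-intro {summary []} (start X-colour) λ z c → trans (cell-state (total [] C) z c) (≡-sym (start-total C z c)))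
      reached-complete (v ∷ ls) (v∉ ∷ uniq) =
        filter-intro (λ s → any (λ τ → any (λ t → closes τ t s) (before τ)) rows)
          (subst (summary (v ∷ ls) ∈_) (≡-sym Σ-states) (summary∈ (v ∷ ls)))
          (any-intro (λ τ → any (λ t → closes τ t (summary (v ∷ ls))) (before τ)) (row∈ τ)
            (any-intro (λ t → closes τ t (summary (v ∷ ls))) t∈
              (from T-∧ (all-intro (λ c → lookup τ c == lookup (lookup t zero) c) (λ c → ≡⇒≡ᵇ _ _ (τ≡ c)) ,
                         agrees-intro {summary (v ∷ ls)} (closed t) s≡))))
        where
        S : BoundedList (State n k) q
        S = reached ls
        before : Row k → List (State n k)
        before τ = list (colourClique Σ X-colour v τ S)
        s₀ : State n k
        s₀ = summary ls
        τ : Row k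
        τ = tabulate λ c → fromℕ< (cap<4 (clique-number C v c))
        g : Fin (suc n) → Fin k → ℕ
        g z c = gain (inClique v) C vs z c + cell s₀ z c
        t : State n k
        t = state g
        τ-number : ∀ c → toℕ (lookup τ c) ≡ cap (clique-number C v c)
        τ-number c = trans (cong toℕ (lookup∘tabulate (λ c → fromℕ< (cap<4 (clique-number C v c))) c))
                           (toℕ-fromℕ< (cap<4 (clique-number C v c)))
        sat : ∀ {u} → u ∈ vs → T (inClique v u) → T (satisfied X-colour τ u (C u))
        sat {u} _ Bu = satisfied-intro {τ} τ-number u (C u)
          (subst (λ l → ∃[ c′ ] toℕ (target u (C u) c′) ≡ X-number u c′ + clique-number C l c′)
            (clique-leader {v} {u} (to T-≡ Bu)) (okay u (clique-outside {v} {u} (to T-≡ Bu))))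
        t∈ : t ∈ before τ
        t∈ = colourClique-complete v τ S vs C (summary∈ ls) (reached-complete ls uniq)
          (state∈ t λ z c eq → trans (cell-state g z c)
            (cong cap (cong₂ _+_ (gain-outside (inClique v) C vs {z} c eq) (state-outside (summary∈ ls) z c eq))))
          (sat , cell-state g)
        τ≡ : ∀ c → toℕ (lookup τ c) ≡ cell t zero c
        τ≡ c = begin
          toℕ (lookup τ c)                         ≡⟨ τ-number c ⟩
          cap (clique-number C v c)                ≡⟨ cong cap (≡-sym (gain-zero v C c)) ⟩
          cap (gain (inClique v) C vs zero c)      ≡⟨ cong cap (≡-sym (+-identityʳ _)) ⟩
          cap (gain (inClique v) C vs zero c + 0)  ≡⟨ cong (λ m → cap (gain (inClique v) C vs zero c + m)) (≡-sym (cell-state (total ls C) zero c)) ⟩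
          cap (g zero c)                           ≡⟨ ≡-sym (cell-state g zero c) ⟩
          cell t zero c                            ∎
          where open ≡-Reasoning
        s≡ : ∀ z c → cell (summary (v ∷ ls)) z c ≡ closed t z c
        s≡ zero    c = cell-state (total (v ∷ ls) C) zero c
        s≡ (suc x) c = begin
          cell (summary (v ∷ ls)) (suc x) c ≡⟨ cell-state (total (v ∷ ls) C) (suc x) c ⟩
          cap (total (v ∷ ls) C (suc x) c)
            ≡⟨ ≡-sym (total-split v∉ {C} {C} {C} (λ _ → refl) (λ _ → refl) x c) ⟩
          cap (gain (inClique v) C vs (suc x) c + cap (total ls C (suc x) c))
            ≡⟨ cong (λ m → cap (gain (inClique v) C vs (suc x) c + m)) (≡-sym (cell-state (total ls C) (suc x) c)) ⟩
          cap (g (suc x) c) ≡⟨ ≡-sym (cell-state g (suc x) c) ⟩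
          cell t (suc x) c ∎
          where open ≡-Reasoning

    Agrees : Colours → Set
    Agrees C = ∀ u → inX u ≡ true → lookup X-colour u ≡ toℕ (C u)

    module _ {C : Colours} (agree : Agrees C) where

      -- Every neighbour of `x` is counted once: through its code if it lies in `X`, and otherwise
      -- in the round of its leader.
      total-neighbours : ∀ x c → inX x ≡ true → total vs C (suc x) c ≡ neighbours C x c
      total-neighbours x c x∈ = ≡-sym (number-+ (λ u → go u (inX u) refl) vs)
        where
        near≡ : ∀ u → near (suc x) u ≡ adj x u
        near≡ u = cong (_∧ adj x u) x∈
        go : ∀ u b → inX u ≡ b → ⟦ adj x u ∧ (c == C u) ⟧ ≡
             ⟦ inX u ∧ near (suc x) u ∧ (toℕ c ≡ᵇ lookup X-colour u) ⟧ + ⟦ processed vs u ∧ near (suc x) u ∧ (c == C u) ⟧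
        go u true eq = begin
          ⟦ adj x u ∧ (c == C u) ⟧ ≡⟨ ≡-sym (cong₂ (λ b m → ⟦ b ∧ (toℕ c ≡ᵇ m) ⟧) (near≡ u) (agree u eq)) ⟩
          ⟦ near (suc x) u ∧ (toℕ c ≡ᵇ lookup X-colour u) ⟧ ≡⟨ ≡-sym (+-identityʳ _) ⟩
          ⟦ near (suc x) u ∧ (toℕ c ≡ᵇ lookup X-colour u) ⟧ + 0
            ≡⟨ cong (λ b → ⟦ b ∧ near (suc x) u ∧ (toℕ c ≡ᵇ lookup X-colour u) ⟧ +
                 ⟦ (not b ∧ any (λ v → leader u == v) vs) ∧ near (suc x) u ∧ (c == C u) ⟧) (≡-sym eq) ⟩
          ⟦ inX u ∧ near (suc x) u ∧ (toℕ c ≡ᵇ lookup X-colour u) ⟧ + ⟦ processed vs u ∧ near (suc x) u ∧ (c == C u) ⟧ ∎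
          where open ≡-Reasoning
        go u false eq = begin
          ⟦ adj x u ∧ (c == C u) ⟧ ≡⟨ ≡-sym (cong₂ (λ b d → ⟦ b ∧ d ∧ (c == C u) ⟧) all-leaders (near≡ u)) ⟩
          ⟦ any (λ v → leader u == v) vs ∧ near (suc x) u ∧ (c == C u) ⟧
            ≡⟨ cong (λ b → ⟦ b ∧ near (suc x) u ∧ (toℕ c ≡ᵇ lookup X-colour u) ⟧ +
                 ⟦ (not b ∧ any (λ v → leader u == v) vs) ∧ near (suc x) u ∧ (c == C u) ⟧) (≡-sym eq) ⟩
          ⟦ inX u ∧ near (suc x) u ∧ (toℕ c ≡ᵇ lookup X-colour u) ⟧ + ⟦ processed vs u ∧ near (suc x) u ∧ (c == C u) ⟧ ∎
          where
          open ≡-Reasoning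
          all-leaders : any (λ v → leader u == v) vs ≡ true
          all-leaders = to T-≡ (any-intro (λ v → leader u == v) (∈-allFin (leader u)) (==-refl (leader u)))

      module _ (cluster : ∀ {u w} → inX u ≡ false → inX w ≡ false →
                          adj u w ≡ (leader w == leader u) ∧ (not (u == w) ∨ adj u u))
               {u : Fin n} (u∉ : inX u ≡ false) where

        surplus : Fin k → Bool
        surplus c = not (adj u u) ∧ (c == C u)

        -- The clique count includes `u`, which is one too many exactly for the colour of `u` when
        -- `u` is not in its own neighbourhood. Adding the surplus on the right avoids truncated
        -- subtraction and lets the vertices be compared one by one.
        neighbours+surplus : ∀ c → X-number u c + clique-number C (leader u) c ≡ neighbours C u c + ⟦ surplus c ⟧
        neighbours+surplus c = trans (number-exchange (λ w → go w (inX w) refl) vs)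
          (cong (neighbours C u c +_) (trans
            (number-one (allFin⁺ n) (∈-allFin u) λ w w≢u → cong (_∧ surplus c) (≢⇒== (w≢u ∘ ≡-sym)))
            (cong (λ b → ⟦ b ∧ surplus c ⟧) (to T-≡ (==-refl u)))))
          where
          own : ∀ a b → ⟦ b ⟧ ≡ ⟦ a ∧ b ⟧ + ⟦ not a ∧ b ⟧
          own true  b = ≡-sym (+-identityʳ _)
          own false b = refl
          member : ∀ w b → (u == w) ≡ b → inX w ≡ false →
                   ⟦ (leader w == leader u) ∧ (c == C w) ⟧ ≡ ⟦ adj u w ∧ (c == C w) ⟧ + ⟦ (u == w) ∧ surplus c ⟧
          member w true u≡w _ with refl ← ==-sound {i = u} {w} (from T-≡ u≡w) = begin
            ⟦ (leader u == leader u) ∧ (c == C u) ⟧ ≡⟨ cong (λ b → ⟦ b ∧ (c == C u) ⟧) (to T-≡ (==-refl (leader u))) ⟩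
            ⟦ c == C u ⟧                            ≡⟨ own (adj u u) (c == C u) ⟩
            ⟦ adj u u ∧ (c == C u) ⟧ + ⟦ surplus c ⟧
              ≡⟨ cong (λ b → ⟦ adj u u ∧ (c == C u) ⟧ + ⟦ b ∧ surplus c ⟧) (≡-sym u≡w) ⟩
            ⟦ adj u u ∧ (c == C u) ⟧ + ⟦ (u == u) ∧ surplus c ⟧ ∎
            where open ≡-Reasoning
          member w false u≢w w∉ = begin
            ⟦ (leader w == leader u) ∧ (c == C w) ⟧ ≡⟨ cong (λ b → ⟦ b ∧ (c == C w) ⟧) (≡-sym adj≡) ⟩
            ⟦ adj u w ∧ (c == C w) ⟧                ≡⟨ ≡-sym (+-identityʳ _) ⟩
            ⟦ adj u w ∧ (c == C w) ⟧ + 0            ≡⟨ cong (λ b → ⟦ adj u w ∧ (c == C w) ⟧ + ⟦ b ∧ surplus c ⟧) (≡-sym u≢w) ⟩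
            ⟦ adj u w ∧ (c == C w) ⟧ + ⟦ (u == w) ∧ surplus c ⟧ ∎
            where
            open ≡-Reasoning
            adj≡ : adj u w ≡ (leader w == leader u)
            adj≡ = trans (cluster u∉ w∉) (trans (cong (λ b → (leader w == leader u) ∧ (not b ∨ adj u u)) u≢w) (∧-identityʳ _))
          go : ∀ w b → inX w ≡ b → ⟦ inX w ∧ adj u w ∧ (toℕ c ≡ᵇ lookup X-colour w) ⟧ + ⟦ inClique (leader u) w ∧ (c == C w) ⟧ ≡
               ⟦ adj u w ∧ (c == C w) ⟧ + ⟦ (u == w) ∧ surplus c ⟧
          go w true eq = begin
            ⟦ inX w ∧ adj u w ∧ (toℕ c ≡ᵇ lookup X-colour w) ⟧ + ⟦ (not (inX w) ∧ (leader w == leader u)) ∧ (c == C w) ⟧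
              ≡⟨ cong (λ b → ⟦ b ∧ adj u w ∧ (toℕ c ≡ᵇ lookup X-colour w) ⟧ + ⟦ (not b ∧ (leader w == leader u)) ∧ (c == C w) ⟧) eq ⟩
            ⟦ adj u w ∧ (toℕ c ≡ᵇ lookup X-colour w) ⟧ + 0
              ≡⟨ cong (λ m → ⟦ adj u w ∧ (toℕ c ≡ᵇ m) ⟧ + 0) (agree w eq) ⟩
            ⟦ adj u w ∧ (c == C w) ⟧ + 0
              ≡⟨ cong (λ b → ⟦ adj u w ∧ (c == C w) ⟧ + ⟦ b ∧ surplus c ⟧) (≡-sym (≢⇒== distinct)) ⟩
            ⟦ adj u w ∧ (c == C w) ⟧ + ⟦ (u == w) ∧ surplus c ⟧ ∎
            where
            open ≡-Reasoning
            distinct : u ≢ w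
            distinct refl with () ← trans (≡-sym eq) u∉
          go w false eq = trans
            (cong (λ b → ⟦ b ∧ adj u w ∧ (toℕ c ≡ᵇ lookup X-colour w) ⟧ + ⟦ (not b ∧ (leader w == leader u)) ∧ (c == C w) ⟧) eq)
            (member w (u == w) refl eq)

        target≡ : ∀ c → toℕ (target u (C u) c) ≡ 1 + ⟦ surplus c ⟧
        target≡ c = go (surplus c)
          where
          go : ∀ b → toℕ (if b then suc {n = 2} (suc zero) else suc zero) ≡ 1 + ⟦ b ⟧
          go true  = refl
          go false = refl

        okay⇒unique : Okay C u → ∃[ c ] neighbours C u c ≡ 1
        okay⇒unique (c , eq) = c , +-cancelʳ-≡ ⟦ surplus c ⟧ _ _
          (≡-sym (trans (≡-sym (target≡ c)) (trans eq (neighbours+surplus c))))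

        unique⇒okay : ∃[ c ] neighbours C u c ≡ 1 → Okay C u
        unique⇒okay (c , eq) = c , trans (target≡ c)
          (trans (cong (_+ ⟦ surplus c ⟧) (≡-sym eq)) (≡-sym (neighbours+surplus c)))

  module _ {q} (Σ : BoundedList (State n k) q) (Σ-states : list Σ ≡ states)
           (cluster : ∀ {u w} → inX u ≡ false → inX w ≡ false →
                      adj u w ≡ (leader w == leader u) ∧ (not (u == w) ∨ adj u u)) where

    processed-all : ∀ X-colour u → inX u ≡ false → T (processed Σ Σ-states X-colour vs u)
    processed-all X-colour u eq = from T-∧ (subst (T ∘ not) (≡-sym eq) _ ,
      any-intro (λ v → leader u == v) (∈-allFin (leader u)) (==-refl (leader u)))

    answer-sound : T (answer Σ) → ∃[ C ] ConflictFree C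
    answer-sound t = C , free
      where
      found₀ : ∃[ c ] c ∈ cs × T (any (λ xc → any accepting (list (reachable Σ xc))) codes)
      found₀ = any-elim (λ _ → any (λ xc → any accepting (list (reachable Σ xc))) codes) cs t
      found₁ : ∃[ xc ] xc ∈ codes × T (any accepting (list (reachable Σ xc)))
      found₁ = any-elim (λ xc → any accepting (list (reachable Σ xc))) codes (proj₂ (proj₂ found₀))
      X-colour : Vec ℕ n
      X-colour = proj₁ found₁
      found₂ : ∃[ s ] s ∈ list (reachable Σ X-colour) × T (accepting s)
      found₂ = any-elim accepting (list (reachable Σ X-colour)) (proj₂ (proj₂ found₁))
      s : State n k
      s = proj₁ found₂
      decode : ∀ u → ∃[ c ] (inX u ≡ true → lookup X-colour u ≡ toℕ c)
      decode u = go (inX u) refl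
        where
        go : ∀ b → inX u ≡ b → ∃[ c ] (inX u ≡ true → lookup X-colour u ≡ toℕ c)
        -- Outside `X` the code says nothing; the colour from the outer quantifier of `answer` is a
        -- placeholder until the cliques are glued in.
        go false eq = proj₁ found₀ , λ eq′ → ⊥-elim (subst T (trans (≡-sym eq′) eq) _)
        go true  eq = proj₁ member , λ _ → proj₂ (proj₂ member)
          where
          member : ∃[ c ] c ∈ cs × lookup X-colour u ≡ toℕ c
          member = ∈-map⁻ toℕ (enumerate-inside 0 {as = map toℕ cs} X (proj₁ (proj₂ found₁)) u eq)
      explained : ∃[ C ] (∀ u → inX u ≡ true → C u ≡ proj₁ (decode u)) × Explains Σ Σ-states X-colour vs s C
      explained = reached-sound Σ Σ-states X-colour vs (allFin⁺ n) (proj₁ ∘ decode) (proj₁ (proj₂ found₂))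
      C : Colours
      C = proj₁ explained
      agree : Agrees Σ Σ-states X-colour C
      agree u eq = trans (proj₂ (decode u) eq) (cong toℕ (≡-sym (proj₁ (proj₂ explained) u eq)))
      free : ConflictFree C
      free v = go (inX v) refl
        where
        go : ∀ b → inX v ≡ b → ∃[ c ] neighbours C v c ≡ 1
        go false eq = okay⇒unique Σ Σ-states X-colour {C} agree cluster eq
          (proj₁ (proj₂ (proj₂ explained)) v (processed-all X-colour v eq))
        go true eq = c , trans (≡-sym (total-neighbours Σ Σ-states X-colour {C} agree v c eq))
          (≡-sym (cap-reflects (s≤s (s≤s z≤n))
            (trans (≡-sym (≡ᵇ⇒≡ _ _ (proj₂ (proj₂ one)))) (proj₂ (proj₂ (proj₂ explained)) (suc v) c))))
          where
          accepted : T (not (inX v) ∨ any (λ c → cell s (suc v) c ≡ᵇ 1) cs)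
          accepted = all-elim (λ z → isZero z ∨ not (lookup X̂ z) ∨ any (λ c → cell s z c ≡ᵇ 1) cs)
                              (proj₂ (proj₂ found₂)) (suc v)
          one : ∃[ c ] c ∈ cs × T (cell s (suc v) c ≡ᵇ 1)
          one = any-elim (λ c → cell s (suc v) c ≡ᵇ 1) cs
            (subst (λ b → T (not b ∨ any (λ c → cell s (suc v) c ≡ᵇ 1) cs)) eq accepted)
          c : Fin k
          c = proj₁ one

    -- The given vertex has a colour, which witnesses the outer quantifier of `answer`.
    answer-complete : Fin n → ∀ C → ConflictFree C → T (answer Σ)
    answer-complete v₀ C free =
      any-intro (λ _ → any (λ xc → any accepting (list (reachable Σ xc))) codes) (∈-allFin (C v₀))
        (any-intro (λ xc → any accepting (list (reachable Σ xc))) X-colour∈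
          (any-intro accepting (reached-complete Σ Σ-states X-colour C okay vs (allFin⁺ n)) accepted))
      where
      X-colour : Vec ℕ n
      X-colour = tabulate λ u → if inX u then toℕ (C u) else 0
      X-colour≡ : ∀ {u b} → inX u ≡ b → lookup X-colour u ≡ (if b then toℕ (C u) else 0)
      X-colour≡ {u} refl = lookup∘tabulate (λ u → if inX u then toℕ (C u) else 0) u
      X-colour∈ : X-colour ∈ codes
      X-colour∈ = enumerate-complete 0 X X-colour
        (λ u eq → subst (_∈ map toℕ cs) (≡-sym (X-colour≡ eq)) (∈-map⁺ toℕ (∈-allFin (C u))))
        (λ u eq → X-colour≡ eq)
      agree : Agrees Σ Σ-states X-colour C
      agree u = X-colour≡
      okay : ∀ u → inX u ≡ false → Okay Σ Σ-states X-colour C u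
      okay u eq = unique⇒okay Σ Σ-states X-colour {C} agree cluster eq (free u)
      s : State n k
      s = summary Σ Σ-states X-colour C okay vs
      accepted : T (accepting s)
      accepted = all-intro (λ z → isZero z ∨ not (lookup X̂ z) ∨ any (λ c → cell s z c ≡ᵇ 1) cs) position
        where
        go : ∀ x b → inX x ≡ b → T (not (inX x) ∨ any (λ c → cell s (suc x) c ≡ᵇ 1) cs)
        go x false eq = subst (λ b → T (not b ∨ any (λ c → cell s (suc x) c ≡ᵇ 1) cs)) (≡-sym eq) _
        go x true  eq = subst (λ b → T (not b ∨ any (λ c → cell s (suc x) c ≡ᵇ 1) cs)) (≡-sym eq)
          (any-intro (λ c → cell s (suc x) c ≡ᵇ 1) (∈-allFin c) (≡⇒≡ᵇ _ _ (begin
            cell s (suc x) c ≡⟨ cell-state (total Σ Σ-states X-colour vs C) (suc x) c ⟩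
            cap (total Σ Σ-states X-colour vs C (suc x) c)
              ≡⟨ cong cap (total-neighbours Σ Σ-states X-colour {C} agree x c eq) ⟩
            cap (neighbours C x c) ≡⟨ cong cap (proj₂ (free x)) ⟩
            1 ∎)))
          where
          open ≡-Reasoning
          c : Fin k
          c = proj₁ (free x)
        position : ∀ z → T (isZero z ∨ not (lookup X̂ z) ∨ any (λ c → cell s z c ≡ᵇ 1) cs)
        position zero    = _
        position (suc x) = go x (inX x) refl

-- Cliques outside the modulator and their leaders

T-ext : ∀ {b c} → (T b → T c) → (T c → T b) → b ≡ c
T-ext {true}  {true}  f g = refl
T-ext {true}  {false} f g = ⊥-elim (f _)
T-ext {false} {true}  f g = ⊥-elim (g _)
T-ext {false} {false} f g = refl

T-not : ∀ {b} → T (not b) → b ≡ false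
T-not {false} _ = refl

first : ∀ {A : Set} → (A → Bool) → A → List A → A
first P = foldr (λ a r → if P a then a else r)

first-satisfies : ∀ {A : Set} (P : A → Bool) {d a as} → a ∈ as → T (P a) → T (P (first P d as))
first-satisfies P {as = b ∷ as} a∈ Pa with P b in eq
... | true = from T-≡ eq
first-satisfies P {as = b ∷ as} (here refl) Pa | false = ⊥-elim (subst T eq Pa)
first-satisfies P {as = b ∷ as} (there a∈)  Pa | false = first-satisfies P a∈ Pa

-- The defaults may differ because a hit is guaranteed. So two vertices of one clique get the same
-- leader, although each is its own default.
first-cong : ∀ {A : Set} {P Q : A → Bool} {d e a as} → (∀ b → P b ≡ Q b) → a ∈ as → T (P a) →
             first P d as ≡ first Q e as
first-cong {P = P} {Q} {as = b ∷ as} eq a∈ Pa with P b in eqP | Q b | eq b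
... | true | _ | refl = refl
first-cong {as = b ∷ as} eq (here refl) Pa | false | _ | refl = ⊥-elim (subst T eqP Pa)
first-cong {as = b ∷ as} eq (there a∈)  Pa | false | _ | refl = first-cong eq a∈ Pa

module Cliques {n m : ℕ} (A : Vec (Vec Bool n) n) (X : Vec Bool n) (k : ℕ) (part : Fin n → Fin m)
  (cluster : ∀ {u w} → lookup X u ≡ false → lookup X w ≡ false → u ≢ w →
             T (lookup (lookup A u) w) ⇔ part u ≡ part w) where

  open Algorithm A X k using (adj; inX; mate; leader; vs)

  mate-intro : ∀ {w u} → inX w ≡ false → inX u ≡ false → part w ≡ part u → T (mate w u)
  mate-intro {w} {u} w∉ u∉ eq = from T-∧ (subst (T ∘ not) (≡-sym w∉) _ ,
    from T-∧ (subst (T ∘ not) (≡-sym u∉) _ , from (T-∨ {w == u}) adjacent))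
    where
    adjacent : T (w == u) ⊎ T (adj w u)
    adjacent with w ≟ u
    ... | yes refl = inj₁ (==-refl w)
    ... | no  w≢u  = inj₂ (from (cluster w∉ u∉ w≢u) eq)

  mate-elim : ∀ {w u} → T (mate w u) → inX w ≡ false × part w ≡ part u
  mate-elim {w} {u} t = w∉ , same (w ≟ u)
    where
    w∉ : inX w ≡ false
    w∉ = T-not (proj₁ (to (T-∧ {not (inX w)}) t))
    u∉ : inX u ≡ false
    u∉ = T-not (proj₁ (to (T-∧ {not (inX u)}) (proj₂ (to (T-∧ {not (inX w)}) t))))
    same : Dec (w ≡ u) → part w ≡ part u
    same (yes w≡u) = cong part w≡u
    same (no  w≢u) with to (T-∨ {w == u}) (proj₂ (to (T-∧ {not (inX u)}) (proj₂ (to (T-∧ {not (inX w)}) t))))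
    ... | inj₁ w==u = contradiction (==-sound w==u) w≢u
    ... | inj₂ wu   = to (cluster w∉ u∉ w≢u) wu

  leader-mate : ∀ {u} → inX u ≡ false → T (mate (leader u) u)
  leader-mate {u} u∉ = first-satisfies (λ w → mate w u) {d = u} {a = u} {as = vs} (∈-allFin u) (mate-intro u∉ u∉ refl)

  leader∉ : ∀ {u} → inX u ≡ false → inX (leader u) ≡ false
  leader∉ u∉ = proj₁ (mate-elim (leader-mate u∉))

  part-leader : ∀ {u} → inX u ≡ false → part (leader u) ≡ part u
  part-leader u∉ = proj₂ (mate-elim (leader-mate u∉))

  leader-cong : ∀ {u w} → inX u ≡ false → inX w ≡ false → part u ≡ part w → leader u ≡ leader w
  leader-cong {u} {w} u∉ w∉ eq = first-cong {P = λ v → mate v u} {Q = λ v → mate v w} {d = u} {e = w} {a = u} {as = vs}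
    (λ v → T-ext (λ t → mate-intro (proj₁ (mate-elim {v} {u} t)) w∉ (trans (proj₂ (mate-elim {v} {u} t)) eq))
                 (λ t → mate-intro (proj₁ (mate-elim {v} {w} t)) u∉ (trans (proj₂ (mate-elim {v} {w} t)) (≡-sym eq))))
    (∈-allFin u) (mate-intro u∉ u∉ refl)

  leader-idem : ∀ {u} → inX u ≡ false → leader (leader u) ≡ leader u
  leader-idem u∉ = leader-cong (leader∉ u∉) u∉ (part-leader u∉)

  -- One formula for both problems: off the diagonal, adjacency means a common leader, and the
  -- diagonal entry, which tells open from closed neighbourhoods, reproduces itself.
  adj-leader : ∀ {u w} → inX u ≡ false → inX w ≡ false →
               adj u w ≡ (leader w == leader u) ∧ (not (u == w) ∨ adj u u)
  adj-leader {u} {w} u∉ w∉ = go (u ≟ w)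
    where
    go : Dec (u ≡ w) → adj u w ≡ (leader w == leader u) ∧ (not (u == w) ∨ adj u u)
    go (yes refl) = ≡-sym (cong₂ (λ b c → b ∧ (not c ∨ adj u u)) (to T-≡ (==-refl (leader u))) (to T-≡ (==-refl u)))
    go (no u≢w) = trans
      (T-ext (λ t → subst (λ l → T (l == leader u)) (leader-cong u∉ w∉ (to (cluster u∉ w∉ u≢w) t)) (==-refl (leader u)))
             (λ t → from (cluster u∉ w∉ u≢w) (trans (≡-sym (part-leader u∉))
                      (trans (cong part (≡-sym (==-sound t))) (part-leader w∉)))))
      (≡-sym (trans (cong (λ b → (leader w == leader u) ∧ (not b ∨ adj u u)) (≢⇒== u≢w)) (∧-identityʳ _)))

-- The palette

number-witness : ∀ {A : Set} (P : A → Bool) as → number P as ≢ 0 → ∃[ a ] T (P a)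
number-witness P []       ≢0 = contradiction refl ≢0
number-witness P (a ∷ as) ≢0 with P a in eq
... | true  = a , from T-≡ eq
... | false = number-witness P as ≢0

size≡number : ∀ {n} (p : Subset n) → ∣ p ∣ ≡ number (lookup p) (allFin n)
size≡number p = go p (lookup p) id (λ _ → refl)
  where
  go : ∀ {A : Set} {m} (p : Subset m) (P : A → Bool) (f : Fin m → A) → (∀ i → lookup p i ≡ P (f i)) →
       ∣ p ∣ ≡ number P (List.tabulate f)
  go []          P f eq = refl
  go (true ∷ p)  P f eq = cong₂ (λ b m → ⟦ b ⟧ + m) (eq zero) (go p P (f ∘ suc) (eq ∘ suc))
  go (false ∷ p) P f eq = cong₂ (λ b m → ⟦ b ⟧ + m) (eq zero) (go p P (f ∘ suc) (eq ∘ suc))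

length-filter≡number : ∀ {A : Set} (P : A → Bool) as → length (filterᵇ P as) ≡ number P as
length-filter≡number P [] = refl
length-filter≡number P (a ∷ as) with P a
... | true  = cong suc (length-filter≡number P as)
... | false = length-filter≡number P as

module _ {n} (p : Subset n) where
  private
    members : List (Fin n)
    members = filterᵇ (lookup p) (allFin n)

    members-size : length members ≡ ∣ p ∣
    members-size = trans (length-filter≡number (lookup p) (allFin n)) (≡-sym (size≡number p))

    member∈ : ∀ {x} → lookup p x ≡ true → x ∈ members
    member∈ {x} eq = filter-intro (lookup p) (∈-allFin x) (from T-≡ eq)

  rank : ∀ {x} → lookup p x ≡ true → Fin ∣ p ∣
  rank eq = Fin.cast members-size (Any.index (member∈ eq))

  rank-injective : ∀ {x y} (x∈ : lookup p x ≡ true) (y∈ : lookup p y ≡ true) → rank x∈ ≡ rank y∈ → x ≡ y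
  rank-injective x∈ y∈ eq = trans (lookup-index (member∈ x∈))
    (trans (cong (List.lookup members) (toℕ-injective (begin
      toℕ (Any.index (member∈ x∈)) ≡⟨ ≡-sym (Fin.toℕ-cast members-size _) ⟩
      toℕ (rank x∈)                ≡⟨ cong toℕ eq ⟩
      toℕ (rank y∈)                ≡⟨ Fin.toℕ-cast members-size _ ⟩
      toℕ (Any.index (member∈ y∈)) ∎)))
    (≡-sym (lookup-index (member∈ y∈))))
    where open ≡-Reasoning

-- Every x ∈ X and one chosen neighbour of each x ∈ X get a colour of their
-- own. In a clique, the leader gets colour 0, a neighbour of the leader
-- colour 1 and the rest colour 2, unless they have a colour of their own.
module Palette {n : ℕ} (A : Vec (Vec Bool n) n) (X : Vec Bool n)
  (leader : Fin n → Fin n)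
  (leader∉ : ∀ {u} → lookup X u ≡ false → lookup X (leader u) ≡ false)
  (leader-idem : ∀ {u} → lookup X u ≡ false → leader (leader u) ≡ leader u)
  (adj-leader : ∀ {u w} → lookup X u ≡ false → lookup X w ≡ false → lookup (lookup A u) w ≡
                (leader w == leader u) ∧ (not (u == w) ∨ lookup (lookup A u) u))
  (neighbour : Fin n → Fin n)
  (adj-neighbour : ∀ v → T (lookup (lookup A v) (neighbour v))) where

  private
    adj : Fin n → Fin n → Bool
    adj u v = lookup (lookup A u) v

    inX : Fin n → Bool
    inX = lookup X

    d : ℕ
    d = ∣ X ∣

  Chosen : Fin n → Set
  Chosen w = ∃[ x ] inX x ≡ true × neighbour x ≡ w

  data Role (w : Fin n) : Set where
    modulator : inX w ≡ true → Role w
    chosen    : Chosen w → Role w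
    lead      : inX w ≡ false → ¬ Chosen w → leader w ≡ w → Role w
    second    : inX w ≡ false → ¬ Chosen w → leader w ≢ w → neighbour (leader w) ≡ w → Role w
    other     : inX w ≡ false → ¬ Chosen w → leader w ≢ w → neighbour (leader w) ≢ w → Role w

  role : ∀ w → Role w
  role w with inX w in eq | any? (λ x → (inX x Bool.≟ true) ×-dec (neighbour x ≟ w))
  ... | true  | _ = modulator eq
  ... | false | yes ch = chosen ch
  ... | false | no ¬ch with leader w ≟ w | neighbour (leader w) ≟ w
  ...   | yes l | _     = lead eq ¬ch l
  ...   | no ¬l | yes s = second eq ¬ch ¬l s
  ...   | no ¬l | no ¬s = other eq ¬ch ¬l ¬s

  Kind : Set
  Kind = Fin 3 ⊎ (Fin d × Fin 2)

  kind : ∀ {w} → Role w → Kind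
  kind (modulator x∈)         = inj₂ (rank X x∈ , zero)
  kind (chosen (x , x∈ , _))  = inj₂ (rank X x∈ , suc zero)
  kind (lead _ _ _)           = inj₁ zero
  kind (second _ _ _ _)       = inj₁ (suc zero)
  kind (other _ _ _ _)        = inj₁ (suc (suc zero))

  Private : ∀ {w} → Role w → Set
  Private r = ∃[ p ] kind r ≡ inj₂ p

  -- A private kind names a vertex of `X` by its rank, and that vertex determines the owner of the
  -- colour: itself or its chosen neighbour.
  private-unique : ∀ {w u} (r : Role w) (s : Role u) → Private s → kind r ≡ kind s → w ≡ u
  private-unique (modulator x∈) (modulator y∈) _ eq = rank-injective X x∈ y∈ (cong proj₁ (inj₂-injective eq))
  private-unique (chosen (x , x∈ , x↦)) (chosen (y , y∈ , y↦)) _ eq =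
    trans (≡-sym x↦) (trans (cong neighbour (rank-injective X x∈ y∈ (cong proj₁ (inj₂-injective eq)))) y↦)
  private-unique (modulator _) (chosen _) _ ()
  private-unique (chosen _) (modulator _) _ ()
  private-unique (lead _ _ _) s (_ , eq′) eq with () ← trans eq eq′
  private-unique (second _ _ _ _) s (_ , eq′) eq with () ← trans eq eq′
  private-unique (other _ _ _ _) s (_ , eq′) eq with () ← trans eq eq′

  encode : Kind → Fin (palette d)
  encode (inj₁ i)       = i ↑ˡ (d * 2)
  encode (inj₂ (i , j)) = 3 ↑ʳ combine i j

  splitAt-encode : ∀ s → splitAt 3 (encode s) ≡ Sum.map₂ (λ (i , j) → combine i j) s
  splitAt-encode (inj₁ i) = splitAt-↑ˡ 3 i (d * 2)
  splitAt-encode (inj₂ (i , j)) = splitAt-↑ʳ 3 (d * 2) (combine i j)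

  encode-injective : ∀ {s t} → encode s ≡ encode t → s ≡ t
  encode-injective {s} {t} eq = go s t (trans (≡-sym (splitAt-encode s)) (trans (cong (splitAt 3) eq) (splitAt-encode t)))
    where
    go : ∀ s t → Sum.map₂ (λ (i , j) → combine i j) s ≡ Sum.map₂ (λ (i , j) → combine i j) t → s ≡ t
    go (inj₁ i) (inj₁ i′) refl = refl
    go (inj₂ (i , j)) (inj₂ (i′ , j′)) eq with refl , refl ← combine-injective i j i′ j′ (inj₂-injective eq) = refl

  paint : Fin n → Fin (palette d)
  paint w = encode (kind (role w))

  Distinguished : Fin n → Fin n → Set
  Distinguished v h = T (adj v h) × (∀ w → T (adj v w) → kind (role w) ≡ kind (role h) → w ≡ h)

  same-leader : ∀ {v w} → inX v ≡ false → inX w ≡ false → T (adj v w) → leader w ≡ leader v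
  same-leader v∉ w∉ vw = ==-sound (proj₁ (to T-∧ (subst T (adj-leader v∉ w∉) vw)))

  distinguish-private : ∀ {v h} → T (adj v h) → Private (role h) → Distinguished v h
  distinguish-private {h = h} vh pr = vh , λ w _ eq → private-unique (role w) (role h) pr eq

  chosen-private : ∀ {w} (r : Role w) → Chosen w → Private r
  chosen-private (modulator _)     ch = _ , refl
  chosen-private (chosen _)        ch = _ , refl
  chosen-private (lead _ ¬ch _)    ch = contradiction ch ¬ch
  chosen-private (second _ ¬ch _ _) ch = contradiction ch ¬ch
  chosen-private (other _ ¬ch _ _) ch = contradiction ch ¬ch

  -- Outside `X`, `v` sees only its own clique, where at most the leader has colour 0, and vertices
  -- of `X` have private colours. If the leader itself has a private colour, it is distinguished by
  -- that.
  distinguish-leader : ∀ {v} → inX v ≡ false → T (adj v (leader v)) → Distinguished v (leader v)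
  distinguish-leader {v} v∉ vl = go (role (leader v)) refl
    where
    only : ∀ {w} (r : Role w) → T (adj v w) → kind r ≡ inj₁ zero → w ≡ leader v
    only (lead w∉ _ l) vw _ = trans (≡-sym l) (same-leader v∉ w∉ vw)
    go : ∀ r → role (leader v) ≡ r → Distinguished v (leader v)
    go (modulator l∈)    eq = contradiction (trans (≡-sym l∈) (leader∉ v∉)) λ ()
    go (chosen ch)       eq = distinguish-private vl (chosen-private (role (leader v)) ch)
    go (lead _ _ _)      eq = vl , λ w vw k≡ → only (role w) vw (trans k≡ (cong kind eq))
    go (second _ _ ¬l _) eq = contradiction (leader-idem v∉) ¬l
    go (other _ _ ¬l _)  eq = contradiction (leader-idem v∉) ¬l

  -- This is what colour 1 is for: a leader that does not see itself looks at its selected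
  -- neighbour. That neighbour is private or the only one in the clique with colour 1; it is no
  -- leader, since it would then be `v`.
  distinguish-neighbour : ∀ {v} → inX v ≡ false → leader v ≡ v → ¬ T (adj v v) → Distinguished v (neighbour v)
  distinguish-neighbour {v} v∉ l ¬vv = go (role (neighbour v)) refl
    where
    vh : T (adj v (neighbour v))
    vh = adj-neighbour v
    only : ∀ {w} (r : Role w) → T (adj v w) → kind r ≡ inj₁ (suc zero) → w ≡ neighbour v
    only (second w∉ _ _ s) vw _ = trans (≡-sym s) (cong neighbour (trans (same-leader v∉ w∉ vw) l))
    go : ∀ r → role (neighbour v) ≡ r → Distinguished v (neighbour v)
    go (modulator _)       eq = distinguish-private vh (_ , cong kind eq)
    go (chosen _)          eq = distinguish-private vh (_ , cong kind eq)
    go (lead h∉ _ h-lead)  eq = contradiction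
      (subst (T ∘ adj v) (trans (≡-sym h-lead) (trans (same-leader v∉ h∉ vh) l)) vh) ¬vv
    go (second _ _ _ _)    eq = vh , λ w vw k≡ → only (role w) vw (trans k≡ (cong kind eq))
    go (other h∉ _ _ ¬s)   eq = contradiction (cong neighbour (trans (same-leader v∉ h∉ vh) l)) ¬s

  distinguish : ∀ v → ∃[ h ] Distinguished v h
  distinguish v = go (inX v) refl
    where
    go : ∀ b → inX v ≡ b → ∃[ h ] Distinguished v h
    go true  v∈ = neighbour v , distinguish-private (adj-neighbour v)
      (chosen-private (role (neighbour v)) (v , v∈ , refl))
    go false v∉ = go′ (adj v (leader v)) refl
      where
      go′ : ∀ b → adj v (leader v) ≡ b → ∃[ h ] Distinguished v h
      go′ true  eq = leader v , distinguish-leader v∉ (from T-≡ eq)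
      go′ false eq = neighbour v , distinguish-neighbour v∉ (≡-sym v≡l) λ vv →
        subst T eq (subst (T ∘ adj v) v≡l vv)
        where
        -- A vertex other than its leader shares a clique with it and hence sees it, contrary to
        -- `eq`.
        v≡l : v ≡ leader v
        v≡l with v ≟ leader v
        ... | yes v≡ = v≡
        ... | no  v≢ = ⊥-elim (subst T (trans (≡-sym (adj-leader v∉ (leader∉ v∉))) eq)
          (from T-∧ (subst (λ l → T (l == leader v)) (≡-sym (leader-idem v∉)) (==-refl (leader v)) ,
                     from (T-∨ {not (v == leader v)}) (inj₁ (subst (T ∘ not) (≡-sym (≢⇒== v≢)) _)))))

  paint-unique : ∀ v → ∃[ c ] number (λ u → adj v u ∧ (c == paint u)) (allFin n) ≡ 1
  paint-unique v = paint h , trans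
    (number-one (allFin⁺ n) (∈-allFin h) λ w w≢h → not-other w w≢h (adj v w ∧ (paint h == paint w)) refl)
    (cong ⟦_⟧ (to T-≡ (from T-∧ (proj₁ (proj₂ (distinguish v)) , ==-refl (paint h)))))
    where
    h : Fin n
    h = proj₁ (distinguish v)
    not-other : ∀ w → w ≢ h → ∀ b → adj v w ∧ (paint h == paint w) ≡ b → adj v w ∧ (paint h == paint w) ≡ false
    not-other w w≢h false eq = eq
    not-other w w≢h true  eq = contradiction
      (proj₂ (proj₂ (distinguish v)) w (proj₁ both) (encode-injective (≡-sym (==-sound (proj₂ both))))) w≢h
      where
      both : T (adj v w) × T (paint h == paint w)
      both = to (T-∧ {adj v w}) (from T-≡ eq)

-- From the dynamic program to fixed-parameter tractability

unique-number : ∀ {n k} (C : Colouring n k) U c →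
                ∣ U ∩ colourClass C c ∣ ≡ number (λ u → lookup U u ∧ (c == C u)) (allFin n)
unique-number {n} C U c = trans (size≡number (U ∩ colourClass C c)) (number-cong (allFin n) λ {u} _ →
  trans (lookup-zipWith _∧_ u U (colourClass C c))
        (cong (lookup U u ∧_) (trans (lookup∘tabulate (λ u → does (C u ≟ c)) u) (same u))))
  where
  same : ∀ u → does (C u ≟ c) ≡ (c == C u)
  same u with C u ≟ c
  ... | yes refl = ≡-sym (to T-≡ (==-refl (C u)))
  ... | no  Cu≢c = ≡-sym (≢⇒== (Cu≢c ∘ ≡-sym))

^-distribʳ-* : ∀ m n c → (m * n) ^ c ≡ m ^ c * n ^ c
^-distribʳ-* m n zero    = refl
^-distribʳ-* m n (suc c) = trans (cong (m * n *_) (^-distribʳ-* m n c)) (interchange m n (m ^ c) (n ^ c))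
  where
  interchange : ∀ a b x y → (a * b) * (x * y) ≡ (a * x) * (b * y)
  interchange = solve-∀

reflects : ∀ {P : Set} b → (T b → P) → (P → T b) → Reflects P b
reflects true  f g = ofʸ (f _)
reflects false f g = ofⁿ g

module Solve (neighbourhood : ∀ {n} → Graph n → Fin n → Subset n)
  (adjacent : ∀ {n} (G : Graph n) {u w} → u ≢ w → (w ∈ₛ neighbourhood G u) ⇔ Adj G u w)
  (adjacencyC : Input ⟶ Const (VecO (VecO BoolO N̂) N̂) (λ I → tabulate (neighbourhood (I.G I)))) where

  IsCF : ∀ {n k} → Graph n → Colouring n k → Set
  IsCF G C = ∀ v → HasUniqueColour C (neighbourhood G v)

  decider : Input ⟶ BoolO
  decider = decideC (λ I → tabulate (neighbourhood (I.G I))) adjacencyC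

  module _ (I : CFInstance) where
    open CFInstance I renaming (G to G′; X to X′; k to k′)

    A : Vec (Vec Bool (I.n I)) (I.n I)
    A = tabulate (neighbourhood G′)

    row≡ : ∀ v → lookup A v ≡ neighbourhood G′ v
    row≡ v = lookup∘tabulate (neighbourhood G′) v

    module At (k : ℕ) = Correctness A X′ k

    unique≡ : ∀ {k} (C : Colouring (I.n I) k) v c →
              At.neighbours k C v c ≡ ∣ neighbourhood G′ v ∩ colourClass C c ∣
    unique≡ C v c = trans (cong (λ U → number (λ u → lookup U u ∧ (c == C u)) (allFin _)) (row≡ v))
                          (≡-sym (unique-number C (neighbourhood G′ v) c))

    toCF : ∀ {k} {C : Colouring (I.n I) k} → At.ConflictFree k C → IsCF G′ C
    toCF {C = C} free v = proj₁ (free v) , trans (≡-sym (unique≡ C v _)) (proj₂ (free v))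

    fromCF : ∀ {k} {C : Colouring (I.n I) k} → IsCF G′ C → At.ConflictFree k C
    fromCF {C = C} cf v = proj₁ (cf v) , trans (unique≡ C v _) (proj₂ (cf v))

    part : Fin (I.n I) → Fin (proj₁ modulator)
    part = proj₁ (proj₂ modulator)

    ∉X : ∀ {u} → lookup X′ u ≡ false → u ∉ₛ X′
    ∉X eq u∈ with () ← trans (≡-sym eq) ([]=⇒lookup u∈)

    cluster : ∀ {u w} → lookup X′ u ≡ false → lookup X′ w ≡ false → u ≢ w →
              T (lookup (lookup A u) w) ⇔ part u ≡ part w
    cluster {u} {w} u∉ w∉ u≢w = mk⇔
      (λ t → to parts (to (adjacent G′ u≢w) (lookup⇒[]= w _ (trans (cong (λ U → lookup U w) (≡-sym (row≡ u))) (to T-≡ t)))))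
      (λ eq → from T-≡ (trans (cong (λ U → lookup U w) (row≡ u)) ([]=⇒lookup (from (adjacent G′ u≢w) (from parts eq)))))
      where
      parts : Adj G′ u w ⇔ part u ≡ part w
      parts = proj₂ (proj₂ modulator) (∉X u∉) (∉X w∉) u≢w

    recolour : ∀ {k l} → k ≤ l → (C : Colouring (I.n I) k) → At.ConflictFree k C → ∃[ C′ ] At.ConflictFree l C′
    recolour k≤l C free = (λ u → inject≤ (C u) k≤l) , λ v → inject≤ (proj₁ (free v)) k≤l ,
      trans (number-cong (allFin _) λ {u} _ → cong (lookup (lookup A v) u ∧_)
              (cong₂ _≡ᵇ_ (toℕ-inject≤ (proj₁ (free v)) k≤l) (toℕ-inject≤ (C u) k≤l)))
            (proj₂ (free v))

    -- If `k` reaches the palette, the colouring is discarded except for one fact: a unique colour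
    -- in every neighbourhood yields the neighbour of every vertex from which `Palette` starts.
    fewer-colours : ∀ (C : Colouring (I.n I) k′) → At.ConflictFree k′ C → ∃[ C′ ] At.ConflictFree (colours I) C′
    fewer-colours C free with ≤-total k′ (palette ∣ X′ ∣)
    ... | inj₁ k≤ = recolour (⊓-glb ≤-refl k≤) C free
    ... | inj₂ ≥p = recolour (⊓-glb ≥p ≤-refl) P.paint P.paint-unique
      where
      witness : ∀ v → ∃[ u ] T (lookup (lookup A v) u ∧ (proj₁ (free v) == C u))
      witness v = number-witness (λ u → lookup (lookup A v) u ∧ (proj₁ (free v) == C u)) (allFin _)
        λ eq → contradiction (trans (≡-sym eq) (proj₂ (free v))) λ ()
      module K = Cliques A X′ k′ part cluster
      module P = Palette A X′ (Algorithm.leader A X′ k′) K.leader∉ K.leader-idem K.adj-leader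
        (proj₁ ∘ witness) (λ v → proj₁ (to T-∧ (proj₂ (witness v))))

    states : BoundedList _ _
    states = bounded (Algorithm.states A X′ (colours I)) (states≤ I)
      where open Tables (tables (λ I → tabulate (neighbourhood (I.G I))) adjacencyC)

    answer : Bool
    answer = Algorithm.answer A X′ (colours I) states

    module K = Cliques A X′ (colours I) part cluster

    answer-reflects : Reflects (∃[ C ] IsCF {k = k′} G′ C) answer
    answer-reflects = reflects answer
      (λ t → let C , free = At.answer-sound (colours I) states refl K.adj-leader t
                 C′ , free′ = recolour (m⊓n≤m k′ _) C free
             in C′ , toCF free′)
      (λ (C , cf) → let C′ , free = fewer-colours C (fromCF cf)
                    in At.answer-complete (colours I) states refl K.adj-leader (fromℕ< (1≤n I)) C′ free)

    -- All components of `Input` are determined by the instance, so it has a single element, and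
    -- this element encodes to `encodeCF I` by computation.
    decided : prog decider ⟨ encodeCF I ⟩⇓ ⌜ answer ⌝ᵇ within value (time decider) I
    decided = subst (λ b → prog decider ⟨ encodeCF I ⟩⇓ ⌜ b ⌝ᵇ within value (time decider) I)
      (decideC-fun (λ I → tabulate (neighbourhood (I.G I))) adjacencyC I (tt , (tt , tt)))
      (run decider I (tt , (tt , tt)))

  c : ℕ
  c = degree (time decider)

  -- The factor of `weight I ^ c` that depends on `d` alone; the other factor is `n ^ c`.
  f : ℕ → ℕ
  f d = 2 ^ (exponent d * c)

  computable : Computable f
  computable = Computable-resp (λ d → cong (2 ^_) (+-identityʳ (exponent d * c)))
    (Computable-∘ Computable-2^ (Computable-∘ (Computable-* c 0) (Computable-∘ Computable-2^ (Computable-* 4 6))))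

  time≤ : ∀ I → value (time decider) I ≤ f ∣ I.X I ∣ * I.n I ^ c
  time≤ I = begin
    value (time decider) I                          ≤⟨ value≤ (time decider) I ⟩
    (2 ^ exponent ∣ I.X I ∣ * I.n I) ^ c            ≡⟨ ^-distribʳ-* (2 ^ exponent ∣ I.X I ∣) (I.n I) c ⟩
    (2 ^ exponent ∣ I.X I ∣) ^ c * I.n I ^ c        ≡⟨ cong (_* I.n I ^ c) (^-*-assoc 2 (exponent ∣ I.X I ∣) c) ⟩
    f ∣ I.X I ∣ * I.n I ^ c                         ∎
    where open ≤-Reasoning

  solved : FixedParameterTractable (CFProblem IsCF)
  solved = f , computable , prog decider , c , λ I →
    let t , r , t≤ = decided I
    in answer I , t , r , answer-reflects I , ≤-trans t≤ (time≤ I)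

open-adjacent : ∀ {n} (G : Graph n) {u w} → u ≢ w → (w ∈ₛ N G u) ⇔ Adj G u w
open-adjacent G _ = mk⇔ (λ w∈ → w∈) (λ w∈ → w∈)

closed-adjacent : ∀ {n} (G : Graph n) {u w} → u ≢ w → (w ∈ₛ N[_] G u) ⇔ Adj G u w
closed-adjacent G {u} {w} u≢w = mk⇔ open-part (λ w∈ → x∈p∪q⁺ (inj₁ w∈))
  where
  open-part : w ∈ₛ N[_] G u → Adj G u w
  open-part w∈ with x∈p∪q⁻ (N G u) ⁅ u ⁆ w∈
  ... | inj₁ w∈N = w∈N
  ... | inj₂ w∈u = contradiction (≡-sym (x∈⁅y⁆⇒x≡y u w∈u)) u≢w

theorem1 : FixedParameterTractable CF-CN-Colouring × FixedParameterTractable CF-ON-Colouring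
theorem1 = Solve.solved N[_] closed-adjacent closedMatrixC , Solve.solved N open-adjacent openMatrixC
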